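{- There exists a polynomial-time $1.92$-approximation algorithm in each of the following cases: (i) Cluster Deletion when the clique number of the input graph is bounded by a constant; (ii) Constrained Clustering when all clusters are required to have bounded size. That is, for every fixed constant $k$, there are polynomial-time $1.92$-approximation algorithms for Cluster Deletion restricted to input graphs whose maximum clique size is at most $k$, and for Constrained Clustering in which every cluster of a feasible solution is required to have size at most $k$.
   Context: All graphs are finite, undirected and simple. A cluster graph is a graph in which every connected component is a clique; its components are called clusters. Cluster Deletion: given a graph $G$, find a minimum-size set $E_-\subseteq E(G)$ such that $G-E_-$ is a cluster graph. Cluster Editing: given a graph $G$, find a minimum-size set of vertex pairs (edges to delete and non-edges to add) whose modification turns $G$ into a cluster graph. Constrained Clustering: given a graph $G$ together with a set $F$ of friendly pairs and a set $H$ of hostile pairs of vertices, find a minimum-size cluster editing solution in which both vertices of every friendly pair are in the same cluster and the two vertices of every hostile pair are in different clusters. The cost of a clustering (a partition of $V(G)$) is the number of edges of $G$ between different clusters plus the number of non-edges of $G$ inside clusters. A $1.92$-approximation algorithm outputs, on every instance having a feasible solution, a feasible solution of cost at most $1.92$ times the minimum cost of a feasible solution. -}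

module Defs where

open import Data.Bool using (Bool; true; false; _∧_; not; _xor_; T; if_then_else_)
open import Data.Fin using (Fin; toℕ)
open import Data.Fin.Subset using (Subset; _∈_; ∣_∣)
open import Data.Integer using (+_)
open import Data.List using (List; []; _∷_; _++_; length; lookup; map; filterᵇ; allFin; cartesianProduct)
open import Data.Nat using (ℕ; zero; suc; _+_; _*_; _∸_; _^_; _≤_; _<ᵇ_; _≡ᵇ_)
open import Data.Product using (Σ; ∃; ∃-syntax; _×_; _,_)
open import Data.Rational.Unnormalised as ℚ using (ℚᵘ)
open import Function.Bundles using (_⇔_)
open import Relation.Binary.Construct.Closure.ReflexiveTransitive using (Star)
open import Relation.Binary.PropositionalEquality using (_≡_; _≢_; refl; cong₂)
open import Relation.Nullary using (¬_)

-- A set of unordered pairs of distinct elements of Fin n.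
record PairSet (n : ℕ) : Set where
  field
    has        : Fin n → Fin n → Bool
    has-sym    : ∀ u v → has u v ≡ has v u
    has-irrefl : ∀ v → has v v ≡ false

open PairSet public

-- A finite simple graph on the vertex set Fin n is its edge set.
Graph : ℕ → Set
Graph = PairSet

module _ {n : ℕ} where

  Adj : PairSet n → Fin n → Fin n → Set
  Adj P u v = T (has P u v)

  infix 4 _⊆_
  _⊆_ : PairSet n → PairSet n → Set
  P ⊆ Q = ∀ u v → Adj P u v → Adj Q u v

  infixl 6 _∖_ _△_
  _∖_ : PairSet n → PairSet n → PairSet n
  has        (P ∖ Q) u v = has P u v ∧ not (has Q u v)
  has-sym    (P ∖ Q) u v = cong₂ (λ a b → a ∧ not b) (has-sym P u v) (has-sym Q u v)
  has-irrefl (P ∖ Q) v rewrite has-irrefl P v = refl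

  _△_ : PairSet n → PairSet n → PairSet n
  has        (P △ Q) u v = has P u v xor has Q u v
  has-sym    (P △ Q) u v = cong₂ _xor_ (has-sym P u v) (has-sym Q u v)
  has-irrefl (P △ Q) v rewrite has-irrefl P v | has-irrefl Q v = refl

  orderedPairs : List (Fin n × Fin n)
  orderedPairs = cartesianProduct (allFin n) (allFin n)

  -- Each unordered pair {u, v} is counted once, as (u, v) with u < v.
  size : PairSet n → ℕ
  size P = length (filterᵇ (λ (u , v) → (toℕ u <ᵇ toℕ v) ∧ has P u v) orderedPairs)

  Connected : Graph n → Fin n → Fin n → Set
  Connected G = Star (Adj G)

  IsComponent : Graph n → Subset n → Set
  IsComponent G S = ∃[ v ] ∀ u → (u ∈ S) ⇔ Connected G v u

  IsClique : Graph n → Subset n → Set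
  IsClique G S = ∀ u v → u ∈ S → v ∈ S → u ≢ v → Adj G u v

  IsClusterGraph : Graph n → Set
  IsClusterGraph G = ∀ S → IsComponent G S → IsClique G S

  CliqueNumber≤ : ℕ → Graph n → Set
  CliqueNumber≤ k G = ∀ S → IsClique G S → ∣ S ∣ ≤ k

  ComponentSizes≤ : ℕ → Graph n → Set
  ComponentSizes≤ k G = ∀ S → IsComponent G S → ∣ S ∣ ≤ k

-- Structured programs for a RAM with finitely many registers in use and an
-- unbounded memory of natural numbers, addressed indirectly.  Every command
-- step costs one unit; the expressions in a program have fixed size.
-- Multiplication is deliberately not primitive: with unit-cost addition and
-- truncated subtraction only, t steps produce numbers of O(t) additional bits,
-- so polynomial time agrees with that of Turing machines.

data Expr : Set where
  const     : ℕ → Expr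
  reg       : ℕ → Expr
  mem       : Expr → Expr
  _⊕_ _⊖_   : Expr → Expr → Expr

infixr 5 _⨾_
infix  6 _≔_ ⟦_⟧≔_

data Cmd : Set where
  skip           : Cmd
  _≔_            : ℕ → Expr → Cmd
  ⟦_⟧≔_          : Expr → Expr → Cmd
  _⨾_            : Cmd → Cmd → Cmd
  ifNonzero      : Expr → Cmd → Cmd → Cmd
  whileNonzero   : Expr → Cmd → Cmd

record State : Set where
  constructor ⟪_,_⟫
  field
    registers : ℕ → ℕ
    memory    : ℕ → ℕ

open State public

eval : Expr → State → ℕ
eval (const c) s = c
eval (reg x)   s = registers s x
eval (mem e)   s = memory s (eval e s)
eval (d ⊕ e)   s = eval d s + eval e s
eval (d ⊖ e)   s = eval d s ∸ eval e s

update : (ℕ → ℕ) → ℕ → ℕ → (ℕ → ℕ)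
update f x v y = if y ≡ᵇ x then v else f y

-- c , s ⇓[ t ] s′ : started in s, the program c halts in s′ after t steps.
infix 4 _,_⇓[_]_

data _,_⇓[_]_ : Cmd → State → ℕ → State → Set where
  ⇓skip   : ∀ {s} → skip , s ⇓[ 1 ] s
  ⇓reg    : ∀ {s x e} →
            (x ≔ e) , s ⇓[ 1 ] ⟪ update (registers s) x (eval e s) , memory s ⟫
  ⇓mem    : ∀ {s d e} →
            (⟦ d ⟧≔ e) , s ⇓[ 1 ] ⟪ registers s , update (memory s) (eval d s) (eval e s) ⟫
  ⇓seq    : ∀ {s s′ s″ c d t t′} →
            c , s ⇓[ t ] s′ → d , s′ ⇓[ t′ ] s″ → (c ⨾ d) , s ⇓[ t + t′ ] s″
  ⇓then   : ∀ {s s′ e c d t} → eval e s ≢ 0 →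
            c , s ⇓[ t ] s′ → ifNonzero e c d , s ⇓[ suc t ] s′
  ⇓else   : ∀ {s s′ e c d t} → eval e s ≡ 0 →
            d , s ⇓[ t ] s′ → ifNonzero e c d , s ⇓[ suc t ] s′
  ⇓repeat : ∀ {s s′ s″ e c t t′} → eval e s ≢ 0 →
            c , s ⇓[ t ] s′ → whileNonzero e c , s′ ⇓[ t′ ] s″ →
            whileNonzero e c , s ⇓[ suc (t + t′) ] s″
  ⇓exit   : ∀ {s e c} → eval e s ≡ 0 → whileNonzero e c , s ⇓[ 1 ] s

-- The input occupies the memory cells 0, 1, …; all else is initially zero.
load : List ℕ → ℕ → ℕ
load []       _       = 0
load (x ∷ xs) zero    = x
load (x ∷ xs) (suc i) = load xs i

initial : List ℕ → State
initial w = ⟪ (λ _ → 0) , load w ⟫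

-- The output is read off from memory cell 0 onwards.
Holds : State → List ℕ → Set
Holds s w = ∀ i → memory s (toℕ i) ≡ lookup w i

record MinimizationProblem : Set₁ where
  field
    Instance       : Set
    Solution       : Instance → Set
    Feasible       : (x : Instance) → Solution x → Set
    cost           : (x : Instance) → Solution x → ℕ
    encodeInstance : Instance → List ℕ
    encodeSolution : (x : Instance) → Solution x → List ℕ

module _ (P : MinimizationProblem) where
  open MinimizationProblem P

  Optimal : (x : Instance) → Solution x → Set
  Optimal x s = Feasible x s × (∀ s′ → Feasible x s′ → cost x s ≤ cost x s′)

  Approximates : ℚᵘ → (x : Instance) → Solution x → Set
  Approximates ρ x s =
    Feasible x s ×
    (∀ s* → Optimal x s* → (+ cost x s ℚ./ 1) ℚ.≤ ρ ℚ.* (+ cost x s* ℚ./ 1))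

  -- The program halts within the time bound on every instance; the output is
  -- constrained only on instances that have a feasible solution.
  HasPolyTimeApproximation : ℚᵘ → Set
  HasPolyTimeApproximation ρ =
    ∃[ program ] ∃[ a ] ∃[ d ] ∀ (x : Instance) →
      let w = encodeInstance x in
      ∃[ t ] ∃[ final ]
        (program , initial w ⇓[ t ] final) ×
        (t ≤ a * length w ^ d + a) ×
        (∃ (Feasible x) →
         ∃[ s ] Holds final (encodeSolution x s) × Approximates ρ x s)

-- The adjacency matrix, row by row.
matrix : ∀ {n} → PairSet n → List ℕ
matrix P = map (λ (u , v) → if has P u v then 1 else 0) orderedPairs

ClusterDeletion : (k : ℕ) → MinimizationProblem
ClusterDeletion k = record
  { Instance       = ∃[ n ] Σ (Graph n) (CliqueNumber≤ k)
  ; Solution       = λ (n , _) → PairSet n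
  ; Feasible       = λ (_ , G , _) D → D ⊆ G × IsClusterGraph (G ∖ D)
  ; cost           = λ _ → size
  ; encodeInstance = λ (n , G , _) → n ∷ matrix G
  ; encodeSolution = λ _ → matrix
  }

record ConstrainedInstance : Set where
  field
    order    : ℕ
    graph    : Graph order
    friendly : PairSet order
    hostile  : PairSet order

-- A solution is the set of pairs to be edited.  Its size is the cost of the
-- clustering of graph into the connected components of graph △ D.
ConstrainedClustering : (k : ℕ) → MinimizationProblem
ConstrainedClustering k = record
  { Instance       = ConstrainedInstance
  ; Solution       = λ x → PairSet (order x)
  ; Feasible       = λ x D →
      IsClusterGraph (graph x △ D) ×
      (∀ u v → Adj (friendly x) u v → Connected (graph x △ D) u v) ×
      (∀ u v → Adj (hostile x) u v → ¬ Connected (graph x △ D) u v) ×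
      ComponentSizes≤ k (graph x △ D)
  ; cost           = λ _ → size
  ; encodeInstance = λ x →
      order x ∷ matrix (graph x) ++ matrix (friendly x) ++ matrix (hostile x)
  ; encodeSolution = λ _ → matrix
  }
  where open ConstrainedInstance

-- Friendly and hostile pairs become prohibitive costs for separating or joining
-- a pair.  A clustering is improved by moves that regroup a bounded number of
-- vertices into at most K clusters of size at most K.  Let L₁ be a local optimum,
-- let L₂ be a local optimum after the costs of the mistakes of L₁ are doubled,
-- and let O be optimal.
--
-- Moving out the clusters of O one at a time shows that the mistakes of each
-- local optimum outside O weigh at most twice those of O outside it.  Hence if
-- both exceed (2 - δ) OPT, then few pairs are mistakes of two of O, L₁, L₂.  Let
-- M join the pairs that at least two of O, L₁, L₂ join.  Any path u v w of M with
-- u w not in M contains a doubly mistaken pair or a mistaken non-edge, so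
-- pivoting on M partitions the vertices into pieces of bounded size with few
-- edges of G between them.  Each piece meets boundedly many clusters of O, so
-- regrouping it as in O is again a move, and L₁ is close to optimal.  The better
-- of L₁ and L₂ costs at most 23/12 times the optimum.
module Submission where

import Algebra.Properties.Semiring.Sum
open import Data.Bool using (Bool; true; false; _∧_; _∨_; not; _xor_; T; if_then_else_)
import Data.Bool.Properties as 𝔹ₚ
open import Data.Empty using (⊥; ⊥-elim)
open import Data.Fin using (Fin; zero; suc; toℕ; fromℕ<; inject≤)
import Data.Fin.Properties as Finₚ
open import Data.Fin.Subset using (Subset; _∈_; ∣_∣)
open import Data.Fin.Subset.Properties using (x∈p⇒∣p-x∣<∣p∣)
import Data.Integer as ℤ
import Data.Integer.Properties as ℤₚ
import Data.List as List
open List using (List; []; _∷_; _++_; length; map; filterᵇ; allFin; cartesianProduct)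
open import Data.List.Properties using (length-++; map-++; filter-++)
open import Data.Nat hiding (_/_; _%_)
open import Data.Nat.Divisibility using (n∣m*n)
open import Data.Nat.DivMod using (m*n/n≡m; m<n⇒m/n≡0; [m+kn]%n≡m%n; m<n⇒m%n≡m; +-distrib-/-∣ˡ)
  renaming (_/_ to _div_; _%_ to _mod_)
open import Data.Nat.Properties
open import Data.Nat.Tactic.RingSolver using (solve-∀)
open import Data.Product using (Σ; ∃; ∃-syntax; _×_; _,_; proj₁; proj₂)
import Data.Rational.Unnormalised as ℚ
open import Data.Sum using (_⊎_; inj₁; inj₂; [_,_]′)
open import Data.Unit using (tt)
open import Data.Vec using (Vec; []; _∷_; lookup; tabulate)
open import Data.Vec.Properties using (lookup∘tabulate; lookup⇒[]=; []=⇒lookup)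
open import Function using (_∘_; id)
open import Function.Bundles using (mk⇔; module Equivalence)
open import Relation.Binary.Construct.Closure.ReflexiveTransitive using (ε; _◅_; _◅◅_)
open import Relation.Binary.Definitions using (tri<; tri≈; tri>)
open import Relation.Binary.PropositionalEquality hiding (J)
open import Relation.Nullary using (¬_; Dec; yes; no; contradiction; does)
open import Relation.Nullary.Decidable using (_×-dec_; dec-true; dec-false; decidable-stable; ¬¬-excluded-middle; T?)
open import Defs

open Algebra.Properties.Semiring.Sum +-*-semiring using (sum; ∑-distrib-+; ∑-comm; sum-cong-≗; *-distribˡ-sum)

-- Finite sums and pivoting

-- The mistakes are not estimated with an explicit `δ`. Three inequalities are added with weights 8,
-- 3 and 1: the cluster-by-cluster exchange for `L₁`, the same for `L₂` under the doubled costs, and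
-- the comparison of `L₁` with the optimum by way of pivoting. The sum bounds nine times the cost of
-- `L₁` plus three times that of `L₂` by 23 times the optimum, and it holds pair by pair. In the
-- exchange, a pair inside a cluster of `O` is counted once and a pair between two clusters twice,
-- which is where the factor 2 arises. Doubling penalises mistakes that `L₂` shares with `L₁`, while
-- mistakes that `O` shares with `L₁` already give slack in the bound for `L₁`. What pivoting cuts
-- is charged to a `credit` on each pair, so that only finite Boolean checks remain. These
-- presuppose unit costs, and prohibitive costs are the obstacle. They are harmless because all
-- three clusterings respect the constraints: on a constrained pair the three agree, and no such
-- pair lies on a path that pivoting has to pay for.

when : Bool → ℕ → ℕ
when true  x = x
when false x = 0

ι : Bool → ℕ
ι b = when b 1

when-≤ : ∀ b x → when b x ≤ x
when-≤ true  x = ≤-refl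
when-≤ false x = z≤n

when-mono : ∀ b {x y} → (b ≡ true → x ≤ y) → when b x ≤ when b y
when-mono true  h = h refl
when-mono false h = z≤n

∑-mono : ∀ {n} {f g : Fin n → ℕ} → (∀ i → f i ≤ g i) → sum f ≤ sum g
∑-mono {zero}  h = z≤n
∑-mono {suc n} h = +-mono-≤ (h zero) (∑-mono (h ∘ suc))

∑-mono-< : ∀ {n} {f g : Fin n → ℕ} → (∀ i → f i ≤ g i) → ∀ i → f i < g i → sum f < sum g
∑-mono-< h zero    p = +-mono-<-≤ p (∑-mono (h ∘ suc))
∑-mono-< h (suc i) p = +-mono-≤-< (h zero) (∑-mono-< (h ∘ suc) i p)

∑-zero : ∀ {n} {f : Fin n → ℕ} → (∀ i → f i ≡ 0) → sum f ≡ 0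
∑-zero {zero}  h = refl
∑-zero {suc n} h = cong₂ _+_ (h zero) (∑-zero (h ∘ suc))

∑-bound : ∀ {n} {f : Fin n → ℕ} b → (∀ i → f i ≤ b) → sum f ≤ n * b
∑-bound {zero}  b h = z≤n
∑-bound {suc n} b h = +-mono-≤ (h zero) (∑-bound b (h ∘ suc))

term≤∑ : ∀ {n} (f : Fin n → ℕ) i → f i ≤ sum f
term≤∑ f zero    = m≤m+n _ _
term≤∑ f (suc i) = ≤-trans (term≤∑ (f ∘ suc) i) (m≤n+m _ _)

∑-when : ∀ {n} b (f : Fin n → ℕ) → sum (λ i → when b (f i)) ≡ when b (sum f)
∑-when true  f = refl
∑-when {n} false f = ∑-zero {n} (λ _ → refl)

infix 7 _≡ᵇᶠ_
_≡ᵇᶠ_ : ∀ {n} → Fin n → Fin n → Bool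
i ≡ᵇᶠ j = does (i Finₚ.≟ j)

≡ᵇᶠ-refl : ∀ {n} (i : Fin n) → i ≡ᵇᶠ i ≡ true
≡ᵇᶠ-refl i = dec-true (i Finₚ.≟ i) refl

≡ᵇᶠ-≢ : ∀ {n} {i j : Fin n} → i ≢ j → i ≡ᵇᶠ j ≡ false
≡ᵇᶠ-≢ {i = i} {j} p = dec-false (i Finₚ.≟ j) p

≡ᵇᶠ⇒≡ : ∀ {n} {i j : Fin n} → i ≡ᵇᶠ j ≡ true → i ≡ j
≡ᵇᶠ⇒≡ {i = i} {j} p with i Finₚ.≟ j
... | yes q = q

∑-δ : ∀ {n} (i : Fin n) x → sum (λ r → when (i ≡ᵇᶠ r) x) ≡ x
∑-δ {suc n} zero x = trans (cong (x +_) (∑-zero {n} (λ _ → refl))) (+-identityʳ x)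
∑-δ {suc n} (suc i) x = ∑-δ i x

-- If every index of `R` failed, the sums would compare strictly the other way, with `r` supplying
-- the strict term. This selects a pivot that is at least as good as the average.
∑-pigeonhole : ∀ {n} (R : Fin n → Bool) (f g : Fin n → ℕ) →
               sum (λ v → when (R v) (f v)) ≤ sum (λ v → when (R v) (g v)) →
               ∀ r → R r ≡ true → ∃[ v ] R v ≡ true × f v ≤ g v
∑-pigeonhole R f g h r Rr with Finₚ.any? (λ v → (R v 𝔹ₚ.≟ true) ×-dec (f v ≤? g v))
... | yes p = p
... | no ¬p = contradiction h (<⇒≱ (∑-mono-< below r strict))
  where
  above : ∀ v → R v ≡ true → g v < f v
  above v Rv = ≰⇒> (λ q → ¬p (v , Rv , q))
  below : ∀ v → when (R v) (g v) ≤ when (R v) (f v)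
  below v = when-mono (R v) (<⇒≤ ∘ above v)
  strict : when (R r) (g r) < when (R r) (f r)
  strict rewrite Rr = above r Rr

BRel : ℕ → Set
BRel n = Fin n → Fin n → Bool

∑² : ∀ {n} → (Fin n → Fin n → ℕ) → ℕ
∑² f = sum (λ u → sum (f u))

∑²-mono : ∀ {n} {f g : Fin n → Fin n → ℕ} → (∀ u v → f u v ≤ g u v) → ∑² f ≤ ∑² g
∑²-mono h = ∑-mono (λ u → ∑-mono (h u))

∑²-cong : ∀ {n} {f g : Fin n → Fin n → ℕ} → (∀ u v → f u v ≡ g u v) → ∑² f ≡ ∑² g
∑²-cong h = sum-cong-≗ (λ u → sum-cong-≗ (h u))

∑²-+ : ∀ {n} (f g : Fin n → Fin n → ℕ) → ∑² (λ u v → f u v + g u v) ≡ ∑² f + ∑² g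
∑²-+ f g = trans (sum-cong-≗ (λ u → ∑-distrib-+ (f u) (g u))) (∑-distrib-+ (sum ∘ f) (sum ∘ g))

∑²-* : ∀ {n} c (f : Fin n → Fin n → ℕ) → ∑² (λ u v → c * f u v) ≡ c * ∑² f
∑²-* c f = trans (sum-cong-≗ (λ u → sym (*-distribˡ-sum c (f u)))) (sym (*-distribˡ-sum c (sum ∘ f)))

∑²-transpose : ∀ {n} (f : Fin n → Fin n → ℕ) → ∑² (λ u v → f v u) ≡ ∑² f
∑²-transpose f = sym (∑-comm f)

term≤∑² : ∀ {n} (f : Fin n → Fin n → ℕ) u v → f u v ≤ ∑² f
term≤∑² f u v = ≤-trans (term≤∑ (f u) v) (term≤∑ (sum ∘ f) u)

∑²-bound : ∀ {n} {f : Fin n → Fin n → ℕ} b → (∀ u v → f u v ≤ b) → ∑² f ≤ n * (n * b)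
∑²-bound {n} b h = ∑-bound (n * b) (λ u → ∑-bound b (h u))

∑³ : ∀ {n} → (Fin n → Fin n → Fin n → ℕ) → ℕ
∑³ f = sum (λ a → ∑² (f a))

∑³-mono : ∀ {n} {f g : Fin n → Fin n → Fin n → ℕ} → (∀ a b c → f a b c ≤ g a b c) → ∑³ f ≤ ∑³ g
∑³-mono h = ∑-mono (λ a → ∑²-mono (h a))

∑³-+ : ∀ {n} (f g : Fin n → Fin n → Fin n → ℕ) → ∑³ (λ a b c → f a b c + g a b c) ≡ ∑³ f + ∑³ g
∑³-+ f g = trans (sum-cong-≗ (λ a → ∑²-+ (f a) (g a))) (∑-distrib-+ (∑² ∘ f) (∑² ∘ g))

∑³-swap₂₃ : ∀ {n} (f : Fin n → Fin n → Fin n → ℕ) → ∑³ (λ a b c → f a c b) ≡ ∑³ f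
∑³-swap₂₃ f = sum-cong-≗ (λ a → ∑²-transpose (f a))

∑³-swap₁₂ : ∀ {n} (f : Fin n → Fin n → Fin n → ℕ) → ∑³ (λ a b c → f b a c) ≡ ∑³ f
∑³-swap₁₂ f = ∑²-transpose (λ a b → sum (f a b))

∑³-swap₁₃ : ∀ {n} (f : Fin n → Fin n → Fin n → ℕ) → ∑³ (λ a b c → f c b a) ≡ ∑³ f
∑³-swap₁₃ f = trans (∑³-swap₂₃ (λ a b c → f b c a))
  (trans (∑³-swap₁₂ (λ a b c → f a c b)) (∑³-swap₂₃ f))

-- A deterministic form of the pivot algorithm for correlation clustering. `ext` is the price of
-- cutting a pair and `κ` a budget. For a path a b c without the pair a c, the pivot a cuts b c, the
-- pivot c cuts b a, and the pivot b wrongly joins a c; the hypothesis `path` says that the budgets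
-- released by these three pivots pay for the two cuts.
module Pivoting {n : ℕ} (K : BRel n)
  (K-refl : ∀ u → K u u ≡ true) (K-sym : ∀ u v → K u v ≡ K v u)
  (ext κ : Fin n → Fin n → ℕ)
  (ext-sym : ∀ u v → ext u v ≡ ext v u) (κ-sym : ∀ u v → κ u v ≡ κ v u)
  (outside : ∀ u v → K u v ≡ false → ext u v ≤ κ u v)
  (path : ∀ a b c → K a b ≡ true → K b c ≡ true → K a c ≡ false →
          ext b a + ext b c ≤ κ b a + κ b c + κ a c)
  where

  within : (Fin n → Bool) → (Fin n → Fin n → ℕ) → Fin n → Fin n → ℕ
  within R f u w = when (R u ∧ R w) (f u w)

  cutBy touchedBy : Fin n → (Fin n → Fin n → ℕ) → Fin n → Fin n → ℕ
  cutBy     v f u w = when (K v u xor K v w) (f u w)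
  touchedBy v f u w = when (K v u ∨ K v w) (f u w)

  -- Summed over all pivots in R, both sides count paths a b c of K with a c
  -- not in K, apart from the pairs outside K, which are compared termwise.
  module _ (R : Fin n → Bool) where

    P : Fin n → Fin n → Fin n → Bool
    P a b c = R a ∧ R b ∧ R c ∧ K a b ∧ K b c ∧ not (K a c)

    Q : Fin n → Fin n → Fin n → Bool
    Q v u w = R v ∧ R u ∧ R w ∧ not (K u w) ∧ (K v u xor K v w)

    X Y Z D D′ : Fin n → Fin n → Fin n → ℕ
    X a b c = when (P a b c) (ext b c)
    Y a b c = when (P a b c) (κ b c)
    Z a b c = when (P a b c) (κ a c)
    D a b c = when (Q a b c) (ext b c)
    D′ a b c = when (Q a b c) (κ b c)

    cut-pointwise : ∀ v u w → when (R v) (within R (cutBy v ext) u w) ≤ X v u w + X v w u + D v u w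
    cut-pointwise v u w rewrite ext-sym w u | K-sym w u =
      go (R v) (R u) (R w) (K v u) (K v w) (K u w) (ext u w)
      where
      go : ∀ rv ru rw vu vw uw e → when rv (when (ru ∧ rw) (when (vu xor vw) e)) ≤
           when (rv ∧ ru ∧ rw ∧ vu ∧ uw ∧ not vw) e + when (rv ∧ rw ∧ ru ∧ vw ∧ uw ∧ not vu) e +
           when (rv ∧ ru ∧ rw ∧ not uw ∧ (vu xor vw)) e
      go false ru rw vu vw uw e = z≤n
      go true false rw vu vw uw e = z≤n
      go true true false vu vw uw e = z≤n
      go true true true false false uw e = z≤n
      go true true true true true uw e = z≤n
      go true true true true false true e = ≤-trans (m≤m+n e 0) (m≤m+n (e + 0) 0)
      go true true true true false false e = ≤-refl
      go true true true false true true e = m≤m+n e 0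
      go true true true false true false e = ≤-refl

    touch-pointwise : ∀ v u w → Y v u w + Y v w u + Z u v w + D′ v u w ≤
                      when (R v) (within R (touchedBy v κ) u w)
    touch-pointwise v u w rewrite κ-sym w u | K-sym w u | K-sym u v =
      go (R v) (R u) (R w) (K v u) (K v w) (K u w) (κ u w)
      where
      go : ∀ rv ru rw vu vw uw e →
           when (rv ∧ ru ∧ rw ∧ vu ∧ uw ∧ not vw) e + when (rv ∧ rw ∧ ru ∧ vw ∧ uw ∧ not vu) e +
           when (ru ∧ rv ∧ rw ∧ vu ∧ vw ∧ not uw) e +
           when (rv ∧ ru ∧ rw ∧ not uw ∧ (vu xor vw)) e ≤
           when rv (when (ru ∧ rw) (when (vu ∨ vw) e))
      go false false rw vu vw uw e = z≤n
      go false true rw vu vw uw e = z≤n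
      go true false false vu vw uw e = z≤n
      go true false true vu vw uw e = z≤n
      go true true false vu vw uw e = z≤n
      go true true true false false false e = z≤n
      go true true true false false true e = z≤n
      go true true true true true false e = ≤-reflexive (+-identityʳ e)
      go true true true true true true e = z≤n
      go true true true true false true e = ≤-reflexive (trans (+-identityʳ _) (trans (+-identityʳ _) (+-identityʳ e)))
      go true true true true false false e = ≤-refl
      go true true true false true true e = ≤-reflexive (trans (+-identityʳ _) (+-identityʳ e))
      go true true true false true false e = ≤-refl

    path-pointwise : ∀ a b c → X c b a + X a b c + D a b c ≤ Y c b a + Y a b c + Z a b c + D′ a b c
    path-pointwise a b c rewrite K-sym c b | K-sym b a | K-sym c a =
      +-mono-≤ (go (R a) (R b) (R c) (K a b) (K b c) (K a c) (path a b c)) dd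
      where
      dd : D a b c ≤ D′ a b c
      dd = go′ (R a) (R b) (R c) (K b c) (K a b xor K a c) (outside b c)
        where
        go′ : ∀ ra rb rc bc x {e k} → (bc ≡ false → e ≤ k) →
              when (ra ∧ rb ∧ rc ∧ not bc ∧ x) e ≤ when (ra ∧ rb ∧ rc ∧ not bc ∧ x) k
        go′ false rb rc bc x h = z≤n
        go′ true false rc bc x h = z≤n
        go′ true true false bc x h = z≤n
        go′ true true true true x h = z≤n
        go′ true true true false true h = h refl
        go′ true true true false false h = z≤n
      go : ∀ ra rb rc ab bc ac {e₁ e₂ k₁ k₂ k₃} →
           (ab ≡ true → bc ≡ true → ac ≡ false → e₁ + e₂ ≤ k₁ + k₂ + k₃) →
           when (rc ∧ rb ∧ ra ∧ bc ∧ ab ∧ not ac) e₁ + when (ra ∧ rb ∧ rc ∧ ab ∧ bc ∧ not ac) e₂ ≤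
           when (rc ∧ rb ∧ ra ∧ bc ∧ ab ∧ not ac) k₁ + when (ra ∧ rb ∧ rc ∧ ab ∧ bc ∧ not ac) k₂ +
           when (ra ∧ rb ∧ rc ∧ ab ∧ bc ∧ not ac) k₃
      go false false false ab bc ac h = z≤n
      go false false true ab bc ac h = z≤n
      go false true false ab bc ac h = z≤n
      go false true true ab bc ac h = z≤n
      go true false false ab bc ac h = z≤n
      go true false true ab bc ac h = z≤n
      go true true false ab bc ac h = z≤n
      go true true true false false ac h = z≤n
      go true true true false true ac h = z≤n
      go true true true true false ac h = z≤n
      go true true true true true true h = z≤n
      go true true true true true false h = h refl refl refl

    -- A path is seen from both of its ends, so `X` and `Y` occur twice, while `Z` belongs to the
    -- middle vertex as pivot and occurs once. Permuting the variables of the triple sums lines up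
    -- the two occurrences with the two orientations of one path.
    average : sum (λ v → when (R v) (∑² (within R (cutBy v ext)))) ≤
              sum (λ v → when (R v) (∑² (within R (touchedBy v κ))))
    average = begin
      sum (λ v → when (R v) (∑² (within R (cutBy v ext))))          ≡⟨ sum-cong-≗ (λ v → when-∑² (R v) _) ⟨
      ∑³ (λ v u w → when (R v) (within R (cutBy v ext) u w))        ≤⟨ ∑³-mono cut-pointwise ⟩
      ∑³ (λ a b c → X a b c + X a c b + D a b c)                    ≡⟨ split₃ X (λ a b c → X a c b) D ⟩
      ∑³ X + ∑³ (λ a b c → X a c b) + ∑³ D                          ≡⟨ cong (λ z → z + ∑³ D) (cong (∑³ X +_) (∑³-swap₂₃ X)) ⟩
      ∑³ X + ∑³ X + ∑³ D                                            ≡⟨ cong (λ z → z + ∑³ X + ∑³ D) (∑³-swap₁₃ X) ⟨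
      ∑³ (λ a b c → X c b a) + ∑³ X + ∑³ D                          ≡⟨ split₃ (λ a b c → X c b a) X D ⟨
      ∑³ (λ a b c → X c b a + X a b c + D a b c)                    ≤⟨ ∑³-mono path-pointwise ⟩
      ∑³ (λ a b c → Y c b a + Y a b c + Z a b c + D′ a b c)         ≡⟨ split₄ (λ a b c → Y c b a) Y Z D′ ⟩
      ∑³ (λ a b c → Y c b a) + ∑³ Y + ∑³ Z + ∑³ D′
        ≡⟨ cong (λ z → z + ∑³ Z + ∑³ D′)
             (trans (cong (_+ ∑³ Y) (∑³-swap₁₃ Y)) (cong (∑³ Y +_) (sym (∑³-swap₂₃ Y)))) ⟩
      ∑³ Y + ∑³ (λ a b c → Y a c b) + ∑³ Z + ∑³ D′
        ≡⟨ cong (λ z → ∑³ Y + ∑³ (λ a b c → Y a c b) + z + ∑³ D′) (∑³-swap₁₂ Z) ⟨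
      ∑³ Y + ∑³ (λ a b c → Y a c b) + ∑³ (λ a b c → Z b a c) + ∑³ D′
        ≡⟨ split₄ Y (λ a b c → Y a c b) (λ a b c → Z b a c) D′ ⟨
      ∑³ (λ a b c → Y a b c + Y a c b + Z b a c + D′ a b c)         ≤⟨ ∑³-mono touch-pointwise ⟩
      ∑³ (λ v u w → when (R v) (within R (touchedBy v κ) u w))      ≡⟨ sum-cong-≗ (λ v → when-∑² (R v) _) ⟩
      sum (λ v → when (R v) (∑² (within R (touchedBy v κ))))        ∎
      where
      open ≤-Reasoning
      when-∑² : ∀ b (f : Fin n → Fin n → ℕ) → ∑² (λ u w → when b (f u w)) ≡ when b (∑² f)
      when-∑² b f = trans (sum-cong-≗ (λ u → ∑-when b (f u))) (∑-when b (sum ∘ f))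
      split₃ : ∀ f g h → ∑³ (λ a b c → f a b c + g a b c + h a b c) ≡ ∑³ f + ∑³ g + ∑³ h
      split₃ f g h = trans (∑³-+ (λ a b c → f a b c + g a b c) h) (cong (_+ ∑³ h) (∑³-+ f g))
      split₄ : ∀ f g h k → ∑³ (λ a b c → f a b c + g a b c + h a b c + k a b c) ≡ ∑³ f + ∑³ g + ∑³ h + ∑³ k
      split₄ f g h k = trans (∑³-+ (λ a b c → f a b c + g a b c + h a b c) k) (cong (_+ ∑³ k) (split₃ f g h))

  -- `near` keeps each piece inside a single `K`-neighbourhood, which later bounds the number of
  -- clusters of the optimum that it meets.
  record Clustering (R : Fin n → Bool) : Set where
    field
      leader  : Fin n → Fin n
      near    : ∀ u → R u ≡ true → K (leader u) u ≡ true
      bounded : ∑² (within R (λ u w → when (not (leader u ≡ᵇᶠ leader w)) (ext u w))) ≤ ∑² (within R κ)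

  open Clustering

  trivial : ∀ R → (∀ u → R u ≡ false) → Clustering R
  trivial R empty .leader u = u
  trivial R empty .near u _ = K-refl u
  trivial R empty .bounded = ≤-trans (≤-reflexive
    (∑-zero (λ u → ∑-zero (λ w → cong (λ r → when (r ∧ R w) (when (not (u ≡ᵇᶠ w)) (ext u w))) (empty u))))) z≤n

  -- Budgets of pairs touched by `v` are spent here; the remaining vertices span only untouched
  -- pairs, so no budget is used twice.
  extend : ∀ R v → ∑² (within R (cutBy v ext)) ≤ ∑² (within R (touchedBy v κ)) →
           Clustering (λ u → R u ∧ not (K v u)) → Clustering R
  extend R v le C = record { leader = ld ; near = nr ; bounded = bd }
    where
    R′ : Fin n → Bool
    R′ u = R u ∧ not (K v u)
    ld : Fin n → Fin n
    ld u = if K v u then v else leader C u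
    nr : ∀ u → R u ≡ true → K (ld u) u ≡ true
    nr u Ru with K v u in eq
    ... | true  = eq
    ... | false = near C u (cong₂ _∧_ Ru (cong not eq))
    rest : Fin n → Fin n → ℕ
    rest u w = when (not (leader C u ≡ᵇᶠ leader C w)) (ext u w)
    pw₁ : ∀ u w → within R (λ u w → when (not (ld u ≡ᵇᶠ ld w)) (ext u w)) u w ≤
                  within R (cutBy v ext) u w + within R′ rest u w
    pw₁ u w with R u | R w | K v u | K v w
    ... | false | _     | _     | _     = z≤n
    ... | true  | false | _     | _     = z≤n
    ... | true  | true  | true  | true  rewrite ≡ᵇᶠ-refl v = z≤n
    ... | true  | true  | true  | false = ≤-trans (when-≤ (not (v ≡ᵇᶠ leader C w)) (ext u w)) (m≤m+n _ 0)
    ... | true  | true  | false | true  = ≤-trans (when-≤ (not (leader C u ≡ᵇᶠ v)) (ext u w)) (m≤m+n _ 0)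
    ... | true  | true  | false | false = ≤-refl
    pw₂ : ∀ u w → within R (touchedBy v κ) u w + within R′ κ u w ≤ within R κ u w
    pw₂ u w with R u | R w | K v u | K v w
    ... | false | _     | _     | _     = z≤n
    ... | true  | false | true  | _     = z≤n
    ... | true  | false | false | _     = z≤n
    ... | true  | true  | true  | true  = ≤-reflexive (+-identityʳ _)
    ... | true  | true  | true  | false = ≤-reflexive (+-identityʳ _)
    ... | true  | true  | false | true  = ≤-reflexive (+-identityʳ _)
    ... | true  | true  | false | false = ≤-refl
    bd : ∑² (within R (λ u w → when (not (ld u ≡ᵇᶠ ld w)) (ext u w))) ≤ ∑² (within R κ)
    bd = begin
      ∑² (within R (λ u w → when (not (ld u ≡ᵇᶠ ld w)) (ext u w)))             ≤⟨ ∑²-mono pw₁ ⟩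
      ∑² (λ u w → within R (cutBy v ext) u w + within R′ rest u w)             ≡⟨ ∑²-+ (within R (cutBy v ext)) (within R′ rest) ⟩
      ∑² (within R (cutBy v ext)) + ∑² (within R′ rest)                        ≤⟨ +-mono-≤ le (bounded C) ⟩
      ∑² (within R (touchedBy v κ)) + ∑² (within R′ κ)                         ≡⟨ ∑²-+ (within R (touchedBy v κ)) (within R′ κ) ⟨
      ∑² (λ u w → within R (touchedBy v κ) u w + within R′ κ u w)              ≤⟨ ∑²-mono pw₂ ⟩
      ∑² (within R κ)                                                          ∎
      where open ≤-Reasoning

  -- `m` bounds the number of vertices left. It decreases because a pivot is its own neighbour and
  -- is removed.
  pivot : ∀ m R → sum (ι ∘ R) ≤ m → Clustering R
  pivot m R le with Finₚ.any? (λ v → R v 𝔹ₚ.≟ true)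
  ... | no none = trivial R (λ u → 𝔹ₚ.¬-not (λ p → none (u , p)))
  pivot zero R le | yes (r , Rr) =
    contradiction (≤-trans (≤-trans (≤-reflexive (cong ι (sym Rr))) (term≤∑ (ι ∘ R) r)) le) λ ()
  pivot (suc m) R le | yes (r , Rr)
    with ∑-pigeonhole R _ _ (average R) r Rr
  ... | v , Rv , good = extend R v good (pivot m _ (≤-pred (≤-trans (∑-mono-< smaller v strict) le)))
    where
    smaller : ∀ u → ι (R u ∧ not (K v u)) ≤ ι (R u)
    smaller u with R u | K v u
    ... | false | _ = z≤n
    ... | true | true = z≤n
    ... | true | false = ≤-refl
    strict : ι (R v ∧ not (K v v)) < ι (R v)
    strict rewrite Rv | K-refl v = ≤-refl

  pivotAll : Clustering (λ _ → true)
  pivotAll = pivot _ (λ _ → true) ≤-refl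

-- Local optima against an optimal clustering

record IsEquiv {A : Set} (X : A → A → Bool) : Set where
  field
    rfl : ∀ u → X u u ≡ true
    sy  : ∀ u v → X u v ≡ X v u
    tr  : ∀ u v w → X u v ≡ true → X v w ≡ true → X u w ≡ true

open IsEquiv

-- An enumeration with repetitions bounds the size of a cluster without counting, and it provides
-- the entries of a move.
RowsWithin : ∀ {n} → ℕ → BRel n → Set
RowsWithin {n} k X = ∀ r → Σ (Fin k → Fin n) λ e → ∀ u → X r u ≡ true → ∃[ a ] e a ≡ u

-- `s` is the price of separating a pair and `j` that of joining it. Totals run over ordered pairs
-- and hence are twice the usual costs.
pay : ∀ {A : Set} → (s j : A → A → ℕ) → (A → A → Bool) → A → A → ℕ
pay s j X u v = if X u v then j u v else s u v

total : ∀ {n} → (s j : Fin n → Fin n → ℕ) → BRel n → ℕ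
total s j X = ∑² (pay s j X)

reset : ∀ {n} → (Fin n → Bool) → BRel n → BRel n → BRel n
reset N O L u v = if N u ∨ N v then N u ∧ N v ∧ O u v else L u v

CoveredBy : ∀ {n} → ℕ → BRel n → (Fin n → Bool) → Set
CoveredBy {n} k O N = Σ (Fin k → Fin n) λ e → ∀ u → N u ≡ true → ∃[ a ] O (e a) u ≡ true

-- Local optimality as seen from the optimum `O`: the moves considered regroup a set as `O` does. If
-- the set is covered by boundedly many clusters of `O`, and these are bounded in size, such a move
-- is small enough to be found by exhaustive search.
Stable : ∀ {n} → ℕ → (s j : Fin n → Fin n → ℕ) → BRel n → BRel n → Set
Stable k s j O L = ∀ N → CoveredBy k O N → total s j L ≤ total s j (reset N O L)

once-or-twice : Bool → ℕ → ℕ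
once-or-twice b x = if b then x else 2 * x

module _ {n : ℕ} (s j : Fin n → Fin n → ℕ) (O L : BRel n) (ld : Fin n → Fin n) where

  private
    piece : Fin n → Fin n → Bool
    piece r u = ld u ≡ᵇᶠ r
    same : BRel n
    same u v = ld u ≡ᵇᶠ ld v
    touched : Fin n → BRel n
    touched r u v = piece r u ∨ piece r v
    new : Fin n → BRel n
    new r = reset (piece r) O L

  -- Add the inequalities for resetting each piece. A pair inside a piece is touched by one reset. A
  -- pair between two pieces is touched by two, and each of them separates it, whence `2 * s`.
  stable-on-pieces : (∀ r → total s j L ≤ total s j (new r)) →
    ∑² (λ u v → once-or-twice (same u v) (pay s j L u v)) ≤
    ∑² (λ u v → if same u v then pay s j O u v else 2 * s u v)
  stable-on-pieces stable = begin
    ∑² (λ u v → once-or-twice (same u v) (pay s j L u v))            ≡⟨ ∑²-cong old-count ⟨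
    ∑² (λ u v → sum (λ r → when (touched r u v) (pay s j L u v)))    ≡⟨ pull (λ r u v → when (touched r u v) (pay s j L u v)) ⟨
    sum (λ r → ∑² (λ u v → when (touched r u v) (pay s j L u v)))    ≤⟨ ∑-mono cancelled ⟩
    sum (λ r → ∑² (λ u v → when (touched r u v) (pay s j (new r) u v))) ≡⟨ pull (λ r u v → when (touched r u v) (pay s j (new r) u v)) ⟩
    ∑² (λ u v → sum (λ r → when (touched r u v) (pay s j (new r) u v))) ≡⟨ ∑²-cong new-count ⟩
    ∑² (λ u v → if same u v then pay s j O u v else 2 * s u v)       ∎
    where
    open ≤-Reasoning
    pull : ∀ f → ∑³ f ≡ ∑² (λ u v → sum (λ r → f r u v))
    pull f = trans (∑-comm (λ r u → sum (f r u))) (sum-cong-≗ (λ u → ∑-comm (λ r v → f r u v)))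

    exchange : ∀ r u v → pay s j (new r) u v + when (touched r u v) (pay s j L u v) ≡
                         pay s j L u v + when (touched r u v) (pay s j (new r) u v)
    exchange r u v with piece r u ∨ piece r v
    ... | true  = +-comm (if piece r u ∧ piece r v ∧ O u v then j u v else s u v) _
    ... | false = refl

    -- Untouched pairs pay the same before and after a reset, so they cancel.
    cancelled : ∀ r → ∑² (λ u v → when (touched r u v) (pay s j L u v)) ≤
                      ∑² (λ u v → when (touched r u v) (pay s j (new r) u v))
    cancelled r = +-cancelˡ-≤ (total s j (new r)) _ _ (begin
      total s j (new r) + ∑² tL    ≡⟨ ∑²-+ (pay s j (new r)) tL ⟨
      ∑² (λ u v → pay s j (new r) u v + tL u v) ≡⟨ ∑²-cong (exchange r) ⟩
      ∑² (λ u v → pay s j L u v + tN u v)       ≡⟨ ∑²-+ (pay s j L) tN ⟩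
      total s j L + ∑² tN                       ≤⟨ +-monoˡ-≤ (∑² tN) (stable r) ⟩
      total s j (new r) + ∑² tN    ∎)
      where
      tL tN : Fin n → Fin n → ℕ
      tL u v = when (touched r u v) (pay s j L u v)
      tN u v = when (touched r u v) (pay s j (new r) u v)

    module _ (u v : Fin n) where
      count : ∀ (g : Fin n → ℕ) x y →
              (ld u ≡ ld v → ∀ r → g r ≡ when (ld u ≡ᵇᶠ r) x) →
              (ld u ≢ ld v → ∀ r → g r ≡ when (ld u ≡ᵇᶠ r) y + when (ld v ≡ᵇᶠ r) y) →
              sum g ≡ (if same u v then x else 2 * y)
      count g x y h₁ h₂ with ld u Finₚ.≟ ld v
      ... | yes p = trans (sum-cong-≗ (h₁ p)) (∑-δ (ld u) x)
      ... | no p  = trans (sum-cong-≗ (h₂ p)) (trans (∑-distrib-+ _ (λ r → when (ld v ≡ᵇᶠ r) y))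
                      (cong₂ _+_ (∑-δ (ld u) y) (trans (∑-δ (ld v) y) (sym (+-identityʳ y)))))

      disjoint : ld u ≢ ld v → ∀ r → ld u ≡ᵇᶠ r ≡ true → ld v ≡ᵇᶠ r ≡ false
      disjoint p r q = ≡ᵇᶠ-≢ (λ e → p (trans (≡ᵇᶠ⇒≡ q) (sym e)))

      old-count : sum (λ r → when (touched r u v) (pay s j L u v)) ≡ once-or-twice (same u v) (pay s j L u v)
      old-count = count _ _ _ h₁ h₂
        where
        h₁ : ld u ≡ ld v → ∀ r → when (touched r u v) (pay s j L u v) ≡ when (ld u ≡ᵇᶠ r) (pay s j L u v)
        h₁ p r rewrite p with ld v ≡ᵇᶠ r
        ... | true = refl
        ... | false = refl
        h₂ : ld u ≢ ld v → ∀ r → when (touched r u v) (pay s j L u v) ≡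
             when (ld u ≡ᵇᶠ r) (pay s j L u v) + when (ld v ≡ᵇᶠ r) (pay s j L u v)
        h₂ p r with ld u ≡ᵇᶠ r in e
        ... | false = refl
        ... | true rewrite disjoint p r e = sym (+-identityʳ _)

      new-count : sum (λ r → when (touched r u v) (pay s j (new r) u v)) ≡
                  (if same u v then pay s j O u v else 2 * s u v)
      new-count = count _ _ _ h₁ h₂
        where
        h₁ : ld u ≡ ld v → ∀ r → when (touched r u v) (pay s j (new r) u v) ≡ when (ld u ≡ᵇᶠ r) (pay s j O u v)
        h₁ p r rewrite p with ld v ≡ᵇᶠ r
        ... | true = refl
        ... | false = refl
        h₂ : ld u ≢ ld v → ∀ r → when (touched r u v) (pay s j (new r) u v) ≡
             when (ld u ≡ᵇᶠ r) (s u v) + when (ld v ≡ᵇᶠ r) (s u v)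
        h₂ p r with ld u ≡ᵇᶠ r in e
        ... | true rewrite disjoint p r e = sym (+-identityʳ _)
        ... | false with ld v ≡ᵇᶠ r
        ...   | true = refl
        ...   | false = refl

-- Pivoting on an equivalence relation: transitivity leaves no path with a missing third pair, so
-- the budget zero suffices and no pair of `O` is cut.
representative : ∀ {n} {O : BRel n} → IsEquiv O →
                 ∃[ ld ] (∀ u → O (ld u) u ≡ true) × (∀ u v → ld u ≡ᵇᶠ ld v ≡ O u v)
representative {n} {O} E = leader C , (λ u → near C u refl) , agree
  where
  open Pivoting O (rfl E) (sy E) (λ u v → ι (O u v)) (λ _ _ → 0)
    (λ u v → cong ι (sy E u v)) (λ _ _ → refl)
    (λ u v p → ≤-reflexive (cong ι p))
    (λ a b c p q r → contradiction (trans (sym r) (tr E a b c p q)) λ ())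
  open Clustering
  C = pivotAll
  agree : ∀ u v → leader C u ≡ᵇᶠ leader C v ≡ O u v
  agree u v with leader C u Finₚ.≟ leader C v | O u v in q
  ... | no _  | false = refl
  ... | yes p | true  = refl
  ... | yes p | false = trans (sym (tr E u (leader C u) v (trans (sy E _ _) (near C u refl))
                          (subst (λ z → O z v ≡ true) (sym p) (near C v refl)))) q
  ... | no p  | true  = contradiction (≤-trans (≤-trans pos (term≤∑² _ u v)) (≤-trans (bounded C) zero-total)) λ ()
    where
    pos : 1 ≤ when (not (leader C u ≡ᵇᶠ leader C v)) (ι (O u v))
    pos rewrite ≡ᵇᶠ-≢ p | q = ≤-refl
    zero-total : ∑² (within (λ _ → true) (λ _ _ → 0)) ≤ 0
    zero-total = ≤-reflexive (∑-zero {n} (λ u → ∑-zero {n} (λ _ → refl)))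

-- A pair is weighted by the number of clusters of `O` that it meets.
multiplicity : ∀ {n} → BRel n → (Fin n → Fin n → ℕ) → Fin n → Fin n → ℕ
multiplicity O f u v = once-or-twice (O u v) (f u v)

module _ {n k : ℕ} {O : BRel n} (E : IsEquiv O) (s j : Fin n → Fin n → ℕ) {L : BRel n}
         (stable : Stable (suc k) s j O L) where

  -- The pieces are the clusters of `O`, each covered by one representative. Between two of them `O`
  -- separates, so `2 * s` is exactly twice what `O` pays.
  stable-vs-optimum : ∑² (multiplicity O (pay s j L)) ≤ ∑² (multiplicity O (pay s j O))
  stable-vs-optimum with representative E
  ... | ld , near , agree = begin
    ∑² (multiplicity O (pay s j L))   ≡⟨ ∑²-cong (λ u v → cong (λ b → once-or-twice b (pay s j L u v)) (agree u v)) ⟨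
    ∑² (λ u v → once-or-twice (ld u ≡ᵇᶠ ld v) (pay s j L u v))
      ≤⟨ stable-on-pieces s j O L ld (λ r → stable _ ((λ _ → r) ,
           λ u p → zero , subst (λ z → O z u ≡ true) (≡ᵇᶠ⇒≡ p) (near u))) ⟩
    ∑² (λ u v → if ld u ≡ᵇᶠ ld v then pay s j O u v else 2 * s u v)  ≡⟨ ∑²-cong rhs ⟩
    ∑² (multiplicity O (pay s j O))   ∎
    where
    open ≤-Reasoning
    rhs : ∀ u v → (if ld u ≡ᵇᶠ ld v then pay s j O u v else 2 * s u v) ≡ multiplicity O (pay s j O) u v
    rhs u v rewrite agree u v with O u v
    ... | true  = refl
    ... | false = refl

  -- A single payment of `L` is at most the whole right-hand side of `stable-vs-optimum`. Any larger
  -- penalty is therefore never incurred by a stable clustering.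
  no-violation : ∀ b → (∀ u v → pay s j O u v ≤ b) →
                 ∀ u v → n * (n * (2 * b)) < pay s j L u v → ⊥
  no-violation b O≤b u v big = <⇒≱ big (begin
    pay s j L u v                       ≤⟨ once (O u v) _ ⟩
    multiplicity O (pay s j L) u v      ≤⟨ term≤∑² _ u v ⟩
    ∑² (multiplicity O (pay s j L))     ≤⟨ stable-vs-optimum ⟩
    ∑² (multiplicity O (pay s j O))     ≤⟨ ∑²-bound (2 * b) (λ u v → twice (O u v) (O≤b u v)) ⟩
    n * (n * (2 * b))                   ∎)
    where
    open ≤-Reasoning
    once : ∀ c x → x ≤ once-or-twice c x
    once true  x = ≤-refl
    once false x = m≤m+n x _
    twice : ∀ c {x} → x ≤ b → once-or-twice c x ≤ 2 * b
    twice true  p = ≤-trans p (m≤m+n b _)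
    twice false p = *-monoʳ-≤ 2 p

-- Finite checks for one pair and for one path

allᵛ : ∀ n → (Vec Bool n → Bool) → Bool
allᵛ zero    p = p []
allᵛ (suc n) p = allᵛ n (p ∘ (true ∷_)) ∧ allᵛ n (p ∘ (false ∷_))

∧-true : ∀ {a b} → a ∧ b ≡ true → a ≡ true × b ≡ true
∧-true {true} p = refl , p

-- Proof by reflection: inequalities that depend only on a few Booleans are settled by `refl` on the
-- enumeration of all cases.
allᵛ-sound : ∀ n p → allᵛ n p ≡ true → ∀ bs → p bs ≡ true
allᵛ-sound zero    p h [] = h
allᵛ-sound (suc n) p h (true ∷ bs)  = allᵛ-sound n _ (proj₁ (∧-true h)) bs
allᵛ-sound (suc n) p h (false ∷ bs) = allᵛ-sound n _ (proj₂ (∧-true {allᵛ n (p ∘ (true ∷_))} h)) bs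

infixr 4 _⇒ᵇ_
_⇒ᵇ_ : Bool → Bool → Bool
a ⇒ᵇ b = if a then b else true

⇒ᵇ-elim : ∀ {a b} → (a ⇒ᵇ b) ≡ true → a ≡ true → b ≡ true
⇒ᵇ-elim h refl = h

maj : Bool → Bool → Bool → Bool
maj true  b c = b ∨ c
maj false b c = b ∧ c

allEqual : Bool → Bool → Bool → Bool
allEqual true  b c = b ∧ c
allEqual false b c = not (b ∨ c)

-- In a set with three elements an equivalence relation cannot hold for
-- exactly two of the three pairs.
triangle : Bool → Bool → Bool → Bool
triangle true  true  c = c
triangle true  false c = not c
triangle false true  c = not c
triangle false false c = true

unitPay : Bool → Bool → ℕ
unitPay g x = if x then ι (not g) else ι g

-- The largest values for which combinationTest holds, except that pairs on
-- which all three clusterings agree get none.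
credit : (g o a b : Bool) → ℕ
credit true  true  false false = 3
credit true  true  _     _     = 0
credit true  false true  true  = 0
credit true  false false true  = 2
credit true  false true  false = 3
credit true  false false false = 0
credit false true  true  true  = 0
credit false true  true  false = 8
credit false true  false _     = 11
credit false false true  true  = 17
credit false false true  false = 8
credit false false false true  = 3
credit false false false false = 0

-- A pair cut between pieces is touched by two resets and may cost `2 * ι g`. What `L₁` and `O` pay
-- for the pair is offset against this; the rest has to be covered by credits.
unitExt : (g o a : Bool) → ℕ
unitExt g o a = 2 * ι g ∸ (unitPay g a + unitPay g o)

-- The conclusion also says that no pair of the path is one of agreement. Two majorities among three
-- clusterings share a member, which joins the ends; and if one pair of the path were joined by all
-- three, the majority for the other would join the ends. This is what licenses unit costs on the
-- path.
pathTest : Vec Bool 12 → Bool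
pathTest (g₁ ∷ o₁ ∷ a₁ ∷ b₁ ∷ g₂ ∷ o₂ ∷ a₂ ∷ b₂ ∷ g₃ ∷ o₃ ∷ a₃ ∷ b₃ ∷ []) =
  triangle o₁ o₂ o₃ ∧ triangle a₁ a₂ a₃ ∧ triangle b₁ b₂ b₃ ∧
  maj o₁ a₁ b₁ ∧ maj o₂ a₂ b₂ ∧ not (maj o₃ a₃ b₃) ⇒ᵇ
  not (allEqual o₁ a₁ b₁) ∧ not (allEqual o₂ a₂ b₂) ∧ not (allEqual o₃ a₃ b₃) ∧
  (unitExt g₁ o₁ a₁ + unitExt g₂ o₂ a₂ ≤ᵇ credit g₁ o₁ a₁ b₁ + credit g₂ o₂ a₂ b₂ + credit g₃ o₃ a₃ b₃)

pathTest-true : ∀ bs → pathTest bs ≡ true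
pathTest-true = allᵛ-sound 12 pathTest refl

outsideTest : Vec Bool 4 → Bool
outsideTest (g ∷ o ∷ a ∷ b ∷ []) =
  not (maj o a b) ∧ not (allEqual o a b) ⇒ᵇ (unitExt g o a ≤ᵇ credit g o a b)

-- The share of one pair in `weighted-ratio`, before the sums of the three auxiliary inequalities
-- are cancelled. `x` is the payment under the original costs and `y` that under the costs doubled
-- on the mistakes of `a`.
combinationTest : Vec Bool 4 → Bool
combinationTest (g ∷ o ∷ a ∷ b ∷ []) = not (allEqual o a b) ⇒ᵇ
  (9 * x a + 3 * x b + (8 * m (x o) + 3 * m (y o) + (x o + credit g o a b)) ≤ᵇ
   23 * x o + (8 * m (x a) + 3 * m (y b) + x a))
  where
  m = once-or-twice o
  x = unitPay g
  y : Bool → ℕ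
  y c = if c then ι (not g) + (if a then ι (not g) else 0) else ι g + (if a then 0 else ι g)

≤ᵇ-true : ∀ {m n} → (m ≤ᵇ n) ≡ true → m ≤ n
≤ᵇ-true {m} {n} p = ≤ᵇ⇒≤ m n (subst T (sym p) _)

record Respects {n} (f h X : BRel n) : Set where
  field
    together : ∀ u v → f u v ≡ true → X u v ≡ true
    apart    : ∀ u v → h u v ≡ true → X u v ≡ false

open Respects

allEqual-refl : ∀ b → allEqual b b b ≡ true
allEqual-refl true  = refl
allEqual-refl false = refl

allEqual⇒≡ : ∀ {a b c} → allEqual a b c ≡ true → a ≡ b × b ≡ c
allEqual⇒≡ {true}  {true}  {true}  p = refl , refl
allEqual⇒≡ {false} {false} {false} p = refl , refl

credit-allEqual : ∀ g b → credit g b b b ≡ 0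
credit-allEqual true  true  = refl
credit-allEqual true  false = refl
credit-allEqual false true  = refl
credit-allEqual false false = refl

not-true : ∀ {b} → not b ≡ true → b ≡ false
not-true {false} _ = refl

triangle-equiv : ∀ {A : Set} {X : A → A → Bool} → IsEquiv X → ∀ a b c → triangle (X b a) (X b c) (X a c) ≡ true
triangle-equiv {X = X} E a b c with X b a in p | X b c in q | X a c in r
... | true  | true  | true  = refl
... | true  | true  | false = trans (sym r) (tr E a b c (trans (sy E a b) p) q)
... | true  | false | false = refl
... | true  | false | true  = contradiction (trans (sym q) (tr E b a c p r)) λ ()
... | false | true  | false = refl
... | false | true  | true  = contradiction (trans (sym p) (tr E b c a q (trans (sy E c a) r))) λ ()
... | false | false | _     = refl

-- Comparing two local optima with a feasible clustering

record ConstraintGraph (n : ℕ) : Set where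
  field
    g f h : BRel n
    g-sym : ∀ u v → g u v ≡ g v u
    f-sym : ∀ u v → f u v ≡ f v u
    h-sym : ∀ u v → h u v ≡ h v u

record Costs {n} (I : ConstraintGraph n) (w : ℕ) (s j : Fin n → Fin n → ℕ) : Set where
  open ConstraintGraph I
  field
    diag-s : ∀ u → s u u ≡ 0
    diag-j : ∀ u → j u u ≡ 0
    off-s  : ∀ u v → u ≢ v → s u v ≡ ι (g u v) + when (f u v) w
    off-j  : ∀ u v → u ≢ v → j u v ≡ ι (not (g u v)) + when (h u v) w

-- The 4 in `heavy` covers the doubled costs as well: there a pair costs `O` at most 2 and is
-- counted at most twice.
module Analysis {n k w : ℕ} (I : ConstraintGraph n)
  (heavy : n * (n * 4) < w)
  {s j : Fin n → Fin n → ℕ} (costs : Costs I w s j)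
  {s² j² : Fin n → Fin n → ℕ}
  {O L₁ L₂ : BRel n} (EO : IsEquiv O) (E₁ : IsEquiv L₁) (E₂ : IsEquiv L₂)
  (double-s : ∀ u v → s² u v ≡ s u v + (if L₁ u v then 0 else s u v))
  (double-j : ∀ u v → j² u v ≡ j u v + (if L₁ u v then j u v else 0))
  (rows : RowsWithin (suc k) L₁)
  (feasible : Respects (ConstraintGraph.f I) (ConstraintGraph.h I) O)
  (stable₁ : Stable (suc k) s j O L₁) (stable₂ : Stable (suc k) s² j² O L₂)
  where

  open ConstraintGraph I
  open Costs costs

  O≤1 : ∀ u v → pay s j O u v ≤ 1
  O≤1 u v with u Finₚ.≟ v
  ... | yes refl rewrite diag-s u | diag-j u with O u u
  ...   | true  = z≤n
  ...   | false = z≤n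
  O≤1 u v | no p with O u v in q
  ... | true rewrite off-j u v p with h u v in r
  ...   | true  = contradiction (trans (sym q) (apart feasible u v r)) λ ()
  ...   | false rewrite +-identityʳ (ι (not (g u v))) = when-≤ (not (g u v)) 1
  O≤1 u v | no p | false rewrite off-s u v p with f u v in r
  ...   | true  = contradiction (trans (sym q) (together feasible u v r)) λ ()
  ...   | false rewrite +-identityʳ (ι (g u v)) = when-≤ (g u v) 1

  O²≤2 : ∀ u v → pay s² j² O u v ≤ 2
  O²≤2 u v with O u v | O≤1 u v
  ... | true  | p rewrite double-j u v = +-mono-≤ p (extra (L₁ u v))
    where
    extra : ∀ b → (if b then j u v else 0) ≤ 1
    extra true  = p
    extra false = z≤n
  ... | false | p rewrite double-s u v = +-mono-≤ p (extra (L₁ u v))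
    where
    extra : ∀ b → (if b then 0 else s u v) ≤ 1
    extra true  = z≤n
    extra false = p

  -- Violating a constraint costs `w` on one pair, and doubling only raises costs; `no-violation`
  -- rules this out.
  stable⇒feasible : ∀ {s′ j′ L} b → 2 * b ≤ 4 → IsEquiv L → Stable (suc k) s′ j′ O L →
    (∀ u v → pay s′ j′ O u v ≤ b) → (∀ u v → s u v ≤ s′ u v) → (∀ u v → j u v ≤ j′ u v) →
    Respects f h L
  stable⇒feasible {s′} {j′} {L} b b≤2 E stable O≤b s≤ j≤ = record { together = tog ; apart = ap }
    where
    light : n * (n * (2 * b)) < w
    light = ≤-<-trans (*-monoʳ-≤ n (*-monoʳ-≤ n b≤2)) heavy
    tog : ∀ u v → f u v ≡ true → L u v ≡ true
    tog u v p with L u v in q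
    ... | true  = refl
    ... | false = ⊥-elim (no-violation EO s′ j′ stable b O≤b u v (<-≤-trans light
        (subst (λ z → w ≤ (if z then j′ u v else s′ u v)) (sym q) (≤-trans w≤s (s≤ u v)))))
      where
      u≢v : u ≢ v
      u≢v refl = contradiction (trans (sym q) (rfl E u)) λ ()
      w≤s : w ≤ s u v
      w≤s rewrite off-s u v u≢v | p = m≤n+m w _
    ap : ∀ u v → h u v ≡ true → L u v ≡ false
    ap u v p with L u v in q
    ... | false = refl
    ... | true  = ⊥-elim (no-violation EO s′ j′ stable b O≤b u v (<-≤-trans light
        (subst (λ z → w ≤ (if z then j′ u v else s′ u v)) (sym q) (≤-trans w≤j (j≤ u v)))))
      where
      u≢v : u ≢ v
      u≢v refl = contradiction (trans (sym (apart feasible u u p)) (rfl EO u)) λ ()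
      w≤j : w ≤ j u v
      w≤j rewrite off-j u v u≢v | p = m≤n+m w _

  feasible₁ : Respects f h L₁
  feasible₁ = stable⇒feasible 1 (s≤s (s≤s z≤n)) E₁ stable₁ O≤1 (λ _ _ → ≤-refl) (λ _ _ → ≤-refl)

  feasible₂ : Respects f h L₂
  feasible₂ = stable⇒feasible 2 ≤-refl E₂ stable₂ O²≤2
    (λ u v → subst (s u v ≤_) (sym (double-s u v)) (m≤m+n _ _))
    (λ u v → subst (j u v ≤_) (sym (double-j u v)) (m≤m+n _ _))

  -- Reflexive and symmetric, but in general not transitive; pivoting turns it into a partition.
  K : BRel n
  K u v = maj (O u v) (L₁ u v) (L₂ u v)

  agree : BRel n
  agree u v = allEqual (O u v) (L₁ u v) (L₂ u v)

  agree-if : ∀ {u v} b → O u v ≡ b → L₁ u v ≡ b → L₂ u v ≡ b → agree u v ≡ true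
  agree-if b p q r rewrite p | q | r = allEqual-refl b

  -- A friendly pair is joined and a hostile pair separated by all three clusterings, so a pair of
  -- disagreement carries no penalty.
  unit : ∀ u v → agree u v ≡ false → s u v ≡ ι (g u v) × j u v ≡ ι (not (g u v))
  unit u v p = s-unit , j-unit
    where
    u≢v : u ≢ v
    u≢v refl = contradiction (trans (sym p) (agree-if true (rfl EO u) (rfl E₁ u) (rfl E₂ u))) λ ()
    s-unit : s u v ≡ ι (g u v)
    s-unit rewrite off-s u v u≢v with f u v in q
    ... | false = +-identityʳ _
    ... | true  = contradiction (trans (sym p)
          (agree-if true (together feasible u v q) (together feasible₁ u v q) (together feasible₂ u v q))) λ ()
    j-unit : j u v ≡ ι (not (g u v))
    j-unit rewrite off-j u v u≢v with h u v in q
    ... | false = +-identityʳ _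
    ... | true  = contradiction (trans (sym p)
          (agree-if false (apart feasible u v q) (apart feasible₁ u v q) (apart feasible₂ u v q))) λ ()

  c₁ c₂ cO ext κ : Fin n → Fin n → ℕ
  c₁ = pay s j L₁
  c₂ = pay s j L₂
  cO = pay s j O
  ext u v = 2 * s u v ∸ (c₁ u v + cO u v)
  κ u v = credit (g u v) (O u v) (L₁ u v) (L₂ u v)

  ext-unit : ∀ u v → agree u v ≡ false → ext u v ≡ unitExt (g u v) (O u v) (L₁ u v)
  ext-unit u v p rewrite proj₁ (unit u v p) | proj₂ (unit u v p) = refl

  s-sym : ∀ u v → s u v ≡ s v u
  s-sym u v with u Finₚ.≟ v
  ... | yes refl = refl
  ... | no p rewrite off-s u v p | off-s v u (p ∘ sym) | g-sym u v | f-sym u v = refl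

  j-sym : ∀ u v → j u v ≡ j v u
  j-sym u v with u Finₚ.≟ v
  ... | yes refl = refl
  ... | no p rewrite off-j u v p | off-j v u (p ∘ sym) | g-sym u v | h-sym u v = refl

  ext-sym : ∀ u v → ext u v ≡ ext v u
  ext-sym u v rewrite s-sym u v | j-sym u v | sy E₁ u v | sy EO u v = refl

  κ-sym : ∀ u v → κ u v ≡ κ v u
  κ-sym u v rewrite g-sym u v | sy EO u v | sy E₁ u v | sy E₂ u v = refl

  K-refl : ∀ u → K u u ≡ true
  K-refl u rewrite rfl EO u | rfl E₁ u = refl

  K-sym : ∀ u v → K u v ≡ K v u
  K-sym u v rewrite sy EO u v | sy E₁ u v | sy E₂ u v = refl

  outside : ∀ u v → K u v ≡ false → ext u v ≤ κ u v
  outside u v p with agree u v in q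
  ... | false rewrite ext-unit u v q = ≤ᵇ-true (⇒ᵇ-elim
        (allᵛ-sound 4 outsideTest refl (g u v ∷ O u v ∷ L₁ u v ∷ L₂ u v ∷ []))
        (cong₂ _∧_ (cong not p) (cong not q)))
  -- Here all three separate the pair, so `ext` is `2 * s` less twice `s`.
  ... | true with allEqual⇒≡ {O u v} q
  ...   | p₁ , p₂ rewrite sym p₂ | sym p₁ with O u v | p
  ...     | false | _ rewrite +-identityʳ (s u v) | n∸n≡0 (s u v + s u v) = z≤n

  path : ∀ a b c → K a b ≡ true → K b c ≡ true → K a c ≡ false →
         ext b a + ext b c ≤ κ b a + κ b c + κ a c
  path a b c p q r with ⇒ᵇ-elim
    (pathTest-true (g b a ∷ O b a ∷ L₁ b a ∷ L₂ b a ∷ g b c ∷ O b c ∷ L₁ b c ∷ L₂ b c ∷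
                    g a c ∷ O a c ∷ L₁ a c ∷ L₂ a c ∷ []))
    (cong₂ _∧_ (triangle-equiv EO a b c) (cong₂ _∧_ (triangle-equiv E₁ a b c) (cong₂ _∧_ (triangle-equiv E₂ a b c)
      (cong₂ _∧_ (trans (K-sym b a) p) (cong₂ _∧_ q (cong not r))))))
  ... | t with ∧-true t
  ...   | x , t′ with ∧-true t′
  ...     | y , t″ rewrite ext-unit b a (not-true x) | ext-unit b c (not-true y) =
    ≤ᵇ-true (proj₂ (∧-true {not (agree a c)} t″))

  open Pivoting K K-refl K-sym ext κ ext-sym κ-sym outside path
  open Clustering

  -- A majority neighbour of `r` outside the `L₁`-cluster of `r` must be in the `O`-cluster of `r`.
  -- Hence the clusters of `O` through the at most `suc k` members of the `L₁`-cluster of `r` cover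
  -- the neighbourhood.
  near-covered : ∀ r → CoveredBy (suc k) O (K r)
  near-covered r = e , cov
    where
    e = proj₁ (rows r)
    cov : ∀ u → K r u ≡ true → ∃[ a ] O (e a) u ≡ true
    cov u p with L₁ r u in q
    ... | true with proj₂ (rows r) u q
    ...   | a , refl = a , rfl EO u
    cov u p | false with proj₂ (rows r) r (rfl E₁ r)
    ...   | a , ea≡r = a , subst (λ z → O z u ≡ true) (sym ea≡r) (third-absent p)
      where
      third-absent : ∀ {x y} → maj x false y ≡ true → x ≡ true
      third-absent {true} _ = refl

  -- Resetting every piece found by pivoting replaces `L₁` by `O` inside the pieces. Only pairs
  -- between pieces can spoil the comparison; their excess is `ext`, which pivoting charges to `κ`.
  L₁-vs-credit : ∑² c₁ ≤ ∑² cO + ∑² κ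
  L₁-vs-credit = +-cancelʳ-≤ (∑² old) (∑² c₁) (∑² cO + ∑² κ) (begin
    ∑² c₁ + ∑² old                                ≤⟨ +-monoʳ-≤ (∑² c₁) pieces ⟩
    ∑² c₁ + ∑² new                                ≡⟨ ∑²-+ c₁ new ⟨
    ∑² (λ u v → c₁ u v + new u v)                 ≤⟨ ∑²-mono pointwise ⟩
    ∑² (λ u v → cO u v + cut u v + old u v)       ≡⟨ trans (∑²-+ (λ u v → cO u v + cut u v) old) (cong (_+ ∑² old) (∑²-+ cO cut)) ⟩
    ∑² cO + ∑² cut + ∑² old                       ≤⟨ +-monoˡ-≤ (∑² old) (+-monoʳ-≤ (∑² cO) (bounded pivotAll)) ⟩
    ∑² cO + ∑² κ + ∑² old                         ∎)
    where
    open ≤-Reasoning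
    ld = leader pivotAll
    old new cut : Fin n → Fin n → ℕ
    old u v = once-or-twice (ld u ≡ᵇᶠ ld v) (c₁ u v)
    new u v = if ld u ≡ᵇᶠ ld v then cO u v else 2 * s u v
    cut u v = when (not (ld u ≡ᵇᶠ ld v)) (ext u v)
    pieces : ∑² old ≤ ∑² new
    pieces = stable-on-pieces s j O L₁ ld (λ r → stable₁ _ (proj₁ (near-covered r) ,
      λ u p → proj₂ (near-covered r) u (subst (λ z → K z u ≡ true) (≡ᵇᶠ⇒≡ p) (near pivotAll u refl))))
    pointwise : ∀ u v → c₁ u v + new u v ≤ cO u v + cut u v + old u v
    pointwise u v with ld u ≡ᵇᶠ ld v
    ... | true  = ≤-reflexive (trans (+-comm (c₁ u v) _) (cong (_+ c₁ u v) (sym (+-identityʳ _))))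
    ... | false = begin
      c₁ u v + 2 * s u v                               ≤⟨ +-monoʳ-≤ (c₁ u v) (m≤n+m∸n (2 * s u v) (c₁ u v + cO u v)) ⟩
      c₁ u v + (c₁ u v + cO u v + ext u v)             ≡⟨ rearranged (c₁ u v) (cO u v) (ext u v) ⟩
      cO u v + ext u v + 2 * c₁ u v                    ∎
      where
      rearranged : ∀ x y z → x + (x + y + z) ≡ y + z + 2 * x
      rearranged = solve-∀

  -- Where the three clusterings agree, the stability terms coincide on both sides and the credit
  -- vanishes, so only 12 ≤ 23 is left, whatever the pair costs. Elsewhere the costs are units and
  -- the finite check applies.
  combination : ∀ u v →
    9 * c₁ u v + 3 * c₂ u v +
      (8 * multiplicity O cO u v + 3 * multiplicity O (pay s² j² O) u v + (cO u v + κ u v)) ≤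
    23 * cO u v + (8 * multiplicity O c₁ u v + 3 * multiplicity O (pay s² j² L₂) u v + c₁ u v)
  combination u v rewrite double-s u v | double-j u v with agree u v in q
  ... | false rewrite proj₁ (unit u v q) | proj₂ (unit u v q) =
    ≤ᵇ-true (⇒ᵇ-elim (allᵛ-sound 4 combinationTest refl (g u v ∷ O u v ∷ L₁ u v ∷ L₂ u v ∷ [])) (cong not q))
  ... | true with allEqual⇒≡ {O u v} q
  ...   | p₁ , p₂ rewrite sym p₂ | sym p₁ | credit-allEqual (g u v) (O u v) =
    subst (_≤ 23 * x + (8 * z + 3 * z′ + x)) (rearranged x z z′) (+-monoˡ-≤ _ (*-monoˡ-≤ x {12} {23} (≤ᵇ-true refl)))
    where
    x = pay s j O u v
    z = multiplicity O cO u v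
    z′ = once-or-twice (O u v) (if O u v then j u v + (if O u v then j u v else 0)
                                 else s u v + (if O u v then 0 else s u v))
    rearranged : ∀ x z z′ → 12 * x + (8 * z + 3 * z′ + x) ≡ 9 * x + 3 * x + (8 * z + 3 * z′ + (x + 0))
    rearranged = solve-∀

  -- Eight times stable-vs-optimum for L₁, three times that for L₂ and once
  -- L₁-vs-credit.
  weighted-ratio : 9 * total s j L₁ + 3 * total s j L₂ ≤ 23 * total s j O
  weighted-ratio = +-cancelʳ-≤ (8 * ∑² mO + 3 * ∑² mO² + (∑² cO + ∑² κ)) _ _ (begin
    9 * ∑² c₁ + 3 * ∑² c₂ + (8 * ∑² mO + 3 * ∑² mO² + (∑² cO + ∑² κ))        ≡⟨ lhs ⟨
    ∑² (λ u v → 9 * c₁ u v + 3 * c₂ u v + (8 * mO u v + 3 * mO² u v + (cO u v + κ u v)))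
                                                                              ≤⟨ ∑²-mono combination ⟩
    ∑² (λ u v → 23 * cO u v + (8 * m₁ u v + 3 * m₂ u v + c₁ u v))            ≡⟨ rhs ⟩
    23 * ∑² cO + (8 * ∑² m₁ + 3 * ∑² m₂ + ∑² c₁)
      ≤⟨ +-monoʳ-≤ (23 * ∑² cO) (+-mono-≤ (+-mono-≤
           (*-monoʳ-≤ 8 (stable-vs-optimum EO s j stable₁))
           (*-monoʳ-≤ 3 (stable-vs-optimum EO s² j² stable₂))) L₁-vs-credit) ⟩
    23 * ∑² cO + (8 * ∑² mO + 3 * ∑² mO² + (∑² cO + ∑² κ))                   ∎)
    where
    open ≤-Reasoning
    mO mO² m₁ m₂ : Fin n → Fin n → ℕ
    mO  = multiplicity O cO
    mO² = multiplicity O (pay s² j² O)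
    m₁  = multiplicity O c₁
    m₂  = multiplicity O (pay s² j² L₂)
    lin : ∀ x y (a b : Fin n → Fin n → ℕ) → ∑² (λ u v → x * a u v + y * b u v) ≡ x * ∑² a + y * ∑² b
    lin x y a b = trans (∑²-+ (λ u v → x * a u v) (λ u v → y * b u v)) (cong₂ _+_ (∑²-* x a) (∑²-* y b))
    lhs : ∑² (λ u v → 9 * c₁ u v + 3 * c₂ u v + (8 * mO u v + 3 * mO² u v + (cO u v + κ u v))) ≡
          9 * ∑² c₁ + 3 * ∑² c₂ + (8 * ∑² mO + 3 * ∑² mO² + (∑² cO + ∑² κ))
    lhs = trans (∑²-+ (λ u v → 9 * c₁ u v + 3 * c₂ u v) _) (cong₂ _+_ (lin 9 3 c₁ c₂)
            (trans (∑²-+ (λ u v → 8 * mO u v + 3 * mO² u v) _) (cong₂ _+_ (lin 8 3 mO mO²) (∑²-+ cO κ))))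
    rhs : ∑² (λ u v → 23 * cO u v + (8 * m₁ u v + 3 * m₂ u v + c₁ u v)) ≡
          23 * ∑² cO + (8 * ∑² m₁ + 3 * ∑² m₂ + ∑² c₁)
    rhs = trans (∑²-+ (λ u v → 23 * cO u v) _) (cong₂ _+_ (∑²-* 23 cO)
            (trans (∑²-+ (λ u v → 8 * m₁ u v + 3 * m₂ u v) _) (cong (_+ ∑² c₁) (lin 8 3 m₁ m₂))))

-- Running programs and loops over pairs

-- A total-correctness triple with a time budget. The budget is only an upper bound, so branches of
-- different lengths can share it.
Run : Cmd → State → ℕ → (State → Set) → Set
Run c s T Q = ∃[ t ] ∃[ s′ ] (c , s ⇓[ t ] s′) × t ≤ T × Q s′

run-weaken : ∀ {c s T T′} {Q Q′ : State → Set} → T ≤ T′ → (∀ s′ → Q s′ → Q′ s′) → Run c s T Q → Run c s T′ Q′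
run-weaken T≤ h (t , s′ , r , le , q) = t , s′ , r , ≤-trans le T≤ , h s′ q

run-skip : ∀ {s} {Q : State → Set} → Q s → Run skip s 1 Q
run-skip q = 1 , _ , ⇓skip , ≤-refl , q

run-≔ : ∀ {x e s} {Q : State → Set} →
        Q ⟪ update (registers s) x (eval e s) , memory s ⟫ → Run (x ≔ e) s 1 Q
run-≔ q = 1 , _ , ⇓reg , ≤-refl , q

run-store : ∀ {d e s} {Q : State → Set} →
            Q ⟪ registers s , update (memory s) (eval d s) (eval e s) ⟫ → Run (⟦ d ⟧≔ e) s 1 Q
run-store q = 1 , _ , ⇓mem , ≤-refl , q

run-⨾ : ∀ {c d s T T′} {Q : State → Set} →
        Run c s T (λ s′ → Run d s′ T′ Q) → Run (c ⨾ d) s (T + T′) Q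
run-⨾ (t , s′ , r , le , (t′ , s″ , r′ , le′ , q)) = t + t′ , s″ , ⇓seq r r′ , +-mono-≤ le le′ , q

run-if : ∀ {e c d s T} {Q : State → Set} →
         (eval e s ≢ 0 → Run c s T Q) → (eval e s ≡ 0 → Run d s T Q) →
         Run (ifNonzero e c d) s (suc T) Q
run-if {e} {s = s} then′ else′ with eval e s ≟ 0
... | yes p = let t , s′ , r , le , q = else′ p in suc t , s′ , ⇓else p r , s≤s le , q
... | no p  = let t , s′ , r , le , q = then′ p in suc t , s′ , ⇓then p r , s≤s le , q

-- The counter `j` goes up, while the guard, a truncated difference, goes down to zero; subtraction
-- thus serves as the comparison.
run-for : ∀ {e c T} b (I : ℕ → State → Set) →
          (∀ j s → I j s → eval e s ≡ b ∸ j) →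
          (∀ j s → j < b → I j s → Run c s T (I (suc j))) →
          ∀ {s} → I 0 s → Run (whileNonzero e c) s (suc (b * suc T)) (I b)
run-for {e} {c} {T} b I guard step {s} i₀ = go b 0 refl i₀
  where
  go : ∀ d j {s} → j + d ≡ b → I j s → Run (whileNonzero e c) s (suc (d * suc T)) (I b)
  go zero j {s} p i with trans (sym (+-identityʳ j)) p
  ... | refl = 1 , s , ⇓exit (trans (guard j s i) (n∸n≡0 j)) , ≤-refl , i
  go (suc d) j {s} p i with step j s j<b i
    where
    j<b : j < b
    j<b = subst (j <_) p (m<m+n j (s≤s z≤n))
  ... | t , s′ , r , le , i′ with go d (suc j) (trans (sym (+-suc j d)) p) i′
  ...   | t′ , s″ , r′ , le′ , q =
    suc (t + t′) , s″ , ⇓repeat nonzero r r′ ,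
    s≤s (≤-trans (+-mono-≤ le le′) (≤-reflexive (+-suc T (d * suc T)))) , q
    where
    nonzero : eval e s ≢ 0
    nonzero z = contradiction (trans (sym z) (trans (guard j s i) (trans (cong (_∸ j) (sym p)) (m+n∸m≡n j (suc d))))) λ ()

-- With the base `2 + n` at least 2, constants and sums are absorbed by raising the degree, and no
-- coefficients have to be tracked.
record Poly (f : ℕ → ℕ) : Set where
  constructor poly
  field
    degree : ℕ
    bound  : ∀ n → f n ≤ (2 + n) ^ degree

open Poly

poly-const : ∀ c → Poly (λ _ → c)
poly-const c = poly c (λ n → ≤-trans (<⇒≤ (n<2^n c)) (^-monoˡ-≤ c (m≤m+n 2 n)))
  where
  n<2^n : ∀ m → m < 2 ^ m
  n<2^n zero    = s≤s z≤n
  n<2^n (suc m) = ≤-trans (+-mono-≤ {1} {2 ^ m} (≤-trans (s≤s z≤n) (n<2^n m)) (n<2^n m))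
                    (≤-reflexive (cong (2 ^ m +_) (sym (+-identityʳ (2 ^ m)))))

poly-id : Poly (λ n → n)
poly-id = poly 1 (λ n → ≤-trans (m≤n+m n 2) (≤-reflexive (sym (*-identityʳ (2 + n)))))

poly-* : ∀ {f g} → Poly f → Poly g → Poly (λ n → f n * g n)
poly-* (poly d p) (poly e q) = poly (d + e)
  (λ n → ≤-trans (*-mono-≤ (p n) (q n)) (≤-reflexive (sym (^-distribˡ-+-* (2 + n) d e))))

poly-+ : ∀ {f g} → Poly f → Poly g → Poly (λ n → f n + g n)
poly-+ {f} {g} (poly d p) (poly e q) = poly (suc (d + e)) (λ n → begin
  f n + g n                                  ≤⟨ +-mono-≤ (p n) (q n) ⟩
  (2 + n) ^ d + (2 + n) ^ e                  ≤⟨ +-mono-≤ (^-monoʳ-≤ (2 + n) (m≤m+n d e)) (^-monoʳ-≤ (2 + n) (m≤n+m e d)) ⟩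
  (2 + n) ^ (d + e) + (2 + n) ^ (d + e)      ≤⟨ +-monoʳ-≤ ((2 + n) ^ (d + e)) (m≤m+n ((2 + n) ^ (d + e)) (n * (2 + n) ^ (d + e))) ⟩
  (2 + n) ^ suc (d + e)                      ∎)
  where open ≤-Reasoning

poly-suc : ∀ {f} → Poly f → Poly (λ n → suc (f n))
poly-suc p = poly-+ (poly-const 1) p

-- Uniqueness of quotient and remainder. It serves both for positions within a matrix and for the
-- disjointness of arrays.
idx-injective : ∀ n u v u′ v′ → v < n → v′ < n → u * n + v ≡ u′ * n + v′ → u ≡ u′ × v ≡ v′
idx-injective n zero    v zero     v′ _ _ p = refl , p
idx-injective n zero    v (suc u′) v′ q _ p =
  contradiction (subst (_< n) (trans p (+-assoc n (u′ * n) v′)) q) (m+n≮m n _)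
idx-injective n (suc u) v zero     v′ _ q p =
  contradiction (subst (_< n) (trans (sym p) (+-assoc n (u * n) v)) q) (m+n≮m n _)
idx-injective n (suc u) v (suc u′) v′ q q′ p
  with idx-injective n u v u′ v′ q q′ (+-cancelˡ-≡ n _ _ (trans (sym (+-assoc n (u * n) v)) (trans p (+-assoc n (u′ * n) v′))))
... | refl , r = refl , r

idx-< : ∀ m n u v → u < m → v < n → u * n + v < m * n
idx-< m n u v u<m v<n = <-≤-trans (+-monoʳ-< (u * n) v<n)
  (≤-trans (≤-reflexive (+-comm (u * n) n)) (*-monoˡ-≤ n u<m))

Base : ℕ → State → Set
Base n s = registers s 0 ≡ n × registers s 1 ≡ n * n

AtPair : ℕ → ℕ → ℕ → State → Set
AtPair n u v s = registers s 2 ≡ u × registers s 3 ≡ v × registers s 4 ≡ u * n + v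

high : State → ℕ → ℕ
high s z = registers s (5 + z)

-- Registers 2, 3 and 4 hold u, v and u * n + v.
pairs : Cmd → Cmd
pairs body =
  2 ≔ const 0 ⨾ 4 ≔ const 0 ⨾
  whileNonzero (reg 0 ⊖ reg 2)
    (3 ≔ const 0 ⨾
     whileNonzero (reg 0 ⊖ reg 3) (body ⨾ 4 ≔ (reg 4 ⊕ const 1) ⨾ 3 ≔ (reg 3 ⊕ const 1)) ⨾
     2 ≔ (reg 2 ⊕ const 1))

pairsTime : (ℕ → ℕ) → ℕ → ℕ
pairsTime T n = 1 + (1 + suc (n * suc (1 + (suc (n * suc (T n + (1 + 1))) + 1))))

pairsTime-poly : ∀ {T} → Poly T → Poly (pairsTime T)
pairsTime-poly p = poly-suc (poly-suc (poly-suc (poly-* poly-id (poly-suc (poly-suc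
  (poly-+ (poly-suc (poly-* poly-id (poly-suc (poly-+ p (poly-const 2))))) (poly-const 1)))))))

-- The invariant `Φ` sees only the memory and the registers from 5 on, the others being kept by the
-- loop. `next` passes from the end of a row to the start of the following one, which is the same
-- position in the array.
run-pairs : ∀ {body n} {T : ℕ → ℕ} (Φ : ℕ → ℕ → (ℕ → ℕ) → (ℕ → ℕ) → Set) →
  (∀ u v s → u < n → v < n → Base n s → AtPair n u v s → Φ u v (high s) (memory s) →
     Run body s (T n) (λ s′ → Base n s′ × AtPair n u v s′ × Φ u (suc v) (high s′) (memory s′))) →
  (∀ u ρ m → Φ u n ρ m → Φ (suc u) 0 ρ m) →
  ∀ {s} → Base n s → Φ 0 0 (high s) (memory s) →
  Run (pairs body) s (pairsTime T n) (λ s′ → Base n s′ × Φ n 0 (high s′) (memory s′))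
run-pairs {body} {n} {T} Φ step next b₀ j₀ =
  run-⨾ (run-≔ (run-⨾ (run-≔ (run-weaken ≤-refl (λ _ (b , _ , _ , j) → b , j)
    (run-for n Outer outer-guard outer (b₀ , refl , refl , j₀))))))
  where
  Outer : ℕ → State → Set
  Outer u s = Base n s × registers s 2 ≡ u × registers s 4 ≡ u * n × Φ u 0 (high s) (memory s)
  Inner : ℕ → ℕ → State → Set
  Inner u v s = Base n s × AtPair n u v s × Φ u v (high s) (memory s)
  outer-guard : ∀ u s → Outer u s → eval (reg 0 ⊖ reg 2) s ≡ n ∸ u
  outer-guard u s ((p , _) , q , _) = cong₂ _∸_ p q
  inner-guard : ∀ u v s → Inner u v s → eval (reg 0 ⊖ reg 3) s ≡ n ∸ v
  inner-guard u v s ((p , _) , (_ , q , _) , _) = cong₂ _∸_ p q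
  inner : ∀ u → u < n → ∀ v s → v < n → Inner u v s →
          Run (body ⨾ 4 ≔ (reg 4 ⊕ const 1) ⨾ 3 ≔ (reg 3 ⊕ const 1)) s (T n + (1 + 1)) (Inner u (suc v))
  inner u u<n v s v<n (b , a , j) = run-⨾ (run-weaken ≤-refl
    (λ s′ (b′ , (a₂ , a₃ , a₄) , j′) → run-⨾ (run-≔ (run-≔
      (b′ , (a₂ , trans (+-comm _ 1) (cong suc a₃) ,
             trans (cong (_+ 1) a₄) (trans (+-assoc (u * n) v 1) (cong (u * n +_) (+-comm v 1)))) , j′))))
    (step u v s u<n v<n b a j))
  outer : ∀ u s → u < n → Outer u s → Run _ s _ (Outer (suc u))
  outer u s u<n (b , p , q , j) = run-⨾ (run-≔ (run-⨾ (run-weaken ≤-refl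
    (λ s′ (b′ , (a₂ , a₃ , a₄) , j′) → run-≔ (b′ , trans (+-comm _ 1) (cong suc a₂) ,
       trans a₄ (+-comm (u * n) n) , next u (high s′) (memory s′) j′))
    (run-for n (Inner u) (inner-guard u) (inner u u<n)
      (b , (p , refl , trans q (sym (+-identityʳ (u * n)))) , j)))))

sumTo : ℕ → (ℕ → ℕ) → ℕ
sumTo zero    f = 0
sumTo (suc n) f = sumTo n f + f n

sumTo² : ℕ → (ℕ → ℕ → ℕ) → ℕ
sumTo² n f = sumTo n (λ u → sumTo n (f u))

update-same : ∀ f x v → update f x v x ≡ v
update-same f x v with x ≡ᵇ x | ≡⇒≡ᵇ x x refl
... | true | _ = refl

update-other : ∀ f x v {y} → y ≢ x → update f x v y ≡ f y
update-other f x v {y} p with y ≡ᵇ x in q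
... | false = refl
... | true  = contradiction (≡ᵇ⇒≡ y x (subst T (sym q) _)) p

-- The loop body may read the cell it writes to and all cells outside the
-- range of the writes, since these still hold their original contents.
run-map : ∀ {body n} {T : ℕ → ℕ} (dst : ℕ → ℕ) (f : ℕ → ℕ → ℕ) →
  (∀ i i′ → i < n * n → i′ < n * n → dst i ≡ dst i′ → i ≡ i′) →
  ∀ {s₀} →
  (∀ u v s → u < n → v < n → Base n s → AtPair n u v s → (∀ z → high s z ≡ high s₀ z) →
     (∀ p → (∀ i → i < n * n → p ≢ dst i) → memory s p ≡ memory s₀ p) →
     memory s (dst (u * n + v)) ≡ memory s₀ (dst (u * n + v)) →
     Run body s (T n) (λ s′ → registers s′ ≡ registers s × memory s′ ≡ update (memory s) (dst (u * n + v)) (f u v))) →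
  Base n s₀ →
  Run (pairs body) s₀ (pairsTime T n) (λ s′ → Base n s′ × (∀ z → high s′ z ≡ high s₀ z) ×
    (∀ u v → u < n → v < n → memory s′ (dst (u * n + v)) ≡ f u v) ×
    (∀ p → (∀ i → i < n * n → p ≢ dst i) → memory s′ p ≡ memory s₀ p))
run-map {body} {n} {T} dst f dst-inj {s₀} step b₀ =
  run-weaken ≤-refl
    (λ s′ (b , r , done , _ , other) → b , r ,
       (λ u v u<n v<n → done u v u<n v<n (subst (u * n + v <_) (sym (+-identityʳ (n * n))) (idx-< n n u v u<n v<n))) , other)
    (run-pairs {T = T} Φ step′ (λ u ρ m → subst (Written ρ m) (trans (+-comm (u * n) n) (sym (+-identityʳ _)))) b₀
      ((λ z → refl) , (λ u v u<n v<n ()) , (λ i _ _ → refl) , (λ p _ → refl)))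
  where
  Written : (ℕ → ℕ) → (ℕ → ℕ) → ℕ → Set
  Written ρ m k = (∀ z → ρ z ≡ high s₀ z) ×
    (∀ u v → u < n → v < n → u * n + v < k → m (dst (u * n + v)) ≡ f u v) ×
    (∀ i → i < n * n → k ≤ i → m (dst i) ≡ memory s₀ (dst i)) ×
    (∀ p → (∀ i → i < n * n → p ≢ dst i) → m p ≡ memory s₀ p)
  Φ : ℕ → ℕ → (ℕ → ℕ) → (ℕ → ℕ) → Set
  Φ u v ρ m = Written ρ m (u * n + v)
  step′ : ∀ u v s → u < n → v < n → Base n s → AtPair n u v s → Φ u v (high s) (memory s) →
          Run body s (T n) (λ s′ → Base n s′ × AtPair n u v s′ × Φ u (suc v) (high s′) (memory s′))
  step′ u v s u<n v<n b a (r , done , pending , other) =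
    run-weaken ≤-refl conclude (step u v s u<n v<n b a r other (pending (u * n + v) (idx-< n n u v u<n v<n) ≤-refl))
    where
    here = idx-< n n u v u<n v<n
    conclude : ∀ s′ → registers s′ ≡ registers s × memory s′ ≡ update (memory s) (dst (u * n + v)) (f u v) →
               Base n s′ × AtPair n u v s′ × Φ u (suc v) (high s′) (memory s′)
    conclude ⟪ _ , _ ⟫ (refl , refl) = b , a , r , done′ , pending′ , other′
      where
      done′ : ∀ u′ v′ → u′ < n → v′ < n → u′ * n + v′ < u * n + suc v →
              update (memory s) (dst (u * n + v)) (f u v) (dst (u′ * n + v′)) ≡ f u′ v′
      done′ u′ v′ u′<n v′<n lt with u′ * n + v′ ≟ u * n + v
      ... | yes e with idx-injective n u′ v′ u v v′<n v<n e
      ...   | refl , refl = update-same (memory s) (dst (u * n + v)) (f u v)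
      done′ u′ v′ u′<n v′<n lt | no ne =
        trans (update-other (memory s) _ _ (λ e → ne (dst-inj _ _ (idx-< n n u′ v′ u′<n v′<n) here e)))
          (done u′ v′ u′<n v′<n (≤∧≢⇒< (≤-pred (subst (u′ * n + v′ <_) (+-suc (u * n) v) lt)) ne))
      pending′ : ∀ i → i < n * n → u * n + suc v ≤ i →
                 update (memory s) (dst (u * n + v)) (f u v) (dst i) ≡ memory s₀ (dst i)
      pending′ i i< le =
        trans (update-other (memory s) _ _ (λ e → <⇒≢ lt (sym (dst-inj _ _ i< here e)))) (pending i i< (<⇒≤ lt))
        where
        lt : u * n + v < i
        lt = subst (_≤ i) (+-suc (u * n) v) le
      other′ : ∀ p → (∀ i → i < n * n → p ≢ dst i) → update (memory s) (dst (u * n + v)) (f u v) p ≡ memory s₀ p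
      other′ p ne = trans (update-other (memory s) _ _ (ne _ here)) (other p ne)

-- The machine has no multiplication, but a factor fixed with the program unrolls into additions.
scaleE : ℕ → Expr → Expr
scaleE zero    e = const 0
scaleE (suc a) e = e ⊕ scaleE a e

eval-scale : ∀ a e s → eval (scaleE a e) s ≡ a * eval e s
eval-scale zero    e s = refl
eval-scale (suc a) e s = cong (eval e s +_) (eval-scale a e s)

-- Cell 0 holds the order of the graph. With this offset the input matrices are arrays already in
-- place.
addr : ℕ → ℕ → ℕ → ℕ
addr n a i = 1 + (a * (n * n) + i)

addr-injective : ∀ n a i a′ i′ → i < n * n → i′ < n * n → addr n a i ≡ addr n a′ i′ → a ≡ a′ × i ≡ i′
addr-injective n a i a′ i′ p q e = idx-injective (n * n) a i a′ i′ p q (suc-injective e)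

addrE : ℕ → Expr
addrE a = const 1 ⊕ (scaleE a (reg 1) ⊕ reg 4)

readE : ℕ → Expr
readE a = mem (addrE a)

eval-addr : ∀ {n u v s} a → Base n s → AtPair n u v s → eval (addrE a) s ≡ addr n a (u * n + v)
eval-addr {s = s} a (_ , p) (_ , _ , q) rewrite eval-scale a (reg 1) s | p | q = refl

eval-read : ∀ {n u v s} a → Base n s → AtPair n u v s → eval (readE a) s ≡ memory s (addr n a (u * n + v))
eval-read {s = s} a b p = cong (memory s) (eval-addr {s = s} a b p)

Outside : ℕ → ℕ → ℕ → Set
Outside n a p = ∀ i → i < n * n → p ≢ addr n a i

outside-other : ∀ n {a a′} → a ≢ a′ → ∀ i → i < n * n → Outside n a′ (addr n a i)
outside-other n ne i i< i′ i′< e = ne (proj₁ (addr-injective n _ i _ i′ i< i′< e))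

run-mapArray : ∀ {body n} {T : ℕ → ℕ} a (f : ℕ → ℕ → ℕ) {s₀} →
  (∀ u v s → u < n → v < n → Base n s → AtPair n u v s → (∀ z → high s z ≡ high s₀ z) →
     (∀ p → Outside n a p → memory s p ≡ memory s₀ p) →
     memory s (addr n a (u * n + v)) ≡ memory s₀ (addr n a (u * n + v)) →
     Run body s (T n) (λ s′ → registers s′ ≡ registers s × memory s′ ≡ update (memory s) (addr n a (u * n + v)) (f u v))) →
  Base n s₀ →
  Run (pairs body) s₀ (pairsTime T n) (λ s′ → Base n s′ × (∀ z → high s′ z ≡ high s₀ z) ×
    (∀ u v → u < n → v < n → memory s′ (addr n a (u * n + v)) ≡ f u v) ×
    (∀ p → Outside n a p → memory s′ p ≡ memory s₀ p))
run-mapArray {n = n} {T = T} a f step b =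
  run-map {T = T} (addr n a) f (λ i i′ p q e → proj₂ (addr-injective n a i a i′ p q e)) step b

store-at : ∀ {n u v s} a e x → Base n s → AtPair n u v s → eval e s ≡ x →
  Run (⟦ addrE a ⟧≔ e) s 1 (λ s′ → registers s′ ≡ registers s × memory s′ ≡ update (memory s) (addr n a (u * n + v)) x)
store-at {s = s} a e x b p q = run-store {addrE a} {e} (refl , cong₂ (update (memory s)) (eval-addr {s = s} a b p) q)

eqE : Expr → Expr → Expr
eqE a b = const 1 ⊖ ((a ⊖ b) ⊕ (b ⊖ a))

eval-eq : ∀ a b s → eval (eqE a b) s ≡ ι (eval a s ≡ᵇ eval b s)
eval-eq a b s = go (eval a s) (eval b s)
  where
  go : ∀ x y → 1 ∸ ((x ∸ y) + (y ∸ x)) ≡ ι (x ≡ᵇ y)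
  go zero    zero    = refl
  go zero    (suc y) = 0∸n≡0 y
  go (suc x) zero    = 0∸n≡0 (x + 0)
  go (suc x) (suc y) = go x y

run-sum : ∀ {body n} {T : ℕ → ℕ} (f g : ℕ → ℕ → ℕ) {s₀} →
  (∀ u v s → u < n → v < n → Base n s → AtPair n u v s →
     (∀ z → registers s (7 + z) ≡ registers s₀ (7 + z)) → memory s ≡ memory s₀ →
     Run body s (T n) (λ s′ → Base n s′ × AtPair n u v s′ × registers s′ 5 ≡ registers s 5 + f u v ×
       registers s′ 6 ≡ registers s 6 + g u v ×
       (∀ z → registers s′ (7 + z) ≡ registers s (7 + z)) × memory s′ ≡ memory s)) →
  Base n s₀ → registers s₀ 5 ≡ 0 → registers s₀ 6 ≡ 0 →
  Run (pairs body) s₀ (pairsTime T n) (λ s′ → Base n s′ × registers s′ 5 ≡ sumTo² n f ×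
    registers s′ 6 ≡ sumTo² n g × (∀ z → registers s′ (7 + z) ≡ registers s₀ (7 + z)) × memory s′ ≡ memory s₀)
run-sum {body} {n} {T} f g {s₀} step b z₅ z₆ =
  run-weaken ≤-refl (λ s′ (b′ , p , q , r , m) → b′ , trans p (+-identityʳ _) , trans q (+-identityʳ _) , r , m)
    (run-pairs {T = T} Φ step′ (λ u ρ m (p , q , r) → trans p (sym (+-identityʳ _)) , trans q (sym (+-identityʳ _)) , r) b
      (z₅ , z₆ , (λ _ → refl) , refl))
  where
  partial : (ℕ → ℕ → ℕ) → ℕ → ℕ → ℕ
  partial h u v = sumTo u (λ u → sumTo n (h u)) + sumTo v (h u)
  Φ : ℕ → ℕ → (ℕ → ℕ) → (ℕ → ℕ) → Set
  Φ u v ρ m = ρ 0 ≡ partial f u v × ρ 1 ≡ partial g u v × (∀ z → ρ (2 + z) ≡ registers s₀ (7 + z)) × m ≡ memory s₀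
  step′ : ∀ u v s → u < n → v < n → Base n s → AtPair n u v s → Φ u v (high s) (memory s) →
          Run body s (T n) (λ s′ → Base n s′ × AtPair n u v s′ × Φ u (suc v) (high s′) (memory s′))
  step′ u v s u<n v<n b a (p , q , r , m) = run-weaken ≤-refl
    (λ s′ (b′ , a′ , p′ , q′ , r′ , m′) → b′ , a′ ,
      trans p′ (trans (cong (_+ f u v) p) (+-assoc (sumTo u (λ u → sumTo n (f u))) _ _)) ,
      trans q′ (trans (cong (_+ g u v) q) (+-assoc (sumTo u (λ u → sumTo n (g u))) _ _)) ,
      (λ z → trans (r′ z) (r z)) , trans m′ m)
    (step u v s u<n v<n b a r m)

-- Local search on the machine

anyTo : ℕ → (ℕ → Bool) → Bool
anyTo zero    p = false
anyTo (suc b) p = p b ∨ anyTo b p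

anyTo-witness : ∀ b p → anyTo b p ≡ true → ∃[ i ] i < b × p i ≡ true
anyTo-witness (suc b) p h with p b in eq
... | true  = b , ≤-refl , eq
... | false with anyTo-witness b p h
...   | i , i<b , q = i , m<n⇒m<1+n i<b , q

anyTo-intro : ∀ b p i → i < b → p i ≡ true → anyTo b p ≡ true
anyTo-intro (suc b) p i i<sb q with i ≟ b
... | yes refl rewrite q = refl
... | no ne rewrite anyTo-intro b p i (≤∧≢⇒< (≤-pred i<sb) ne) q = 𝔹ₚ.∨-zeroʳ (p b)

≡ᵇ-true : ∀ {x y} → (x ≡ᵇ y) ≡ true → x ≡ y
≡ᵇ-true {x} {y} p = ≡ᵇ⇒≡ x y (subst T (sym p) _)

≡ᵇ-refl : ∀ x → (x ≡ᵇ x) ≡ true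
≡ᵇ-refl zero    = refl
≡ᵇ-refl (suc x) = ≡ᵇ-refl x

≡ᵇ-sym : ∀ x y → (x ≡ᵇ y) ≡ (y ≡ᵇ x)
≡ᵇ-sym zero    zero    = refl
≡ᵇ-sym zero    (suc y) = refl
≡ᵇ-sym (suc x) zero    = refl
≡ᵇ-sym (suc x) (suc y) = ≡ᵇ-sym x y

-- A move is a tuple τ of K blocks of K vertices each.  It turns the blocks
-- into clusters, where vertices in several blocks go to the last one.
module _ (K : ℕ) (τ : ℕ → ℕ) where

  hit : ℕ → ℕ → Bool
  hit a u = anyTo K (λ b → u ≡ᵇ τ (a * K + b))

  mark : ℕ → ℕ → ℕ
  mark zero    u = 0
  mark (suc a) u = if hit a u then suc a else mark a u

  mark-≤ : ∀ a u → mark a u ≤ a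
  mark-≤ zero    u = z≤n
  mark-≤ (suc a) u with hit a u
  ... | true  = ≤-refl
  ... | false = m≤n⇒m≤1+n (mark-≤ a u)

  mark-block : ∀ a u c → mark a u ≡ suc c → c < a × hit c u ≡ true
  mark-block (suc a) u c p with hit a u in h
  mark-block (suc a) u .a refl | true = ≤-refl , h
  ... | false with mark-block a u c p
  ...   | c<a , q = m<n⇒m<1+n c<a , q

-- The mark 0 means that a vertex stays where it is, `suc a` that block `a` claims it.
regroup : ℕ → ℕ → Bool → Bool
regroup zero    zero    x = x
regroup zero    (suc b) x = false
regroup (suc a) zero    x = false
regroup (suc a) (suc b) x = a ≡ᵇ b

move : ℕ → (ℕ → ℕ) → (ℕ → ℕ → Bool) → ℕ → ℕ → Bool
move K τ X u v = regroup (mark K τ K u) (mark K τ K v) (X u v)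

move-equiv : ∀ K τ {X} → IsEquiv X → IsEquiv (move K τ X)
move-equiv K τ {X} E = record { rfl = r ; sy = s ; tr = t }
  where
  μ = mark K τ K
  r : ∀ u → regroup (μ u) (μ u) (X u u) ≡ true
  r u with μ u
  ... | zero  = rfl E u
  ... | suc a = ≡ᵇ-refl a
  s : ∀ u v → regroup (μ u) (μ v) (X u v) ≡ regroup (μ v) (μ u) (X v u)
  s u v with μ u | μ v
  ... | zero  | zero  = sy E u v
  ... | zero  | suc b = refl
  ... | suc a | zero  = refl
  ... | suc a | suc b = ≡ᵇ-sym a b
  t : ∀ u v w → regroup (μ u) (μ v) (X u v) ≡ true → regroup (μ v) (μ w) (X v w) ≡ true →
      regroup (μ u) (μ w) (X u w) ≡ true
  t u v w p q with μ u | μ v | μ w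
  ... | zero  | zero  | zero  = tr E u v w p q
  ... | suc a | suc b | suc c with ≡ᵇ-true {a} p | ≡ᵇ-true {b} q
  ...   | refl | refl = ≡ᵇ-refl a

anyTo-cong : ∀ b {p q} → (∀ i → i < b → p i ≡ q i) → anyTo b p ≡ anyTo b q
anyTo-cong zero    h = refl
anyTo-cong (suc b) h = cong₂ _∨_ (h b ≤-refl) (anyTo-cong b (λ i i<b → h i (m<n⇒m<1+n i<b)))

mark-cong : ∀ K {τ τ′} a u → a ≤ K → (∀ i → i < K * K → τ i ≡ τ′ i) → mark K τ a u ≡ mark K τ′ a u
mark-cong K zero    u a≤K h = refl
mark-cong K (suc a) u a<K h
  rewrite anyTo-cong K (λ b b<K → cong (u ≡ᵇ_) (h (a * K + b) (idx-< K K a b a<K b<K)))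
        | mark-cong K a u (<⇒≤ a<K) h = refl

sumTo-cong : ∀ n {f g} → (∀ i → f i ≡ g i) → sumTo n f ≡ sumTo n g
sumTo-cong zero    h = refl
sumTo-cong (suc n) h = cong₂ _+_ (sumTo-cong n h) (h n)

-- Clusterings on the machine are relations on all natural numbers, so a tuple entry that is not a
-- vertex needs no separate treatment.
Rows : ℕ → (ℕ → ℕ → Bool) → Set
Rows K X = ∀ r → Σ (ℕ → ℕ) λ e → ∀ u → X r u ≡ true → ∃[ b ] b < K × e b ≡ u

-- A new cluster lies in one block of `K` entries, and an old cluster can only lose vertices.
move-rows : ∀ K τ {X} → Rows K X → Rows K (move K τ X)
move-rows K τ {X} R r with mark K τ K r
... | zero  = proj₁ (R r) , cov
  where
  cov : ∀ u → regroup 0 (mark K τ K u) (X r u) ≡ true → ∃[ b ] b < K × proj₁ (R r) b ≡ u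
  cov u p with mark K τ K u
  ... | zero = proj₂ (R r) u p
... | suc a = (λ b → τ (a * K + b)) , cov
  where
  cov : ∀ u → regroup (suc a) (mark K τ K u) (X r u) ≡ true → ∃[ b ] b < K × τ (a * K + b) ≡ u
  cov u p with mark K τ K u in e
  ... | suc c with ≡ᵇ-true {a} p
  ...   | refl with anyTo-witness K _ (proj₂ (mark-block K τ K u c e))
  ...     | b , b<K , q = b , b<K , sym (≡ᵇ-true q)

hitsE : ℕ → ℕ → ℕ → Expr
hitsE zero    c r = const 0
hitsE (suc b) c r = eqE (reg r) (reg (8 + (c + b))) ⊕ hitsE b c r

hitE : ℕ → ℕ → ℕ → Expr
hitE K a r = const 1 ⊖ (const 1 ⊖ hitsE K (a * K) r)

-- A conditional written as arithmetic. `hitE` is 0 or 1 by double truncation; on a hit the second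
-- summand vanishes, as the earlier mark is at most `a`.
markE : ℕ → ℕ → ℕ → Expr
markE K zero    r = const 0
markE K (suc a) r = scaleE (suc a) (hitE K a r) ⊕ (markE K a r ⊖ scaleE a (hitE K a r))

module _ {τ : ℕ → ℕ} {s : State} {r u : ℕ} (at : registers s r ≡ u) where

  eval-hits : ∀ b c → (∀ i → i < b → registers s (8 + (c + i)) ≡ τ (c + i)) →
              1 ∸ (1 ∸ eval (hitsE b c r) s) ≡ ι (anyTo b (λ i → u ≡ᵇ τ (c + i)))
  eval-hits zero    c h = refl
  eval-hits (suc b) c h
    rewrite eval-eq (reg r) (reg (8 + (c + b))) s | at | h b ≤-refl with u ≡ᵇ τ (c + b)
  ... | true  rewrite 0∸n≡0 (eval (hitsE b c r) s) = refl
  ... | false = eval-hits b c (λ i i<b → h i (m<n⇒m<1+n i<b))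

  eval-mark : ∀ K a → a ≤ K → (∀ i → i < K * K → registers s (8 + i) ≡ τ i) → eval (markE K a r) s ≡ mark K τ a u
  eval-mark K zero    a≤K h = refl
  eval-mark K (suc a) a<K h
    rewrite eval-scale a (hitE K a r) s
          | eval-hits K (a * K) (λ i i<K → h (a * K + i) (idx-< K K a i a<K i<K))
          | eval-mark K a (<⇒≤ a<K) h with hit K τ a u
  ... | true  rewrite *-identityʳ a | m≤n⇒m∸n≡0 (mark-≤ K τ a u) = cong suc (+-identityʳ a)
  ... | false rewrite *-zeroʳ a = refl

-- If both marks are 0, the equality bit is cancelled and the old entry survives; otherwise the sum
-- of the marks cancels the old entry.
newE : ℕ → ℕ → Expr
newE K aX = (readE aX ⊖ both) ⊕ (eqE (markE K K 2) (markE K K 3) ⊖ (const 1 ⊖ both))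
  where
  both : Expr
  both = markE K K 2 ⊕ markE K K 3

regroup-arith : ∀ a b x → (ι x ∸ (a + b)) + (ι (a ≡ᵇ b) ∸ (1 ∸ (a + b))) ≡ ι (regroup a b x)
regroup-arith zero    zero    true  = refl
regroup-arith zero    zero    false = refl
regroup-arith zero    (suc b) true  rewrite 0∸n≡0 b = refl
regroup-arith zero    (suc b) false rewrite 0∸n≡0 b = refl
regroup-arith (suc a) zero    true  rewrite 0∸n≡0 (a + 0) = refl
regroup-arith (suc a) zero    false rewrite 0∸n≡0 (a + 0) = refl
regroup-arith (suc a) (suc b) true  rewrite 0∸n≡0 (a + suc b) = refl
regroup-arith (suc a) (suc b) false rewrite 0∸n≡0 (a + suc b) = refl

ι-choice : ∀ {e st c d T} {Q : State → Set} x → eval e st ≡ ι x →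
           (x ≡ true → Run c st T Q) → (x ≡ false → Run d st T Q) → Run (ifNonzero e c d) st (suc T) Q
ι-choice true  p h₁ h₂ = run-if (λ _ → h₁ refl) (λ q → contradiction (trans (sym p) q) λ ())
ι-choice false p h₁ h₂ = run-if (λ q → contradiction p q) (λ _ → h₂ refl)

module SearchProgram (K aS aJ aX : ℕ) where

  comparison : Cmd
  comparison =
    ifNonzero (readE aX) (5 ≔ (reg 5 ⊕ readE aJ)) (5 ≔ (reg 5 ⊕ readE aS)) ⨾
    ifNonzero (newE K aX) (6 ≔ (reg 6 ⊕ readE aJ)) (6 ≔ (reg 6 ⊕ readE aS))

  tryMove : Cmd
  tryMove =
    5 ≔ const 0 ⨾ 6 ≔ const 0 ⨾ pairs comparison ⨾
    ifNonzero (reg 5 ⊖ reg 6) (pairs (⟦ addrE aX ⟧≔ newE K aX) ⨾ 7 ≔ const 1) skip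

  -- Nested loops over all tuples. Each entry runs from 0 to `n` inclusive; the value `n` is no
  -- vertex and pads blocks that are not full.
  loops : ℕ → Cmd
  loops zero    = tryMove
  loops (suc z) = (8 + z) ≔ const 0 ⨾
    whileNonzero ((reg 0 ⊕ const 1) ⊖ reg (8 + z)) (loops z ⨾ (8 + z) ≔ (reg (8 + z) ⊕ const 1))

  search : Cmd
  search = 7 ≔ const 1 ⨾ whileNonzero (reg 7) (7 ≔ const 0 ⨾ loops (K * K))

tryTime : ℕ → ℕ
tryTime n = 1 + (1 + (pairsTime (λ _ → 2 + 2) n + suc (pairsTime (λ _ → 1) n + 1)))

loopsTime : ℕ → ℕ → ℕ
loopsTime zero    n = tryTime n
loopsTime (suc z) n = 1 + suc (suc n * suc (loopsTime z n + 1))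

searchTime : ℕ → ℕ → ℕ → ℕ
searchTime K c n = 1 + (suc c * suc (1 + loopsTime (K * K) n) + 1)

module LocalSearch (K n aS aJ aX : ℕ) (aS≢aX : aS ≢ aX) (aJ≢aX : aJ ≢ aX) (m₀ : ℕ → ℕ) where

  open SearchProgram K aS aJ aX public

  s j : ℕ → ℕ → ℕ
  s u v = m₀ (addr n aS (u * n + v))
  j u v = m₀ (addr n aJ (u * n + v))

  cost : (ℕ → ℕ → Bool) → ℕ
  cost X = sumTo² n (pay s j X)

  Frame : (ℕ → ℕ) → Set
  Frame m = ∀ p → Outside n aX p → m p ≡ m₀ p

  Stores : (ℕ → ℕ) → (ℕ → ℕ → Bool) → Set
  Stores m X = ∀ u v → u < n → v < n → m (addr n aX (u * n + v)) ≡ ι (X u v)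

  record Represents (X : ℕ → ℕ → Bool) (m : ℕ → ℕ) : Set where
    field
      frame  : Frame m
      stores : Stores m X
      equiv  : IsEquiv X
      rows   : Rows K X

  open Represents

  read-s : ∀ {X u v st} → Represents X (memory st) → u < n → v < n → Base n st → AtPair n u v st → eval (readE aS) st ≡ s u v
  read-s {st = st} h u<n v<n b a = trans (eval-read {s = st} aS b a) (frame h _ (outside-other n aS≢aX _ (idx-< n n _ _ u<n v<n)))

  read-j : ∀ {X u v st} → Represents X (memory st) → u < n → v < n → Base n st → AtPair n u v st → eval (readE aJ) st ≡ j u v
  read-j {st = st} h u<n v<n b a = trans (eval-read {s = st} aJ b a) (frame h _ (outside-other n aJ≢aX _ (idx-< n n _ _ u<n v<n)))

  Tuple : (ℕ → ℕ) → State → Set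
  Tuple τ st = ∀ i → i < K * K → registers st (8 + i) ≡ τ i

  eval-new : ∀ {τ u v st} x → Base n st → AtPair n u v st → memory st (addr n aX (u * n + v)) ≡ ι x → Tuple τ st →
             eval (newE K aX) st ≡ ι (regroup (mark K τ K u) (mark K τ K v) x)
  eval-new {τ} {u} {v} {st} x b a@(a₂ , a₃ , _) m h
    rewrite eval-eq (markE K K 2) (markE K K 3) st
          | eval-mark {τ} {st} {2} a₂ K K ≤-refl h | eval-mark {τ} {st} {3} a₃ K K ≤-refl h
          | eval-read {s = st} aX b a | m = regroup-arith (mark K τ K u) (mark K τ K v) x

  run-comparison : ∀ {τ X st} → Base n st → registers st 5 ≡ 0 → registers st 6 ≡ 0 → Represents X (memory st) → Tuple τ st →
    Run (pairs comparison) st (pairsTime (λ _ → 2 + 2) n) (λ st′ → Base n st′ × registers st′ 5 ≡ cost X ×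
      registers st′ 6 ≡ cost (move K τ X) × (∀ z → registers st′ (7 + z) ≡ registers st (7 + z)) × memory st′ ≡ memory st)
  run-comparison {τ} {X} {st₀} b z₅ z₆ H h = run-sum {T = λ _ → 2 + 2} (pay s j X) (pay s j (move K τ X)) step b z₅ z₆
    where
    step : ∀ u v st → u < n → v < n → Base n st → AtPair n u v st →
      (∀ z → registers st (7 + z) ≡ registers st₀ (7 + z)) → memory st ≡ memory st₀ →
      Run comparison st (2 + 2) (λ s′ → Base n s′ × AtPair n u v s′ × registers s′ 5 ≡ registers st 5 + pay s j X u v ×
        registers s′ 6 ≡ registers st 6 + pay s j (move K τ X) u v ×
        (∀ z → registers s′ (7 + z) ≡ registers st (7 + z)) × memory s′ ≡ memory st)
    step u v st@(⟪ ρ , _ ⟫) u<n v<n b a hi refl = run-⨾ (ι-choice (X u v)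
        (trans (eval-read {s = st} aX b a) (stores H u v u<n v<n))
        (λ x → run-≔ (second _ b a (cong (ρ 5 +_) (trans (read-j {st = st} H u<n v<n b a)
                  (cong (if_then j u v else s u v) (sym x)))) ))
        (λ x → run-≔ (second _ b a (cong (ρ 5 +_) (trans (read-s {st = st} H u<n v<n b a)
                  (cong (if_then j u v else s u v) (sym x)))))))
      where
      second : ∀ x → Base n st → AtPair n u v st → x ≡ ρ 5 + pay s j X u v →
        Run (ifNonzero (newE K aX) (6 ≔ (reg 6 ⊕ readE aJ)) (6 ≔ (reg 6 ⊕ readE aS))) ⟪ update ρ 5 x , memory st₀ ⟫ 2
          (λ s′ → Base n s′ × AtPair n u v s′ × registers s′ 5 ≡ ρ 5 + pay s j X u v ×
            registers s′ 6 ≡ ρ 6 + pay s j (move K τ X) u v ×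
            (∀ z → registers s′ (7 + z) ≡ ρ (7 + z)) × memory s′ ≡ memory st₀)
      second x b a p = ι-choice (move K τ X u v)
        (eval-new {st = st′} (X u v) b a (stores H u v u<n v<n) (λ i i< → trans (hi (1 + i)) (h i i<)))
        (λ y → run-≔ (b , a , p , cong (ρ 6 +_) (trans (read-j {st = st′} H u<n v<n b a)
                  (cong (if_then j u v else s u v) (sym y))) , (λ z → refl) , refl))
        (λ y → run-≔ (b , a , p , cong (ρ 6 +_) (trans (read-s {st = st′} H u<n v<n b a)
                  (cong (if_then j u v else s u v) (sym y))) , (λ z → refl) , refl))
        where
        st′ = ⟪ update ρ 5 x , memory st₀ ⟫

  run-apply : ∀ {τ X st} → Base n st → Represents X (memory st) → Tuple τ st →
    Run (pairs (⟦ addrE aX ⟧≔ newE K aX)) st (pairsTime (λ _ → 1) n) (λ st′ → Base n st′ ×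
      (∀ z → high st′ z ≡ high st z) × Represents (move K τ X) (memory st′))
  run-apply {τ} {X} {st₀} b H h = run-weaken ≤-refl
    (λ st′ (b′ , hi , done , other) → b′ , hi , record
      { frame = λ p o → trans (other p o) (frame H p o) ; stores = done
      ; equiv = move-equiv K τ (equiv H) ; rows = move-rows K τ (rows H) })
    (run-mapArray {T = λ _ → 1} aX (λ u v → ι (move K τ X u v))
      (λ u v st u<n v<n b a hi other cell → store-at {s = st} aX (newE K aX) _ b a
        (eval-new {st = st} (X u v) b a (trans cell (stores H u v u<n v<n)) (λ i i< → trans (hi (3 + i)) (h i i<)))) b)

  module _ (X₀ : ℕ → ℕ → Bool) where

    -- During a pass, register 7 tells whether X₀ has been improved.
    Inv : State → Set
    Inv st = Base n st × Σ (ℕ → ℕ → Bool) λ X → Represents X (memory st) ×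
             ((registers st 7 ≡ 0 × X ≡ X₀) ⊎ (registers st 7 ≡ 1 × cost X < cost X₀))

    NoGain : (ℕ → ℕ) → Set
    NoGain τ = cost X₀ ≤ cost (move K τ X₀)

    -- Within a pass the flag is never cleared. If it is still 0, the stored clustering is still
    -- `X₀`, so the comparison just made concerned `X₀` itself.
    run-tryMove : ∀ {τ st} → Inv st → Tuple τ st →
      Run tryMove st (tryTime n) (λ st′ → Inv st′ × (∀ i → registers st′ (8 + i) ≡ registers st (8 + i)) ×
        (registers st′ 7 ≡ 0 → registers st 7 ≡ 0 × NoGain τ))
    run-tryMove {τ} {st} (b , X , H , status) h =
      run-⨾ (run-≔ (run-⨾ (run-≔ (run-⨾ (run-weaken ≤-refl decide
        (run-comparison {st = ⟪ update (update (registers st) 5 0) 6 0 , memory st ⟫} b refl refl H h))))))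
      where
      cost≤ : cost X ≤ cost X₀
      cost≤ = [ (λ { (_ , refl) → ≤-refl }) , (λ (_ , lt) → <⇒≤ lt) ]′ status
      decide : ∀ st′ → Base n st′ × registers st′ 5 ≡ cost X × registers st′ 6 ≡ cost (move K τ X) ×
        (∀ z → registers st′ (7 + z) ≡ registers st (7 + z)) × memory st′ ≡ memory st →
        Run (ifNonzero (reg 5 ⊖ reg 6) (pairs (⟦ addrE aX ⟧≔ newE K aX) ⨾ 7 ≔ const 1) skip) st′
          (suc (pairsTime (λ _ → 1) n + 1))
          (λ st″ → Inv st″ × (∀ i → registers st″ (8 + i) ≡ registers st (8 + i)) ×
            (registers st″ 7 ≡ 0 → registers st 7 ≡ 0 × NoGain τ))
      decide st′@(⟪ ρ , _ ⟫) (b′ , p , q , hi , refl) = run-if improve keep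
        where
        improve : ρ 5 ∸ ρ 6 ≢ 0 → _
        improve ne = run-⨾ (run-weaken ≤-refl
          (λ st″ (b″ , hi″ , H″) → run-≔ ((b″ , move K τ X , H″ , inj₂ (refl , <-≤-trans better cost≤)) ,
            (λ i → trans (hi″ (3 + i)) (hi (1 + i))) , λ ()))
          (run-apply {st = st′} b′ H (λ i i< → trans (hi (1 + i)) (h i i<))))
          where
          better : cost (move K τ X) < cost X
          better = ≰⇒> (λ le → ne (m≤n⇒m∸n≡0 (subst₂ _≤_ (sym p) (sym q) le)))
        keep : ρ 5 ∸ ρ 6 ≡ 0 → _
        keep z = run-weaken (≤-trans (s≤s z≤n) (m≤n+m 1 (pairsTime (λ _ → 1) n))) (λ _ x → x)
          (run-skip ((b′ , X , H , subst (λ r → (r ≡ 0 × X ≡ X₀) ⊎ (r ≡ 1 × cost X < cost X₀)) (sym (hi 0)) status) ,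
            (λ i → hi (1 + i)) , λ f → let f′ = trans (sym (hi 0)) f in f′ , no-gain f′))
          where
          no-gain : registers st 7 ≡ 0 → NoGain τ
          no-gain f = [ (λ { (_ , refl) → subst₂ _≤_ p q (m∸n≡0⇒m≤n z) }) ,
                        (λ (g , _) → contradiction (trans (sym f) g) λ ()) ]′ status

  module _ (X₀ : ℕ → ℕ → Bool) where

    -- Entries from `z` on are fixed by the registers and entries below range freely, which makes an
    -- induction on the nesting depth possible. An improvement changes the clustering in mid-pass,
    -- so the claim is conditional on the flag.
    run-loops : ∀ z {st} → z ≤ K * K → Inv X₀ st →
      Run (loops z) st (loopsTime z n) (λ st′ → Inv X₀ st′ × (∀ i → z ≤ i → registers st′ (8 + i) ≡ registers st (8 + i)) ×
        (registers st′ 7 ≡ 0 → registers st 7 ≡ 0 ×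
          (∀ τ → (∀ i → i < z → τ i ≤ n) → (∀ i → z ≤ i → i < K * K → registers st (8 + i) ≡ τ i) → NoGain X₀ τ)))
    run-loops zero {st} z≤ inv = run-weaken ≤-refl
      (λ st′ (inv′ , hi , fact) → inv′ , (λ i _ → hi i) ,
        λ f → proj₁ (fact f) , λ τ _ h → subst (cost X₀ ≤_) (same-move τ h) (proj₂ (fact f)))
      (run-tryMove X₀ {τ = λ i → registers st (8 + i)} inv (λ i _ → refl))
      where
      same-move : ∀ τ → (∀ i → 0 ≤ i → i < K * K → registers st (8 + i) ≡ τ i) →
                  cost (move K (λ i → registers st (8 + i)) X₀) ≡ cost (move K τ X₀)
      same-move τ h = sumTo-cong n (λ u → sumTo-cong n (λ v → cong (if_then j u v else s u v)
        (cong₂ (λ a b → regroup a b (X₀ u v)) (same-mark u) (same-mark v))))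
        where
        same-mark : ∀ u → mark K (λ i → registers st (8 + i)) K u ≡ mark K τ K u
        same-mark u = mark-cong K K u ≤-refl (λ i → h i z≤n)
    run-loops (suc z) {st} z< inv =
      run-⨾ (run-≔ (run-weaken ≤-refl finish
        (run-for (suc n) I (λ i st′ ((b , _) , _ , x , _) → cong₂ _∸_ (trans (cong (_+ 1) (proj₁ b)) (+-comm n 1)) x) step
          (inv , (λ i z<i → update-other (registers st) (8 + z) 0 (λ e → <⇒≢ z<i (sym (+-cancelˡ-≡ 8 _ _ e)))) ,
           update-same (registers st) (8 + z) 0 , λ f → f , λ τ _ ()))))
      where
      I : ℕ → State → Set
      I c st′ = Inv X₀ st′ × (∀ i → z < i → registers st′ (8 + i) ≡ registers st (8 + i)) × registers st′ (8 + z) ≡ c ×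
        (registers st′ 7 ≡ 0 → registers st 7 ≡ 0 ×
          (∀ τ → (∀ i → i < z → τ i ≤ n) → τ z < c → (∀ i → z < i → i < K * K → registers st (8 + i) ≡ τ i) → NoGain X₀ τ))
      finish : ∀ st′ → I (suc n) st′ → _
      finish st′ (inv′ , hi , _ , fact) = inv′ , hi , λ f → proj₁ (fact f) ,
        λ τ le h → proj₂ (fact f) τ (λ i i<z → le i (m<n⇒m<1+n i<z)) (s≤s (le z ≤-refl)) h
      step : ∀ c st′ → c < suc n → I c st′ →
             Run (loops z ⨾ (8 + z) ≔ (reg (8 + z) ⊕ const 1)) st′ (loopsTime z n + 1) (I (suc c))
      step c st′ _ (inv′ , hi , x , fact) = run-⨾ (run-weaken ≤-refl after (run-loops z (<⇒≤ z<) inv′))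
        where
        after : ∀ st″ → Inv X₀ st″ × (∀ i → z ≤ i → registers st″ (8 + i) ≡ registers st′ (8 + i)) ×
          (registers st″ 7 ≡ 0 → registers st′ 7 ≡ 0 ×
            (∀ τ → (∀ i → i < z → τ i ≤ n) → (∀ i → z ≤ i → i < K * K → registers st′ (8 + i) ≡ τ i) → NoGain X₀ τ)) →
          Run ((8 + z) ≔ (reg (8 + z) ⊕ const 1)) st″ 1 (I (suc c))
        after st″ (inv″ , hi″ , fact″) = run-≔ (inv″ ,
          (λ i z<i → trans (update-other (registers st″) (8 + z) _ (λ e → <⇒≢ z<i (sym (+-cancelˡ-≡ 8 _ _ e))))
                       (trans (hi″ i (<⇒≤ z<i)) (hi i z<i))) ,
          trans (update-same (registers st″) (8 + z) _) (trans (cong (_+ 1) (trans (hi″ z ≤-refl) x)) (+-comm c 1)) ,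
          λ f → proj₁ (fact (proj₁ (fact″ f))) , gain f)
          where
          gain : registers st″ 7 ≡ 0 → ∀ τ → (∀ i → i < z → τ i ≤ n) → τ z < suc c →
                 (∀ i → z < i → i < K * K → registers st (8 + i) ≡ τ i) → NoGain X₀ τ
          gain f τ le lt h with τ z ≟ c
          ... | yes e = proj₂ (fact″ f) τ le agree
            where
            agree : ∀ i → z ≤ i → i < K * K → registers st′ (8 + i) ≡ τ i
            agree i z≤i i< with z ≟ i
            ... | yes refl = trans x (sym e)
            ... | no ne    = trans (hi i (≤∧≢⇒< z≤i ne)) (h i (≤∧≢⇒< z≤i ne) i<)
          ... | no ne = proj₂ (fact (proj₁ (fact″ f))) τ le (≤∧≢⇒< (≤-pred lt) ne) h

  LocallyOptimal : (ℕ → ℕ → Bool) → Set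
  LocallyOptimal X = ∀ τ → (∀ i → i < K * K → τ i ≤ n) → cost X ≤ cost (move K τ X)

  Found : State → Set
  Found st = Base n st × Σ (ℕ → ℕ → Bool) λ X → Represents X (memory st) × LocallyOptimal X

  -- Every pass that sets the flag lowers a natural number bounded by `c`. A pass that leaves it at
  -- 0 has tested all tuples against the final clustering.
  run-search : ∀ c {X st} → Base n st → Represents X (memory st) → cost X ≤ c →
               Run search st (searchTime K c n) Found
  run-search c {X} b H le = run-⨾ (run-≔ (passes c b refl H le))
    where
    L = loopsTime (K * K) n
    passes : ∀ c {X st} → Base n st → registers st 7 ≡ 1 → Represents X (memory st) → cost X ≤ c →
             Run (whileNonzero (reg 7) (7 ≔ const 0 ⨾ loops (K * K))) st (suc c * suc (1 + L) + 1) Found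
    passes c {X} {st} b f H le
      with run-⨾ {7 ≔ const 0} {s = st} (run-≔ (run-loops X (K * K) ≤-refl (b , X , H , inj₁ (refl , refl))))
    ... | t , st′ , r , t≤ , (b′ , X′ , H′ , inj₁ (z , refl)) , _ , fact =
      suc (t + 1) , st′ , ⇓repeat (λ e → contradiction (trans (sym f) e) λ ()) r (⇓exit z) ,
      +-mono-≤ (≤-trans (s≤s t≤) (m≤m+n (suc (1 + L)) (c * suc (1 + L)))) ≤-refl ,
      (b′ , X , H′ , λ τ le′ → proj₂ (fact z) τ le′ (λ i K²≤i i< → contradiction i< (≤⇒≯ K²≤i)))
    passes zero {X} {st} b f H le | t , st′ , r , t≤ , (b′ , X′ , H′ , inj₂ (o , lt)) , _ =
      contradiction (<-≤-trans lt le) λ ()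
    passes (suc c) {X} {st} b f H le | t , st′ , r , t≤ , (b′ , X′ , H′ , inj₂ (o , lt)) , _
      with passes c b′ o H′ (≤-pred (<-≤-trans lt le))
    ... | t′ , st″ , r′ , t≤′ , q =
      suc (t + t′) , st″ , ⇓repeat (λ e → contradiction (trans (sym f) e) λ ()) r r′ ,
      ≤-trans (+-mono-≤ (s≤s t≤) t≤′) (≤-reflexive (sym (+-assoc (suc (1 + L)) (suc c * suc (1 + L)) 1))) , q

tryTime-poly : Poly tryTime
tryTime-poly = poly-suc (poly-suc (poly-+ (pairsTime-poly (poly-const 4))
  (poly-suc (poly-+ (pairsTime-poly (poly-const 1)) (poly-const 1)))))

loopsTime-poly : ∀ z → Poly (loopsTime z)
loopsTime-poly zero    = tryTime-poly
loopsTime-poly (suc z) = poly-suc (poly-suc (poly-* (poly-suc poly-id) (poly-suc (poly-+ (loopsTime-poly z) (poly-const 1)))))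

searchTime-poly : ∀ K {c} → Poly c → Poly (λ n → searchTime K (c n) n)
searchTime-poly K p = poly-suc (poly-+ (poly-* (poly-suc p) (poly-suc (poly-suc (loopsTime-poly (K * K))))) (poly-const 1))

-- From moves on the machine to reset

sumTo-head : ∀ n f → sumTo (suc n) f ≡ f 0 + sumTo n (f ∘ suc)
sumTo-head zero    f = sym (+-identityʳ (f 0))
sumTo-head (suc n) f = trans (cong (_+ f (suc n)) (sumTo-head n f)) (+-assoc (f 0) _ _)

sumTo-∑ : ∀ n f → sumTo n f ≡ sum {n} (f ∘ toℕ)
sumTo-∑ zero    f = refl
sumTo-∑ (suc n) f = trans (sumTo-head n f) (cong (f 0 +_) (sumTo-∑ n (f ∘ suc)))

sumTo²-∑² : ∀ n f → sumTo² n f ≡ ∑² {n} (λ u v → f (toℕ u) (toℕ v))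
sumTo²-∑² n f = trans (sumTo-∑ n _) (sum-cong-≗ {n} (λ u → sumTo-∑ n (f (toℕ u))))

sumTo-bound : ∀ n f b → (∀ i → i < n → f i ≤ b) → sumTo n f ≤ n * b
sumTo-bound zero    f b h = z≤n
sumTo-bound (suc n) f b h = ≤-trans (+-mono-≤ (sumTo-bound n f b (λ i i<n → h i (m<n⇒m<1+n i<n))) (h n ≤-refl))
                              (≤-reflexive (+-comm (n * b) b))

restrict : ∀ {A : Set} n → (ℕ → ℕ → A) → Fin n → Fin n → A
restrict n f u v = f (toℕ u) (toℕ v)

restrict-equiv : ∀ {n X} → IsEquiv X → IsEquiv (restrict n X)
restrict-equiv E = record
  { rfl = λ u → rfl E (toℕ u) ; sy = λ u v → sy E (toℕ u) (toℕ v) ; tr = λ u v w → tr E (toℕ u) (toℕ v) (toℕ w) }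

restrict-rows : ∀ {n K X} → Rows K X → RowsWithin K (restrict n X)
restrict-rows {n} {K} {X} R r = clip ∘ e ∘ toℕ , cov
  where
  e = proj₁ (R (toℕ r))
  clip : ℕ → Fin n
  clip x with x <? n
  ... | yes p = fromℕ< p
  ... | no _  = r
  clip-toℕ : ∀ u → clip (toℕ u) ≡ u
  clip-toℕ u with toℕ u <? n
  ... | yes p = Finₚ.fromℕ<-toℕ u p
  ... | no p  = contradiction (Finₚ.toℕ<n u) p
  cov : ∀ u → X (toℕ r) (toℕ u) ≡ true → ∃[ a ] clip (e (toℕ a)) ≡ u
  cov u p with proj₂ (R (toℕ r)) (toℕ u) p
  ... | b , b<K , q = fromℕ< b<K ,
    trans (cong (clip ∘ e) (Finₚ.toℕ-fromℕ< b<K)) (trans (cong clip q) (clip-toℕ u))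

module _ (K : ℕ) (τ : ℕ → ℕ) where

  mark-agree : ∀ a u v → (∀ c → c < a → hit K τ c u ≡ hit K τ c v) → mark K τ a u ≡ mark K τ a v
  mark-agree zero    u v h = refl
  mark-agree (suc a) u v h rewrite h a ≤-refl | mark-agree a u v (λ c c<a → h c (m<n⇒m<1+n c<a)) = refl

  mark-none : ∀ a u → (∀ c → c < a → hit K τ c u ≡ false) → mark K τ a u ≡ 0
  mark-none zero    u h = refl
  mark-none (suc a) u h rewrite h a ≤-refl = mark-none a u (λ c c<a → h c (m<n⇒m<1+n c<a))

  mark-some : ∀ a u c → c < a → hit K τ c u ≡ true → ∃[ d ] mark K τ a u ≡ suc d
  mark-some (suc a) u c c<a p with hit K τ a u in q
  ... | true  = a , refl
  ... | false = mark-some a u c (≤∧≢⇒< (≤-pred c<a) (λ { refl → contradiction (trans (sym p) q) λ () })) p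

-- The reset of `N` as a tuple: block `a` lists the part in `N` of the cluster of `O` through `e a`,
-- and the other slots hold the padding value `n`.
module Realisation {k n : ℕ} {O : BRel n} (E : IsEquiv O) (rowsO : RowsWithin (suc k) O)
  (N : Fin n → Bool) (covered : CoveredBy (suc k) O N) where

  private
    K = suc k
    e = proj₁ covered

  slot : Fin K → Fin K → ℕ
  slot a b = if N x ∧ O (e a) x then toℕ x else n
    where
    x = proj₁ (rowsO (e a)) b

  slotℕ : ℕ → ℕ → ℕ
  slotℕ a b with a <? K | b <? K
  ... | yes p | yes q = slot (fromℕ< p) (fromℕ< q)
  ... | _     | _     = n

  τ : ℕ → ℕ
  τ z = slotℕ (z div K) (z mod K)

  slot-≤ : ∀ a b → slot a b ≤ n
  slot-≤ a b with N (proj₁ (rowsO (e a)) b) ∧ O (e a) (proj₁ (rowsO (e a)) b)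
  ... | true  = <⇒≤ (Finₚ.toℕ<n _)
  ... | false = ≤-refl

  τ-≤ : ∀ z → τ z ≤ n
  τ-≤ z with z div K <? K | z mod K <? K
  ... | yes p | yes q = slot-≤ (fromℕ< p) (fromℕ< q)
  ... | yes _ | no _  = ≤-refl
  ... | no _  | _     = ≤-refl

  τ-slot : ∀ (a b : Fin K) → τ (toℕ a * K + toℕ b) ≡ slot a b
  τ-slot a b = trans (cong₂ slotℕ quotient remainder) at
    where
    quotient : (toℕ a * K + toℕ b) div K ≡ toℕ a
    quotient = trans (+-distrib-/-∣ˡ {toℕ a * K} (toℕ b) {K} (n∣m*n (toℕ a)))
      (trans (cong₂ _+_ (m*n/n≡m (toℕ a) K) (m<n⇒m/n≡0 (Finₚ.toℕ<n b))) (+-identityʳ _))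
    remainder : (toℕ a * K + toℕ b) mod K ≡ toℕ b
    remainder = trans (cong (_mod K) (+-comm (toℕ a * K) (toℕ b)))
      (trans ([m+kn]%n≡m%n (toℕ b) (toℕ a) K) (m<n⇒m%n≡m (Finₚ.toℕ<n b)))
    at : slotℕ (toℕ a) (toℕ b) ≡ slot a b
    at with toℕ a <? K | toℕ b <? K
    ... | yes p | yes q = cong₂ slot (Finₚ.fromℕ<-toℕ a p) (Finₚ.fromℕ<-toℕ b q)
    ... | yes _ | no q  = contradiction (Finₚ.toℕ<n b) q
    ... | no p  | _     = contradiction (Finₚ.toℕ<n a) p

  hit-exact : ∀ (a : Fin K) u → hit K τ (toℕ a) (toℕ u) ≡ N u ∧ O (e a) u
  hit-exact a u with hit K τ (toℕ a) (toℕ u) in p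
  ... | true = sym (found (anyTo-witness K _ p))
    where
    found : (∃[ b ] b < K × (toℕ u ≡ᵇ τ (toℕ a * K + b)) ≡ true) → N u ∧ O (e a) u ≡ true
    found (b , b<K , q) = inside (fromℕ< b<K)
      (trans (≡ᵇ-true q) (trans (cong (λ c → τ (toℕ a * K + c)) (sym (Finₚ.toℕ-fromℕ< b<K))) (τ-slot a (fromℕ< b<K))))
      where
      inside : ∀ b → toℕ u ≡ slot a b → N u ∧ O (e a) u ≡ true
      inside b r with N (proj₁ (rowsO (e a)) b) ∧ O (e a) (proj₁ (rowsO (e a)) b) in t
      ... | true  rewrite Finₚ.toℕ-injective r = t
      ... | false = contradiction r (<⇒≢ (Finₚ.toℕ<n u))
  ... | false with N u ∧ O (e a) u in q
  ...   | false = refl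
  ...   | true with proj₂ (rowsO (e a)) u (proj₂ (∧-true {N u} q))
  ...     | b , refl = trans (sym p) (anyTo-intro K _ (toℕ b) (Finₚ.toℕ<n b)
              (subst (λ z → (toℕ x ≡ᵇ z) ≡ true) (sym (trans (τ-slot a b) here)) (≡ᵇ-refl (toℕ x))))
    where
    x = proj₁ (rowsO (e a)) b
    here : slot a b ≡ toℕ x
    here rewrite q = refl

  hit-at : ∀ c → c < K → ∀ u → ∃[ a ] hit K τ c (toℕ u) ≡ N u ∧ O (e a) u × c ≡ toℕ a
  hit-at c c<K u = fromℕ< c<K ,
    trans (cong (λ c → hit K τ c (toℕ u)) (sym (Finₚ.toℕ-fromℕ< c<K))) (hit-exact (fromℕ< c<K) u) , sym (Finₚ.toℕ-fromℕ< c<K)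

  mark-outside : ∀ u → N u ≡ false → mark K τ K (toℕ u) ≡ 0
  mark-outside u p = mark-none K τ K (toℕ u)
    (λ c c<K → let a , q , _ = hit-at c c<K u in trans q (cong (_∧ O (e a) u) p))

  mark-inside : ∀ u → N u ≡ true → ∃[ d ] mark K τ K (toℕ u) ≡ suc d
  mark-inside u p with proj₂ covered u p
  ... | a , q = mark-some K τ K (toℕ u) (toℕ a) (Finₚ.toℕ<n a) (trans (hit-exact a u) (cong₂ _∧_ p q))

  mark-class : ∀ u d → mark K τ K (toℕ u) ≡ suc d → ∃[ a ] O (e a) u ≡ true × d ≡ toℕ a
  mark-class u d p with mark-block K τ K (toℕ u) d p
  ... | d<K , h with hit-at d d<K u
  ...   | a , q , r = a , proj₂ (∧-true {N u} (trans (sym q) h)) , r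

  O-resp : ∀ x u v → O u v ≡ true → O x u ≡ O x v
  O-resp x u v p with O x u in q | O x v in r
  ... | true  | true  = refl
  ... | false | false = refl
  ... | true  | false = trans (sym (tr E x u v q p)) r
  ... | false | true  = trans (sym q) (tr E x v u r (trans (sy E v u) p))

  -- Several representatives `e a` may share a cluster of `O`. The same blocks then hit all its
  -- vertices in `N`, and the last of these blocks claims them together.
  same-mark : ∀ u v → N u ≡ N v → O u v ≡ true → mark K τ K (toℕ u) ≡ mark K τ K (toℕ v)
  same-mark u v p q = mark-agree K τ K (toℕ u) (toℕ v) agree
    where
    agree : ∀ c → c < K → hit K τ c (toℕ u) ≡ hit K τ c (toℕ v)
    agree c c<K = begin
      hit K τ c (toℕ u)          ≡⟨ cong (λ c → hit K τ c (toℕ u)) (Finₚ.toℕ-fromℕ< c<K) ⟨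
      hit K τ (toℕ a) (toℕ u)    ≡⟨ hit-exact a u ⟩
      N u ∧ O (e a) u            ≡⟨ cong₂ _∧_ p (O-resp (e a) u v q) ⟩
      N v ∧ O (e a) v            ≡⟨ hit-exact a v ⟨
      hit K τ (toℕ a) (toℕ v)    ≡⟨ cong (λ c → hit K τ c (toℕ v)) (Finₚ.toℕ-fromℕ< c<K) ⟩
      hit K τ c (toℕ v)          ∎
      where
      open ≡-Reasoning
      a = fromℕ< c<K

  move-is-reset : ∀ X u v → move K τ X (toℕ u) (toℕ v) ≡ reset N O (restrict n X) u v
  move-is-reset X u v with N u in p | N v in q
  ... | false | false rewrite mark-outside u p | mark-outside v q = refl
  ... | true  | false rewrite mark-outside v q | proj₂ (mark-inside u p) = refl
  ... | false | true  rewrite mark-outside u p | proj₂ (mark-inside v q) = refl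
  ... | true  | true with mark-inside u p | mark-inside v q
  ...   | c , mu | d , mv with O u v in o
  ...     | true rewrite sym (same-mark u v (trans p (sym q)) o) | mu = ≡ᵇ-refl c
  ...     | false rewrite mu | mv with c ≡ᵇ d in cd
  ...       | false = refl
  ...       | true with mark-class u c mu | mark-class v d mv
  ...         | a , r , ca | a′ , r′ , da′ with Finₚ.toℕ-injective (trans (sym ca) (trans (≡ᵇ-true cd) da′))
  ...           | refl = trans (sym (tr E u (e a) v (trans (sy E u (e a)) r) r′)) o

module _ (k n aS aJ aX : ℕ) (p : aS ≢ aX) (q : aJ ≢ aX) (m₀ : ℕ → ℕ) where
  open LocalSearch (suc k) n aS aJ aX p q m₀

  cost-restrict : ∀ X → cost X ≡ total (restrict n s) (restrict n j) (restrict n X)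
  cost-restrict X = sumTo²-∑² n (pay s j X)

  locallyOptimal⇒stable : ∀ {X} → LocallyOptimal X → ∀ {O} → IsEquiv O → RowsWithin (suc k) O →
                          Stable (suc k) (restrict n s) (restrict n j) O (restrict n X)
  locallyOptimal⇒stable {X} opt {O} E R N c = begin
    total s′ j′ (restrict n X)                      ≡⟨ cost-restrict X ⟨
    cost X                                          ≤⟨ opt τ (λ i _ → τ-≤ i) ⟩
    cost (move (suc k) τ X)                         ≡⟨ cost-restrict (move (suc k) τ X) ⟩
    total s′ j′ (restrict n (move (suc k) τ X))     ≡⟨ ∑²-cong (λ u v → cong (if_then j′ u v else s′ u v) (move-is-reset X u v)) ⟩
    total s′ j′ (reset N O (restrict n X))          ∎
    where
    open ≤-Reasoning
    open Realisation E R N c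
    s′ = restrict n s
    j′ = restrict n j

-- The stages of the program

Arr : ℕ → ℕ → (ℕ → ℕ → ℕ) → (ℕ → ℕ) → Set
Arr n a f m = ∀ u v → u < n → v < n → m (addr n a (u * n + v)) ≡ f u v

SameOutside : ℕ → ℕ → (ℕ → ℕ) → (ℕ → ℕ) → Set
SameOutside n a m m₀ = ∀ p → Outside n a p → m p ≡ m₀ p

keep : ∀ {n a b f m m₀} → b ≢ a → SameOutside n a m m₀ → Arr n b f m₀ → Arr n b f m
keep {n} ne o A u v u<n v<n = trans (o _ (outside-other n ne _ (idx-< n n u v u<n v<n))) (A u v u<n v<n)

read-arr : ∀ {n u v st} b {f} → Arr n b f (memory st) → u < n → v < n → Base n st → AtPair n u v st →
           eval (readE b) st ≡ f u v
read-arr {st = st} b A u<n v<n p q = trans (eval-read {s = st} b p q) (A _ _ u<n v<n)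

Written : ℕ → ℕ → ℕ → ℕ → ℕ → State → State → Set
Written n a u v x s s′ = registers s′ ≡ registers s × memory s′ ≡ update (memory s) (addr n a (u * n + v)) x

store-choice : ∀ {n u v s} a e e₁ e₂ b {x} → Base n s → AtPair n u v s → eval e s ≡ ι b →
  (b ≡ true → eval e₁ s ≡ x) → (b ≡ false → eval e₂ s ≡ x) →
  Run (ifNonzero e (⟦ addrE a ⟧≔ e₁) (⟦ addrE a ⟧≔ e₂)) s 2 (Written n a u v x s)
store-choice {s = s} a e e₁ e₂ b p q h h₁ h₂ =
  ι-choice b h (λ t → store-at {s = s} a e₁ _ p q (h₁ t)) (λ t → store-at {s = s} a e₂ _ p q (h₂ t))

Filled : ℕ → ℕ → (ℕ → ℕ → ℕ) → State → State → Set
Filled n a f s₀ s = Base n s × (∀ z → high s z ≡ high s₀ z) × Arr n a f (memory s) × SameOutside n a (memory s) (memory s₀)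

sepW : (g f : ℕ → ℕ → Bool) → ℕ → ℕ → ℕ → ℕ
sepW g f w u v = if u ≡ᵇ v then 0 else (ι (g u v) + when (f u v) w)

joinW : (g h : ℕ → ℕ → Bool) → ℕ → ℕ → ℕ → ℕ
joinW g h = sepW (λ u v → not (g u v)) h

-- Exceeds the bounds arising in no-violation, so that constraints can be
-- encoded as costs and the program need not look for a feasible clustering.
weight : ℕ → ℕ
weight n = 1 + 4 * (n * n)

weightE : Expr
weightE = const 1 ⊕ scaleE 4 (reg 1)

eval-weight : ∀ {n} s → Base n s → eval weightE s ≡ weight n
eval-weight s (_ , p) = cong suc (trans (eval-scale 4 (reg 1) s) (cong (4 *_) p))

not-arith : ∀ b → 1 ∸ ι b ≡ ι (not b)
not-arith true  = refl
not-arith false = refl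

diagonalE : Expr
diagonalE = eqE (reg 2) (reg 3)

eval-diagonal : ∀ {n u v} s → AtPair n u v s → eval diagonalE s ≡ ι (u ≡ᵇ v)
eval-diagonal s (p , q , _) = trans (eval-eq (reg 2) (reg 3) s) (cong₂ (λ x y → ι (x ≡ᵇ y)) p q)

fillWeights : ℕ → ℕ → Expr → Cmd
fillWeights a b e = pairs
  (ifNonzero diagonalE (⟦ addrE a ⟧≔ const 0)
    (ifNonzero (readE b) (⟦ addrE a ⟧≔ (e ⊕ weightE)) (⟦ addrE a ⟧≔ e)))

run-fillWeights : ∀ {n s₀} a b e (g f : ℕ → ℕ → Bool) → b ≢ a →
  (∀ u v s → u < n → v < n → Base n s → AtPair n u v s → SameOutside n a (memory s) (memory s₀) → eval e s ≡ ι (g u v)) →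
  Arr n b (λ u v → ι (f u v)) (memory s₀) → Base n s₀ →
  Run (fillWeights a b e) s₀ (pairsTime (λ _ → 3) n) (Filled n a (sepW g f (weight n)) s₀)
run-fillWeights {n} {s₀} a b e g f ne he A = run-mapArray {T = λ _ → 3} a (sepW g f (weight n)) step
  where
  step : ∀ u v s → u < n → v < n → Base n s → AtPair n u v s → (∀ z → high s z ≡ high s₀ z) →
    SameOutside n a (memory s) (memory s₀) → memory s (addr n a (u * n + v)) ≡ memory s₀ (addr n a (u * n + v)) →
    Run _ s 3 (Written n a u v (sepW g f (weight n) u v) s)
  step u v s u<n v<n p q _ o _ = ι-choice (u ≡ᵇ v) (eval-diagonal s q)
    (λ t → run-weaken (s≤s z≤n) (λ _ x → x) (store-at {s = s} a (const 0) _ p q (sym (on t))))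
    (λ t → store-choice {s = s} a (readE b) (e ⊕ weightE) e (f u v) p q
      (read-arr {st = s} b (keep ne o A) u<n v<n p q)
      (λ r → trans (cong₂ _+_ (he u v s u<n v<n p q o) (eval-weight s p)) (sym (off t true r)))
      (λ r → trans (he u v s u<n v<n p q o) (trans (sym (+-identityʳ _)) (sym (off t false r)))))
    where
    on : (u ≡ᵇ v) ≡ true → sepW g f (weight n) u v ≡ 0
    on t rewrite t = refl
    off : (u ≡ᵇ v) ≡ false → ∀ c → f u v ≡ c → sepW g f (weight n) u v ≡ ι (g u v) + when c (weight n)
    off t c r rewrite t | r = refl

stable-cong : ∀ {n k} {s s′ j j′ : Fin n → Fin n → ℕ} {O L} → (∀ u v → s u v ≡ s′ u v) → (∀ u v → j u v ≡ j′ u v) →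
              Stable k s j O L → Stable k s′ j′ O L
stable-cong {s = s} {s′} {j} {j′} {O} {L} p q stable N c = subst₂ _≤_ (same L) (same (reset N O L)) (stable N c)
  where
  same : ∀ X → total s j X ≡ total s′ j′ X
  same X = ∑²-cong (λ u v → cong₂ (λ x y → if X u v then y else x) (p u v) (q u v))

-- The search starts from singletons, which meet the size bound but may violate constraints. Since
-- penalties are polynomial in `n`, so are the initial cost and the number of passes.
clusterSearch : (k aS aJ aX : ℕ) → Cmd
clusterSearch k aS aJ aX = pairs (⟦ addrE aX ⟧≔ diagonalE) ⨾ SearchProgram.search (suc k) aS aJ aX

clusterSearchTime : ℕ → (ℕ → ℕ) → ℕ → ℕ
clusterSearchTime k M n = pairsTime (λ _ → 1) n + searchTime (suc k) (n * (n * M n)) n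

-- The machine does not know the optimum, so stability is stated for every clustering with clusters
-- of the given size.
StableAll : (k n : ℕ) → (s j : ℕ → ℕ → ℕ) → (ℕ → ℕ → Bool) → Set
StableAll k n s j X = ∀ {O} → IsEquiv O → RowsWithin (suc k) O → Stable (suc k) (restrict n s) (restrict n j) O (restrict n X)

record Clusters (k n aX : ℕ) (s j : ℕ → ℕ → ℕ) (m₀ : ℕ → ℕ) (X : ℕ → ℕ → Bool) (st : State) : Set where
  field
    base    : Base n st
    stored  : Arr n aX (λ u v → ι (X u v)) (memory st)
    outside : SameOutside n aX (memory st) m₀
    equiv   : IsEquiv X
    rows    : Rows (suc k) X
    stable  : StableAll k n s j X

run-clusterSearch : ∀ {n s₀} k M aS aJ aX {s j} → aS ≢ aX → aJ ≢ aX →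
  Arr n aS s (memory s₀) → Arr n aJ j (memory s₀) →
  (∀ u v → s u v ≤ M n) → (∀ u v → j u v ≤ M n) → Base n s₀ →
  Run (clusterSearch k aS aJ aX) s₀ (clusterSearchTime k M n)
    (λ st → ∃[ X ] Clusters k n aX s j (memory s₀) X st)
run-clusterSearch {n} {s₀} k M aS aJ aX {s} {j} p q A B s≤ j≤ b = run-⨾ (run-weaken ≤-refl main
  (run-mapArray {T = λ _ → 1} aX (λ u v → ι (u ≡ᵇ v))
    (λ u v st u<n v<n b a _ _ _ → store-at {s = st} aX diagonalE _ b a (eval-diagonal st a)) b))
  where
  main : ∀ st → Filled n aX (λ u v → ι (u ≡ᵇ v)) s₀ st →
         Run (SearchProgram.search (suc k) aS aJ aX) st (searchTime (suc k) (n * (n * M n)) n)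
           (λ st → ∃[ X ] Clusters k n aX s j (memory s₀) X st)
  main st (b′ , _ , init , same) = run-weaken ≤-refl conclude (run-search (n * (n * M n)) b′
    (record { frame = λ _ _ → refl ; stores = init
            ; equiv = record { rfl = ≡ᵇ-refl ; sy = ≡ᵇ-sym ; tr = trans-≡ᵇ }
            ; rows = λ r → (λ _ → r) , λ u e → 0 , s≤s z≤n , ≡ᵇ-true e })
    (sumTo-bound n _ (n * M n) (λ u u<n → sumTo-bound n _ (M n) (λ v v<n → small u v u<n v<n))))
    where
    open LocalSearch (suc k) n aS aJ aX p q (memory st) using (module Represents; Found; run-search)
    open Represents
    trans-≡ᵇ : ∀ u v w → (u ≡ᵇ v) ≡ true → (v ≡ᵇ w) ≡ true → (u ≡ᵇ w) ≡ true
    trans-≡ᵇ u v w x y rewrite ≡ᵇ-true {u} x = y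
    A′ = keep p same A
    B′ = keep q same B
    small : ∀ u v → u < n → v < n → pay (LocalSearch.s (suc k) n aS aJ aX p q (memory st)) (LocalSearch.j (suc k) n aS aJ aX p q (memory st)) _≡ᵇ_ u v ≤ M n
    small u v u<n v<n with u ≡ᵇ v
    ... | true  = ≤-trans (≤-reflexive (B′ u v u<n v<n)) (j≤ u v)
    ... | false = ≤-trans (≤-reflexive (A′ u v u<n v<n)) (s≤ u v)
    conclude : ∀ st′ → Found st′ → ∃[ X ] Clusters k n aX s j (memory s₀) X st′
    conclude st′ (b″ , X , H , opt) = X , record
      { base = b″ ; stored = stores H ; outside = λ x o → trans (frame H x o) (same x o)
      ; equiv = equiv H ; rows = rows H
      ; stable = λ E R → stable-cong (λ u v → A′ (toℕ u) (toℕ v) (Finₚ.toℕ<n u) (Finₚ.toℕ<n v))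
                           (λ u v → B′ (toℕ u) (toℕ v) (Finₚ.toℕ<n u) (Finₚ.toℕ<n v))
                           (locallyOptimal⇒stable k n aS aJ aX p q (memory st) opt E R) }

fillDouble : ℕ → ℕ → Expr → Expr → Cmd
fillDouble a b e₁ e₂ = pairs (ifNonzero (readE b) (⟦ addrE a ⟧≔ e₁) (⟦ addrE a ⟧≔ e₂))

doubleSep doubleJoin : (ℕ → ℕ → Bool) → (ℕ → ℕ → ℕ) → ℕ → ℕ → ℕ
doubleSep  X s u v = s u v + (if X u v then 0 else s u v)
doubleJoin X j u v = j u v + (if X u v then j u v else 0)

run-fillDoubleSep : ∀ {n s₀} a b c X {s} → b ≢ a → c ≢ a → Arr n b (λ u v → ι (X u v)) (memory s₀) → Arr n c s (memory s₀) →
  Base n s₀ → Run (fillDouble a b (readE c) (readE c ⊕ readE c)) s₀ (pairsTime (λ _ → 2) n) (Filled n a (doubleSep X s) s₀)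
run-fillDoubleSep {n} {s₀} a b c X {s} ne ne′ A B = run-mapArray {T = λ _ → 2} a (doubleSep X s)
  λ u v st u<n v<n p q _ o _ → let r = read-arr {st = st} c (keep ne′ o B) u<n v<n p q in
    store-choice {s = st} a (readE b) (readE c) (readE c ⊕ readE c) (X u v) p q (read-arr {st = st} b (keep ne o A) u<n v<n p q)
      (λ t → trans r (sym (trans (cong (λ z → s u v + (if z then 0 else s u v)) t) (+-identityʳ _))))
      (λ t → trans (cong₂ _+_ r r) (sym (cong (λ z → s u v + (if z then 0 else s u v)) t)))

run-fillDoubleJoin : ∀ {n s₀} a b c X {s} → b ≢ a → c ≢ a → Arr n b (λ u v → ι (X u v)) (memory s₀) → Arr n c s (memory s₀) →
  Base n s₀ → Run (fillDouble a b (readE c ⊕ readE c) (readE c)) s₀ (pairsTime (λ _ → 2) n) (Filled n a (doubleJoin X s) s₀)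
run-fillDoubleJoin {n} {s₀} a b c X {s} ne ne′ A B = run-mapArray {T = λ _ → 2} a (doubleJoin X s)
  λ u v st u<n v<n p q _ o _ → let r = read-arr {st = st} c (keep ne′ o B) u<n v<n p q in
    store-choice {s = st} a (readE b) (readE c ⊕ readE c) (readE c) (X u v) p q (read-arr {st = st} b (keep ne o A) u<n v<n p q)
      (λ t → trans (cong₂ _+_ r r) (sym (cong (λ z → s u v + (if z then s u v else 0)) t)))
      (λ t → trans r (sym (trans (cong (λ z → s u v + (if z then s u v else 0)) t) (+-identityʳ _))))

tally : ℕ → ℕ → Cmd
tally r a = ifNonzero (readE a) (r ≔ (reg r ⊕ readE 4)) (r ≔ (reg r ⊕ readE 3))

-- Both clusterings are compared under the original costs in arrays 3 and 4, although the second was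
-- found under the doubled ones.
chooseBetter : Cmd
chooseBetter =
  5 ≔ const 0 ⨾ 6 ≔ const 0 ⨾ pairs (tally 5 5 ⨾ tally 6 8) ⨾
  ifNonzero (reg 5 ⊖ reg 6) (pairs (⟦ addrE 5 ⟧≔ readE 8)) skip

chooseTime : ℕ → ℕ
chooseTime n = 1 + (1 + (pairsTime (λ _ → 2 + 2) n + suc (pairsTime (λ _ → 1) n)))

run-chooseBetter : ∀ {n s₀ s j} X₁ X₂ → Arr n 3 s (memory s₀) → Arr n 4 j (memory s₀) →
  Arr n 5 (λ u v → ι (X₁ u v)) (memory s₀) → Arr n 8 (λ u v → ι (X₂ u v)) (memory s₀) → Base n s₀ →
  Run chooseBetter s₀ (chooseTime n) (λ st → Base n st × SameOutside n 5 (memory st) (memory s₀) ×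
    ∃[ X ] (X ≡ X₁ ⊎ X ≡ X₂) × Arr n 5 (λ u v → ι (X u v)) (memory st) ×
      sumTo² n (pay s j X) ≤ sumTo² n (pay s j X₁) × sumTo² n (pay s j X) ≤ sumTo² n (pay s j X₂))
run-chooseBetter {n} {s₀} {s} {j} X₁ X₂ S A₄ A₅ A₈ b =
  run-⨾ (run-≔ (run-⨾ (run-≔ (run-⨾ (run-weaken ≤-refl decide
    (run-sum {T = λ _ → 2 + 2} (pay s j X₁) (pay s j X₂) {s₁} step b refl refl))))))
  where
  s₁ = ⟪ update (update (registers s₀) 5 0) 6 0 , memory s₀ ⟫
  amount : ∀ X u v st → u < n → v < n → Base n st → AtPair n u v st → memory st ≡ memory s₀ → ∀ b → X u v ≡ b →
           eval (if b then readE 4 else readE 3) st ≡ pay s j X u v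
  amount X u v st u<n v<n p q refl true  t rewrite t = read-arr {st = st} 4 A₄ u<n v<n p q
  amount X u v st u<n v<n p q refl false t rewrite t = read-arr {st = st} 3 S u<n v<n p q
  step : ∀ u v st → u < n → v < n → Base n st → AtPair n u v st →
      (∀ z → registers st (7 + z) ≡ registers s₁ (7 + z)) → memory st ≡ memory s₀ →
      Run (tally 5 5 ⨾ tally 6 8) st (2 + 2) (λ s′ → Base n s′ × AtPair n u v s′ × registers s′ 5 ≡ registers st 5 + pay s j X₁ u v ×
        registers s′ 6 ≡ registers st 6 + pay s j X₂ u v ×
        (∀ z → registers s′ (7 + z) ≡ registers st (7 + z)) × memory s′ ≡ memory st)
  step u v st@(⟪ ρ , _ ⟫) u<n v<n p q _ refl = run-⨾ (ι-choice (X₁ u v) (read-arr {st = st} 5 A₅ u<n v<n p q)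
      (λ t → run-≔ (second _ p q (cong (ρ 5 +_) (amount X₁ u v st u<n v<n p q refl true t))))
      (λ t → run-≔ (second _ p q (cong (ρ 5 +_) (amount X₁ u v st u<n v<n p q refl false t)))))
    where
    second : ∀ x → Base n st → AtPair n u v st → x ≡ ρ 5 + pay s j X₁ u v →
      Run (tally 6 8) ⟪ update ρ 5 x , memory s₀ ⟫ 2
        (λ s′ → Base n s′ × AtPair n u v s′ × registers s′ 5 ≡ ρ 5 + pay s j X₁ u v ×
          registers s′ 6 ≡ ρ 6 + pay s j X₂ u v × (∀ z → registers s′ (7 + z) ≡ ρ (7 + z)) × memory s′ ≡ memory s₀)
    second x p q e = ι-choice (X₂ u v) (read-arr {st = st′} 8 A₈ u<n v<n p q)
      (λ t → run-≔ (p , q , e , cong (ρ 6 +_) (amount X₂ u v st′ u<n v<n p q refl true t) , (λ _ → refl) , refl))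
      (λ t → run-≔ (p , q , e , cong (ρ 6 +_) (amount X₂ u v st′ u<n v<n p q refl false t) , (λ _ → refl) , refl))
      where
      st′ = ⟪ update ρ 5 x , memory s₀ ⟫
  Chosen : State → Set
  Chosen st = Base n st × SameOutside n 5 (memory st) (memory s₀) ×
    ∃[ X ] (X ≡ X₁ ⊎ X ≡ X₂) × Arr n 5 (λ u v → ι (X u v)) (memory st) ×
      sumTo² n (pay s j X) ≤ sumTo² n (pay s j X₁) × sumTo² n (pay s j X) ≤ sumTo² n (pay s j X₂)
  decide : ∀ st → _ → Run (ifNonzero (reg 5 ⊖ reg 6) (pairs (⟦ addrE 5 ⟧≔ readE 8)) skip) st (suc (pairsTime (λ _ → 1) n)) Chosen
  decide st@(⟪ ρ , _ ⟫) (b′ , p , q , _ , refl) = run-if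
    (λ ne → run-weaken ≤-refl
      (λ st′ (b″ , _ , A , o) → b″ , o , X₂ , inj₂ refl , A ,
        ≰⇒≥ (λ le → ne (m≤n⇒m∸n≡0 (subst₂ _≤_ (sym p) (sym q) le))) , ≤-refl)
      (run-mapArray {T = λ _ → 1} 5 (λ u v → ι (X₂ u v))
        (λ u v st u<n v<n p q _ o _ → store-at {s = st} 5 (readE 8) _ p q
          (read-arr {st = st} 8 (keep {n} {5} {8} (λ ()) o A₈) u<n v<n p q)) b′))
    (λ z → run-weaken (s≤s z≤n) (λ _ x → x) (run-skip (b′ , (λ _ _ → refl) , X₁ , inj₁ refl , A₅ , ≤-refl ,
      subst₂ _≤_ p q (m∸n≡0⇒m≤n z))))

difference : ∀ {A : Set} → (A → A → Bool) → (A → A → Bool) → (A → A → Bool) → A → A → Bool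
difference eq g X u v = not (eq u v) ∧ (g u v xor X u v)

-- The output starts at cell 0 and overlaps the input. The edits are therefore computed in array 9,
-- beyond all output cells, and then copied down.
writeDifference : Cmd
writeDifference =
  pairs (ifNonzero diagonalE (⟦ addrE 9 ⟧≔ const 0)
    (ifNonzero (readE 5) (⟦ addrE 9 ⟧≔ (const 1 ⊖ readE 0)) (⟦ addrE 9 ⟧≔ readE 0))) ⨾
  pairs (⟦ reg 4 ⟧≔ readE 9)

writeTime : ℕ → ℕ
writeTime n = pairsTime (λ _ → 3) n + pairsTime (λ _ → 1) n

run-writeDifference : ∀ {n s₀} g X → Arr n 0 (λ u v → ι (g u v)) (memory s₀) → Arr n 5 (λ u v → ι (X u v)) (memory s₀) →
  Base n s₀ → Run writeDifference s₀ (writeTime n)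
    (λ st → ∀ u v → u < n → v < n → memory st (u * n + v) ≡ ι (difference _≡ᵇ_ g X u v))
run-writeDifference {n} {s₀} g X A₀ A₅ b = run-⨾ (run-weaken ≤-refl copy
  (run-mapArray {T = λ _ → 3} 9 (λ u v → ι (difference _≡ᵇ_ g X u v)) step b))
  where
  value : ∀ d g x → ι (not d ∧ (g xor x)) ≡ (if d then 0 else (if x then ι (not g) else ι g))
  value true  g x     = refl
  value false true  true  = refl
  value false true  false = refl
  value false false true  = refl
  value false false false = refl
  step : ∀ u v s → u < n → v < n → Base n s → AtPair n u v s → (∀ z → high s z ≡ high s₀ z) →
    SameOutside n 9 (memory s) (memory s₀) → memory s (addr n 9 (u * n + v)) ≡ memory s₀ (addr n 9 (u * n + v)) →
    Run _ s 3 (Written n 9 u v (ι (difference _≡ᵇ_ g X u v)) s)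
  step u v s u<n v<n p q _ o _ = ι-choice (u ≡ᵇ v) (eval-diagonal s q)
    (λ t → run-weaken (s≤s z≤n) (λ _ x → x) (store-at {s = s} 9 (const 0) _ p q
      (sym (trans (value (u ≡ᵇ v) (g u v) (X u v)) (cong (λ d → if d then 0 else inner) t)))))
    (λ t → store-choice {s = s} 9 (readE 5) (const 1 ⊖ readE 0) (readE 0) (X u v) p q
      (read-arr {st = s} 5 (keep {n} {9} {5} (λ ()) o A₅) u<n v<n p q)
      (λ r → trans (cong (1 ∸_) r₀) (trans (not-arith (g u v)) (sym (off t true r))))
      (λ r → trans r₀ (sym (off t false r))))
    where
    inner = if X u v then ι (not (g u v)) else ι (g u v)
    r₀ = read-arr {st = s} 0 (keep {n} {9} {0} (λ ()) o A₀) u<n v<n p q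
    off : (u ≡ᵇ v) ≡ false → ∀ c → X u v ≡ c → ι (difference _≡ᵇ_ g X u v) ≡ (if c then ι (not (g u v)) else ι (g u v))
    off t c r = trans (value (u ≡ᵇ v) (g u v) (X u v)) (cong₂ (λ d x → if d then 0 else (if x then ι (not (g u v)) else ι (g u v))) t r)
  copy : ∀ st → Filled n 9 (λ u v → ι (difference _≡ᵇ_ g X u v)) s₀ st → Run (pairs (⟦ reg 4 ⟧≔ readE 9)) st (pairsTime (λ _ → 1) n)
    (λ st → ∀ u v → u < n → v < n → memory st (u * n + v) ≡ ι (difference _≡ᵇ_ g X u v))
  copy st (b′ , _ , A₉ , _) = run-weaken ≤-refl (λ _ (_ , _ , done , _) → done)
    (run-map {T = λ _ → 1} (λ i → i) (λ u v → ι (difference _≡ᵇ_ g X u v)) (λ _ _ _ _ e → e)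
      (λ u v s u<n v<n p q@(_ , _ , i) _ o _ → run-store {reg 4} {readE 9} (refl ,
        cong₂ (update (memory s)) i (read-arr {st = s} 9 (λ u v u<n v<n → trans (o _ (beyond u v)) (A₉ u v u<n v<n)) u<n v<n p q))) b′)
    where
    beyond : ∀ u v i → i < n * n → addr n 9 (u * n + v) ≢ i
    beyond u v i i< e = <⇒≢ (<-≤-trans i< (≤-trans (m≤m+n (n * n) _) (≤-trans (m≤m+n (9 * (n * n)) _) (n≤1+n _)))) (sym e)

maxWeight maxDouble : ℕ → ℕ
maxWeight n = 1 + weight n
maxDouble n = maxWeight n + maxWeight n

weight-poly : Poly weight
weight-poly = poly-suc (poly-* (poly-const 4) (poly-* poly-id poly-id))

clusterSearchTime-poly : ∀ k {M} → Poly M → Poly (clusterSearchTime k M)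
clusterSearchTime-poly k p = poly-+ (pairsTime-poly (poly-const 1))
  (searchTime-poly (suc k) (poly-* poly-id (poly-* poly-id p)))

-- Arrays: 0 to 2 the input, 3 and 4 the costs of separating and of joining a
-- pair, 5 the first clustering, 6 and 7 the costs with its mistakes doubled,
-- 8 the second clustering, 9 the set of edits.
main : ℕ → Cmd
main k =
  fillWeights 3 1 (readE 0) ⨾
  fillWeights 4 2 (const 1 ⊖ readE 0) ⨾
  clusterSearch k 3 4 5 ⨾
  fillDouble 6 5 (readE 3) (readE 3 ⊕ readE 3) ⨾
  fillDouble 7 5 (readE 4 ⊕ readE 4) (readE 4) ⨾
  clusterSearch k 6 7 8 ⨾
  chooseBetter ⨾
  writeDifference

mainTime : ℕ → ℕ → ℕ
mainTime k n =
  pairsTime (λ _ → 3) n + (pairsTime (λ _ → 3) n + (clusterSearchTime k maxWeight n +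
  (pairsTime (λ _ → 2) n + (pairsTime (λ _ → 2) n + (clusterSearchTime k maxDouble n +
  (chooseTime n + writeTime n))))))

mainTime-poly : ∀ k → Poly (mainTime k)
mainTime-poly k = poly-+ (p 3) (poly-+ (p 3) (poly-+ (clusterSearchTime-poly k w)
  (poly-+ (p 2) (poly-+ (p 2) (poly-+ (clusterSearchTime-poly k (poly-+ w w))
  (poly-+ (poly-suc (poly-suc (poly-+ (p 4) (poly-suc (p 1))))) (poly-+ (p 3) (p 1))))))))
  where
  p : ∀ c → Poly (pairsTime (λ _ → c))
  p c = pairsTime-poly (poly-const c)
  w = poly-suc weight-poly

-- Respecting the constraints is asserted only in the presence of some feasible `O`. Otherwise the
-- program still halts with clusters of bounded size.
record Outcome (k n : ℕ) (g f h X : ℕ → ℕ → Bool) : Set where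
  field
    equiv : IsEquiv X
    rows  : Rows (suc k) X
    ratio : ∀ {O} → IsEquiv O → RowsWithin (suc k) O → Respects (restrict n f) (restrict n h) O →
            Respects (restrict n f) (restrict n h) (restrict n X) ×
            12 * ∑² (λ u v → ι (difference _≡ᵇᶠ_ (restrict n g) (restrict n X) u v)) ≤
            23 * ∑² (λ u v → ι (difference _≡ᵇᶠ_ (restrict n g) O u v))

-- A clustering that respects the constraints pays no penalty, so its cost counts the edited pairs.
pay-difference : ∀ {n w} (I : ConstraintGraph n) {s j} → Costs I w s j → ∀ {X} → IsEquiv X →
  Respects (ConstraintGraph.f I) (ConstraintGraph.h I) X → ∀ u v → pay s j X u v ≡ ι (difference _≡ᵇᶠ_ (ConstraintGraph.g I) X u v)
pay-difference I {s} {j} C {X} E F u v with u Finₚ.≟ v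
... | yes refl rewrite rfl E u = Costs.diag-j C u
... | no p with X u v in q
...   | true  rewrite Costs.off-j C u v p with ConstraintGraph.h I u v in r
...     | true  = contradiction (trans (sym q) (apart F u v r)) λ ()
...     | false with ConstraintGraph.g I u v
...       | true  = refl
...       | false = refl
pay-difference I {s} {j} C {X} E F u v | no p | false rewrite Costs.off-s C u v p with ConstraintGraph.f I u v in r
...     | true  = contradiction (trans (sym q) (together F u v r)) λ ()
...     | false with ConstraintGraph.g I u v
...       | true  = refl
...       | false = refl

sepW-≤ : ∀ g f w u v → sepW g f w u v ≤ 1 + w
sepW-≤ g f w u v with u ≡ᵇ v
... | true  = z≤n
... | false = +-mono-≤ (when-≤ (g u v) 1) (when-≤ (f u v) w)

sepW-diag : ∀ g f w u → sepW g f w u u ≡ 0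
sepW-diag g f w u rewrite ≡ᵇ-refl u = refl

sepW-off : ∀ g f w u v → (u ≡ᵇ v) ≡ false → sepW g f w u v ≡ ι (g u v) + when (f u v) w
sepW-off g f w u v p rewrite p = refl

extra-≤ : ∀ (b : Bool) {x y m : ℕ} → x ≤ m → y ≤ m → (if b then x else y) ≤ m
extra-≤ true  p q = p
extra-≤ false p q = q

weight-heavy : ∀ n → n * (n * 4) < weight n
weight-heavy n = s≤s (≤-reflexive (rearranged n))
  where
  rearranged : ∀ n → n * (n * 4) ≡ 4 * (n * n)
  rearranged = solve-∀

module _ {n : ℕ} (g f h : ℕ → ℕ → Bool)
  (g-sym : ∀ u v → restrict n g u v ≡ restrict n g v u)
  (f-sym : ∀ u v → restrict n f u v ≡ restrict n f v u)
  (h-sym : ∀ u v → restrict n h u v ≡ restrict n h v u) where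

  private
    w = weight n
    I : ConstraintGraph n
    I = record { g = restrict n g ; f = restrict n f ; h = restrict n h
               ; g-sym = g-sym ; f-sym = f-sym ; h-sym = h-sym }
    not-g : ℕ → ℕ → Bool
    not-g u v = not (g u v)
    S joinCost : ℕ → ℕ → ℕ
    S  = sepW g f w
    joinCost = joinW g h w

  sepW-joinW-costs : Costs I w (restrict n S) (restrict n joinCost)
  sepW-joinW-costs = record
    { diag-s = λ u → sepW-diag g f w (toℕ u)
    ; diag-j = λ u → sepW-diag not-g h w (toℕ u)
    ; off-s = λ u v p → sepW-off g f w (toℕ u) (toℕ v) (apart′ u v p)
    ; off-j = λ u v p → sepW-off not-g h w (toℕ u) (toℕ v) (apart′ u v p) }
    where
    apart′ : ∀ (u v : Fin n) → u ≢ v → (toℕ u ≡ᵇ toℕ v) ≡ false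
    apart′ u v p with toℕ u ≡ᵇ toℕ v in q
    ... | false = refl
    ... | true  = contradiction (Finₚ.toℕ-injective (≡ᵇ-true q)) p

  outcome : ∀ {k a₁ a₂ m₁ m₂ st₁ st₂} {X₁ X₂ X} →
    Clusters k n a₁ S joinCost m₁ X₁ st₁ → Clusters k n a₂ (doubleSep X₁ S) (doubleJoin X₁ joinCost) m₂ X₂ st₂ →
    (X ≡ X₁ ⊎ X ≡ X₂) → sumTo² n (pay S joinCost X) ≤ sumTo² n (pay S joinCost X₁) → sumTo² n (pay S joinCost X) ≤ sumTo² n (pay S joinCost X₂) →
    Outcome k n g f h X
  outcome {k} {X₁ = X₁} {X₂} {X} C₁ C₂ which le₁ le₂ = record
    { equiv = [ (λ { refl → C₁.equiv }) , (λ { refl → C₂.equiv }) ]′ which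
    ; rows  = [ (λ { refl → C₁.rows }) , (λ { refl → C₂.rows }) ]′ which
    ; ratio = ratio }
    where
    module C₁ = Clusters C₁
    module C₂ = Clusters C₂
    ratio : ∀ {O} → IsEquiv O → RowsWithin (suc k) O → Respects (restrict n f) (restrict n h) O →
            Respects (restrict n f) (restrict n h) (restrict n X) ×
            12 * ∑² (λ u v → ι (difference _≡ᵇᶠ_ (restrict n g) (restrict n X) u v)) ≤
            23 * ∑² (λ u v → ι (difference _≡ᵇᶠ_ (restrict n g) O u v))
    ratio {O} E R F = feasible , (begin
      12 * ∑² (λ u v → ι (difference _≡ᵇᶠ_ (restrict n g) (restrict n X) u v))
        ≡⟨ cong (12 *_) (∑²-cong (pay-difference I sepW-joinW-costs (restrict-equiv equivX) feasible)) ⟨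
      -- The chosen clustering costs no more than either candidate, so its weight 12 is split as 9 +
      -- 3 to match `weighted-ratio`.
      12 * t X                        ≡⟨ *-distribʳ-+ (t X) 9 3 ⟩
      9 * t X + 3 * t X               ≤⟨ +-mono-≤ (*-monoʳ-≤ 9 (subst₂ _≤_ (sumTo²-∑² n _) (sumTo²-∑² n _) le₁))
                                                  (*-monoʳ-≤ 3 (subst₂ _≤_ (sumTo²-∑² n _) (sumTo²-∑² n _) le₂)) ⟩
      9 * t X₁ + 3 * t X₂             ≤⟨ A.weighted-ratio ⟩
      23 * total (restrict n S) (restrict n joinCost) O
        ≡⟨ cong (23 *_) (∑²-cong (pay-difference I sepW-joinW-costs E F)) ⟩
      23 * ∑² (λ u v → ι (difference _≡ᵇᶠ_ (restrict n g) O u v)) ∎)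
      where
      open ≤-Reasoning
      t : (ℕ → ℕ → Bool) → ℕ
      t Y = total (restrict n S) (restrict n joinCost) (restrict n Y)
      module A = Analysis I (weight-heavy n) sepW-joinW-costs E
        (restrict-equiv {n} C₁.equiv) (restrict-equiv {n} C₂.equiv)
        (λ _ _ → refl) (λ _ _ → refl) (restrict-rows C₁.rows) F (C₁.stable E R) (C₂.stable E R)
      equivX : IsEquiv X
      equivX = [ (λ { refl → C₁.equiv }) , (λ { refl → C₂.equiv }) ]′ which
      feasible : Respects (restrict n f) (restrict n h) (restrict n X)
      feasible = [ (λ { refl → A.feasible₁ }) , (λ { refl → A.feasible₂ }) ]′ which

  run-main : ∀ k {s₀} → Base n s₀ →
    Arr n 0 (λ u v → ι (g u v)) (memory s₀) → Arr n 1 (λ u v → ι (f u v)) (memory s₀) → Arr n 2 (λ u v → ι (h u v)) (memory s₀) →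
    Run (main k) s₀ (mainTime k n) (λ st → ∃[ X ] Outcome k n g f h X ×
      (∀ u v → u < n → v < n → memory st (u * n + v) ≡ ι (difference _≡ᵇ_ g X u v)))
  run-main k {s₀} b G F H = run-⨾ (run-weaken ≤-refl phase₂
    (run-fillWeights 3 1 (readE 0) g f (λ ())
      (λ u v s u<n v<n p q o → read-arr {st = s} 0 (keep {n} {3} {0} (λ ()) o G) u<n v<n p q) F b))
    where
    Goal : State → Set
    Goal st = ∃[ X ] Outcome k n g f h X × (∀ u v → u < n → v < n → memory st (u * n + v) ≡ ι (difference _≡ᵇ_ g X u v))
    phase₂ : ∀ s₁ → Filled n 3 S s₀ s₁ → Run _ s₁ _ Goal
    phase₂ s₁ (b₁ , _ , S₁ , o₁) = run-⨾ (run-weaken ≤-refl phase₃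
      (run-fillWeights 4 2 (const 1 ⊖ readE 0) (λ u v → not (g u v)) h (λ ())
        (λ u v s u<n v<n p q o → trans (cong (1 ∸_) (read-arr {st = s} 0 (keep {n} {4} {0} (λ ()) o G₁) u<n v<n p q)) (not-arith (g u v)))
        (keep {n} {3} {2} (λ ()) o₁ H) b₁))
      where
      G₁ = keep {n} {3} {0} (λ ()) o₁ G
      phase₃ : ∀ s₂ → Filled n 4 joinCost s₁ s₂ → Run _ s₂ _ Goal
      phase₃ s₂ (b₂ , _ , J₂ , o₂) = run-⨾ (run-weaken ≤-refl (λ s₃ (X₁ , C₁) → phase₄ s₃ X₁ C₁)
        (run-clusterSearch k maxWeight 3 4 5 (λ ()) (λ ()) S₂ J₂ (sepW-≤ g f w) (sepW-≤ not-g h w) b₂))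
        where
        S₂ = keep {n} {4} {3} (λ ()) o₂ S₁
        G₂ = keep {n} {4} {0} (λ ()) o₂ G₁
        phase₄ : ∀ s₃ X₁ → Clusters k n 5 S joinCost (memory s₂) X₁ s₃ → Run _ s₃ _ Goal
        phase₄ s₃ X₁ C₁ = run-⨾ (run-weaken ≤-refl phase₅
          (run-fillDoubleSep 6 5 3 X₁ (λ ()) (λ ()) C₁.stored S₃ C₁.base))
          where
          module C₁ = Clusters C₁
          S₃ = keep {n} {5} {3} (λ ()) C₁.outside S₂
          J₃ = keep {n} {5} {4} (λ ()) C₁.outside J₂
          G₃ = keep {n} {5} {0} (λ ()) C₁.outside G₂
          phase₅ : ∀ s₄ → Filled n 6 (doubleSep X₁ S) s₃ s₄ → Run _ s₄ _ Goal
          phase₅ s₄ (b₄ , _ , D₄ , o₄) = run-⨾ (run-weaken ≤-refl phase₆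
            (run-fillDoubleJoin 7 5 4 X₁ (λ ()) (λ ()) X₄ J₄ b₄))
            where
            X₄ = keep {n} {6} {5} (λ ()) o₄ C₁.stored
            J₄ = keep {n} {6} {4} (λ ()) o₄ J₃
            phase₆ : ∀ s₅ → Filled n 7 (doubleJoin X₁ joinCost) s₄ s₅ → Run _ s₅ _ Goal
            phase₆ s₅ (b₅ , _ , E₅ , o₅) = run-⨾ (run-weaken ≤-refl (λ s₆ (X₂ , C₂) → phase₇ s₆ X₂ C₂)
              (run-clusterSearch k maxDouble 6 7 8 (λ ()) (λ ()) (keep {n} {7} {6} (λ ()) o₅ D₄) E₅
                (λ u v → +-mono-≤ (sepW-≤ g f w u v) (extra-≤ (X₁ u v) z≤n (sepW-≤ g f w u v)))
                (λ u v → +-mono-≤ (sepW-≤ not-g h w u v) (extra-≤ (X₁ u v) (sepW-≤ not-g h w u v) z≤n)) b₅))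
              where
              far : ∀ {a f} → a ≢ 6 → a ≢ 7 → Arr n a f (memory s₃) → Arr n a f (memory s₅)
              far {a} p q A = keep {n} {7} {a} q o₅ (keep {n} {6} {a} p o₄ A)
              phase₇ : ∀ s₆ X₂ → Clusters k n 8 (doubleSep X₁ S) (doubleJoin X₁ joinCost) (memory s₅) X₂ s₆ → Run _ s₆ _ Goal
              phase₇ s₆ X₂ C₂ = run-⨾ (run-weaken ≤-refl phase₈
                (run-chooseBetter X₁ X₂ (late {3} (λ ()) (far {3} (λ ()) (λ ()) S₃)) (late {4} (λ ()) (far {4} (λ ()) (λ ()) J₃))
                  (late {5} (λ ()) (far {5} (λ ()) (λ ()) C₁.stored)) C₂.stored C₂.base))
                where
                module C₂ = Clusters C₂
                late : ∀ {a f} → a ≢ 8 → Arr n a f (memory s₅) → Arr n a f (memory s₆)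
                late {a} p A = keep {n} {8} {a} p C₂.outside A
                phase₈ : ∀ s₇ → _ → Run writeDifference s₇ (writeTime n) Goal
                phase₈ s₇ (b₇ , o₇ , X , which , X₇ , le₁ , le₂) = run-weaken ≤-refl
                  (λ s₈ out → X , outcome C₁ C₂ which le₁ le₂ , out)
                  (run-writeDifference g X (keep {n} {5} {0} (λ ()) o₇ (late {0} (λ ()) (far {0} (λ ()) (λ ()) G₃))) X₇ b₇)

-- Cluster graphs as equivalence relations

toT : ∀ {b} → b ≡ true → T b
toT refl = tt

fromT : ∀ {b} → T b → b ≡ true
fromT {true} _ = refl

∈-tabulate⁺ : ∀ {n} (p : Fin n → Bool) {x} → p x ≡ true → x ∈ tabulate p
∈-tabulate⁺ p {x} q = lookup⇒[]= x _ (trans (lookup∘tabulate p x) q)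

∈-tabulate⁻ : ∀ {n} (p : Fin n → Bool) {x} → x ∈ tabulate p → p x ≡ true
∈-tabulate⁻ p {x} q = trans (sym (lookup∘tabulate p x)) ([]=⇒lookup q)

∣∣-∑ : ∀ {n} (S : Subset n) → ∣ S ∣ ≡ sum (λ x → ι (lookup S x))
∣∣-∑ [] = refl
∣∣-∑ (true ∷ S)  = cong suc (∣∣-∑ S)
∣∣-∑ (false ∷ S) = ∣∣-∑ S

cover⇒∣∣≤ : ∀ {n K} (S : Subset n) (e : Fin K → Fin n) → (∀ x → x ∈ S → ∃[ a ] e a ≡ x) → ∣ S ∣ ≤ K
cover⇒∣∣≤ {n} {K} S e cov = begin
  ∣ S ∣                                         ≡⟨ ∣∣-∑ S ⟩
  sum (λ x → ι (lookup S x))                    ≤⟨ ∑-mono pointwise ⟩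
  sum (λ x → sum (λ a → ι (e a ≡ᵇᶠ x)))         ≡⟨ ∑-comm (λ x a → ι (e a ≡ᵇᶠ x)) ⟩
  sum (λ a → sum (λ x → ι (e a ≡ᵇᶠ x)))         ≤⟨ ∑-bound {K} 1 (λ a → ≤-reflexive (∑-δ (e a) 1)) ⟩
  K * 1                                         ≡⟨ *-identityʳ K ⟩
  K                                             ∎
  where
  open ≤-Reasoning
  pointwise : ∀ x → ι (lookup S x) ≤ sum (λ a → ι (e a ≡ᵇᶠ x))
  pointwise x with lookup S x in q
  ... | false = z≤n
  ... | true with cov x (lookup⇒[]= x S q)
  ...   | a , refl = ≤-trans (≤-reflexive (sym (cong ι (≡ᵇᶠ-refl (e a))))) (term≤∑ (λ a′ → ι (e a′ ≡ᵇᶠ e a)) a)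

enumerate : ∀ {n} (S : Subset n) → Σ (Fin ∣ S ∣ → Fin n) λ e → ∀ x → lookup S x ≡ true → ∃[ a ] e a ≡ x
enumerate [] = (λ ()) , λ ()
enumerate (false ∷ S) with enumerate S
... | e , cov = suc ∘ e , λ { (suc x) p → let a , q = cov x p in a , cong suc q }
enumerate (true ∷ S) with enumerate S
... | e , cov = (λ { zero → zero ; (suc a) → suc (e a) }) ,
                λ { zero _ → zero , refl ; (suc x) p → let a , q = cov x p in suc a , cong suc q }

∣∣≤⇒cover : ∀ {n K} (S : Subset n) → Fin n → ∣ S ∣ ≤ K → Σ (Fin K → Fin n) λ e → ∀ x → lookup S x ≡ true → ∃[ a ] e a ≡ x
∣∣≤⇒cover {n} {K} S d le = e′ , cov′
  where
  e = proj₁ (enumerate S)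
  e′ : Fin K → Fin n
  e′ a with toℕ a <? ∣ S ∣
  ... | yes p = e (fromℕ< p)
  ... | no _  = d
  cov′ : ∀ x → lookup S x ≡ true → ∃[ a ] e′ a ≡ x
  cov′ x p with proj₂ (enumerate S) x p
  ... | a , refl = inject≤ a le , here
    where
    here : e′ (inject≤ a le) ≡ e a
    here with toℕ (inject≤ a le) <? ∣ S ∣
    ... | yes q = cong e (Finₚ.toℕ-injective (trans (Finₚ.toℕ-fromℕ< q) (Finₚ.toℕ-inject≤ a le)))
    ... | no q  = contradiction (subst (_< ∣ S ∣) (sym (Finₚ.toℕ-inject≤ a le)) (Finₚ.toℕ<n a)) q

-- Double negation commutes with finite conjunctions; this makes connectedness to all vertices
-- decidable under a double negation.
¬¬-all : ∀ {n} {P : Fin n → Set} → (∀ i → ¬ ¬ P i) → ¬ ¬ (∀ i → P i)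
¬¬-all {zero}  h k = k (λ ())
¬¬-all {suc n} h k = h zero (λ p₀ → ¬¬-all (h ∘ suc) (λ ps → k (λ { zero → p₀ ; (suc i) → ps i })))

reflexive-closure : ∀ {n} → Graph n → BRel n
reflexive-closure H u v = u ≡ᵇᶠ v ∨ has H u v

module FromClusterGraph {n : ℕ} (H : Graph n) (cluster : IsClusterGraph H) where

  private
    X = reflexive-closure H

  -- Connectedness need not be decided: the goal is decidable, hence stable.
  connected⇒adjacent : ∀ {u v} → Connected H u v → u ≢ v → Adj H u v
  connected⇒adjacent {u} {v} c u≢v = decidable-stable (T? (has H u v)) λ nonadj →
    ¬¬-all (λ x → ¬¬-excluded-middle {A = Connected H u x}) λ dec →
      nonadj (cluster (tabulate (λ x → does (dec x)))
        (u , λ x → mk⇔ (λ p → to (dec x) (∈-tabulate⁻ (λ x → does (dec x)) p))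
                       (λ p → ∈-tabulate⁺ (λ x → does (dec x)) (dec-true (dec x) p)))
        u v (∈-tabulate⁺ (λ x → does (dec x)) (dec-true (dec u) ε))
            (∈-tabulate⁺ (λ x → does (dec x)) (dec-true (dec v) c)) u≢v)
    where
    to : ∀ {A : Set} (d : Dec A) → does d ≡ true → A
    to (yes a) _ = a

  connected⇒X : ∀ {u v} → Connected H u v → X u v ≡ true
  connected⇒X {u} {v} c with u Finₚ.≟ v
  ... | yes _ = refl
  ... | no p  = fromT (connected⇒adjacent c p)

  X⇒connected : ∀ {u v} → X u v ≡ true → Connected H u v
  X⇒connected {u} {v} p with u Finₚ.≟ v
  ... | yes refl = ε
  ... | no _     = toT p ◅ ε

  X-equiv : IsEquiv X
  X-equiv = record
    { rfl = λ u → cong (_∨ has H u u) (≡ᵇᶠ-refl u)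
    ; sy  = λ u v → cong₂ _∨_ (eq-sym u v) (has-sym H u v)
    ; tr  = λ u v w p q → connected⇒X (X⇒connected p ◅◅ X⇒connected q) }
    where
    eq-sym : ∀ u v → u ≡ᵇᶠ v ≡ v ≡ᵇᶠ u
    eq-sym u v with u Finₚ.≟ v | v Finₚ.≟ u
    ... | yes _ | yes _ = refl
    ... | no _  | no _  = refl
    ... | yes p | no q  = contradiction (sym p) q
    ... | no p  | yes q = contradiction (sym q) p

  row-component : ∀ r → IsComponent H (tabulate (X r))
  row-component r = r , λ u → mk⇔ (λ p → X⇒connected (∈-tabulate⁻ (X r) p)) (λ c → ∈-tabulate⁺ (X r) (connected⇒X c))

module _ {n : ℕ} {X : BRel n} (E : IsEquiv X) where

  RowSizes≤ : ℕ → Set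
  RowSizes≤ k = ∀ r → ∣ tabulate (X r) ∣ ≤ k

  -- The search needs a positive bound already for singletons; `suc (pred k)` changes `k` only when
  -- it is 0.
  sizes⇒rows : ∀ {k} → RowSizes≤ k → RowsWithin (suc (pred k)) X
  sizes⇒rows {k} h r = proj₁ cover , λ u p → proj₂ cover u (trans (lookup∘tabulate (X r) u) p)
    where
    cover = ∣∣≤⇒cover (tabulate (X r)) r (≤-trans (h r) (suc-pred-≥ k))
      where
      suc-pred-≥ : ∀ k → k ≤ suc (pred k)
      suc-pred-≥ zero    = z≤n
      suc-pred-≥ (suc k) = ≤-refl

  -- The row of a vertex contains that vertex, so `k` cannot be 0.
  sizes⇒suc-pred : ∀ {k} → RowSizes≤ k → Fin n → suc (pred k) ≡ k
  sizes⇒suc-pred {zero}  h r =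
    contradiction (≤-trans (x∈p⇒∣p-x∣<∣p∣ (∈-tabulate⁺ (X r) (rfl E r))) (h r)) λ ()
  sizes⇒suc-pred {suc k} h r = refl

module FromEquivalence {n : ℕ} (H : Graph n) {X : BRel n} (E : IsEquiv X)
  (H-X : ∀ u v → has H u v ≡ not (u ≡ᵇᶠ v) ∧ X u v) where

  connected⇒X : ∀ {u v} → Connected H u v → X u v ≡ true
  connected⇒X ε = rfl E _
  connected⇒X {u} {v} (_◅_ {j = w} a c) =
    tr E u w v (proj₂ (∧-true {not (u ≡ᵇᶠ w)} (trans (sym (H-X u w)) (fromT a)))) (connected⇒X c)

  adjacent : ∀ {u v} → u ≢ v → X u v ≡ true → Adj H u v
  adjacent {u} {v} p q = toT (trans (H-X u v) (cong₂ (λ a b → not a ∧ b) (≡ᵇᶠ-≢ p) q))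

  clusterGraph : IsClusterGraph H
  clusterGraph S (r , S⇔) u v u∈S v∈S u≢v = adjacent u≢v
    (tr E u r v (trans (sy E u r) (connected⇒X (Equivalence.to (S⇔ u) u∈S))) (connected⇒X (Equivalence.to (S⇔ v) v∈S)))

  componentSizes : ∀ {K} → RowsWithin K X → ComponentSizes≤ K H
  componentSizes R S (r , S⇔) = cover⇒∣∣≤ S (proj₁ (R r)) (λ x x∈S → proj₂ (R r) x (connected⇒X (Equivalence.to (S⇔ x) x∈S)))

-- Encodings

size-count : ∀ {m n} {A B : Set} (p : A × B → Bool) (e : Fin m → A) (f : Fin n → B) →
  length (filterᵇ p (cartesianProduct (List.tabulate e) (List.tabulate f))) ≡ sum (λ i → sum (λ j → ι (p (e i , f j))))
size-count {zero}  p e f = refl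
size-count {suc m} p e f = begin
  length (filterᵇ p (map (e zero ,_) (List.tabulate f) ++ rest))
    ≡⟨ cong length (filter-++ (T? ∘ p) (map (e zero ,_) (List.tabulate f)) rest) ⟩
  length (filterᵇ p (map (e zero ,_) (List.tabulate f)) ++ filterᵇ p rest)
    ≡⟨ length-++ (filterᵇ p (map (e zero ,_) (List.tabulate f))) ⟩
  length (filterᵇ p (map (e zero ,_) (List.tabulate f))) + length (filterᵇ p rest)
    ≡⟨ cong₂ _+_ (row f) (size-count p (e ∘ suc) f) ⟩
  sum (λ j → ι (p (e zero , f j))) + sum (λ i → sum (λ j → ι (p (e (suc i) , f j))))  ∎
  where
  open ≡-Reasoning
  rest = cartesianProduct (List.tabulate (e ∘ suc)) (List.tabulate f)
  row : ∀ {n} (f : Fin n → _) → length (filterᵇ p (map (e zero ,_) (List.tabulate f))) ≡ sum (λ j → ι (p (e zero , f j)))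
  row {zero}  f = refl
  row {suc n} f with p (e zero , f zero)
  ... | true  = cong suc (row (f ∘ suc))
  ... | false = row (f ∘ suc)

size-doubled : ∀ {n} (P : PairSet n) → ∑² (λ u v → ι (has P u v)) ≡ 2 * size P
size-doubled {n} P = begin
  ∑² (λ u v → ι (has P u v))                        ≡⟨ ∑²-cong split ⟩
  ∑² (λ u v → below u v + below v u)                ≡⟨ ∑²-+ below (λ u v → below v u) ⟩
  ∑² below + ∑² (λ u v → below v u)                 ≡⟨ cong (∑² below +_) (∑²-transpose below) ⟩
  ∑² below + ∑² below                               ≡⟨ cong (λ x → x + x) (size-count {n} {n} (λ (u , v) → (toℕ u <ᵇ toℕ v) ∧ has P u v) id id) ⟨
  size P + size P                                   ≡⟨ cong (size P +_) (+-identityʳ (size P)) ⟨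
  2 * size P                                        ∎
  where
  open ≡-Reasoning
  below : Fin n → Fin n → ℕ
  below u v = ι ((toℕ u <ᵇ toℕ v) ∧ has P u v)
  <ᵇ-true : ∀ {x y} → x < y → (x <ᵇ y) ≡ true
  <ᵇ-true p = fromT (<⇒<ᵇ p)
  <ᵇ-false : ∀ {x y} → ¬ x < y → (x <ᵇ y) ≡ false
  <ᵇ-false {x} {y} p = 𝔹ₚ.¬-not (λ q → p (<ᵇ⇒< x y (toT q)))
  split : ∀ u v → ι (has P u v) ≡ below u v + below v u
  split u v with <-cmp (toℕ u) (toℕ v)
  ... | tri< a _ c rewrite <ᵇ-true a | <ᵇ-false c = sym (+-identityʳ _)
  ... | tri> a _ c rewrite <ᵇ-false a | <ᵇ-true c = cong ι (has-sym P u v)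
  ... | tri≈ a b c rewrite <ᵇ-false a | <ᵇ-false c | Finₚ.toℕ-injective b = cong ι (has-irrefl P v)

load-++ˡ : ∀ xs ys {i} → i < length xs → load (xs ++ ys) i ≡ load xs i
load-++ˡ (x ∷ xs) ys {zero}  p = refl
load-++ˡ (x ∷ xs) ys {suc i} p = load-++ˡ xs ys (≤-pred p)

load-++ʳ : ∀ xs ys i → load (xs ++ ys) (length xs + i) ≡ load ys i
load-++ʳ []       ys i = refl
load-++ʳ (x ∷ xs) ys i = load-++ʳ xs ys i

load-beyond : ∀ xs i → load xs (length xs + i) ≡ 0
load-beyond []       i = refl
load-beyond (x ∷ xs) i = load-beyond xs i

load-row : ∀ {n} {B C : Set} (g : C → ℕ) (c : B → C) (f : Fin n → B) (v : Fin n) →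
           load (map g (map c (List.tabulate f))) (toℕ v) ≡ g (c (f v))
load-row {suc n} g c f zero    = refl
load-row {suc n} g c f (suc v) = load-row g c (f ∘ suc) v

length-row : ∀ {n} {B C : Set} (g : C → ℕ) (c : B → C) (f : Fin n → B) → length (map g (map c (List.tabulate f))) ≡ n
length-row {zero}  g c f = refl
length-row {suc n} g c f = cong suc (length-row g c (f ∘ suc))

load-product : ∀ {m n} {A : Set} (g : A × Fin n → ℕ) (e : Fin m → A) u (v : Fin n) →
               load (map g (cartesianProduct (List.tabulate e) (allFin n))) (toℕ u * n + toℕ v) ≡ g (e u , v)
load-product {suc m} {n} g e u v =
  trans (cong (λ xs → load xs (toℕ u * n + toℕ v)) (map-++ g (map (e zero ,_) (allFin n)) _)) (go u)
  where
  first = map g (map (e zero ,_) (allFin n))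
  rest = map g (cartesianProduct (List.tabulate (e ∘ suc)) (allFin n))
  len : length first ≡ n
  len = length-row g (e zero ,_) id
  go : ∀ u → load (first ++ rest) (toℕ u * n + toℕ v) ≡ g (e u , v)
  go zero    = trans (load-++ˡ first rest (subst (toℕ v <_) (sym len) (Finₚ.toℕ<n v))) (load-row g (e zero ,_) id v)
  go (suc u) = trans (cong (load (first ++ rest)) (trans (+-assoc n (toℕ u * n) (toℕ v)) (cong (_+ (toℕ u * n + toℕ v)) (sym len))))
    (trans (load-++ʳ first rest (toℕ u * n + toℕ v)) (load-product g (e ∘ suc) u v))

length-product : ∀ {m n} {A : Set} (g : A × Fin n → ℕ) (e : Fin m → A) →
                 length (map g (cartesianProduct (List.tabulate e) (allFin n))) ≡ m * n
length-product {zero}  g e = refl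
length-product {suc m} {n} g e =
  trans (cong length (map-++ g (map (e zero ,_) (allFin n)) _)) (trans (length-++ (map g (map (e zero ,_) (allFin n)))) (cong₂ _+_ (length-row g (e zero ,_) id) (length-product g (e ∘ suc))))

module _ {n : ℕ} (P : PairSet n) where

  load-matrix : ∀ u v → load (matrix P) (toℕ u * n + toℕ v) ≡ ι (has P u v)
  load-matrix u v = trans (load-product _ id u v) (bit (has P u v))
    where
    bit : ∀ b → (if b then 1 else 0) ≡ ι b
    bit true  = refl
    bit false = refl

  length-matrix : length (matrix P) ≡ n * n
  length-matrix = length-product {n} {n} (λ (u , v) → if has P u v then 1 else 0) id

  holds-matrix : ∀ st → (∀ u v → memory st (toℕ u * n + toℕ v) ≡ ι (has P u v)) → Holds st (matrix P)
  holds-matrix st h i with Finₚ.combine-surjective {n} {n} (fromℕ< (subst (toℕ i <_) length-matrix (Finₚ.toℕ<n i)))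
  ... | u , v , e = begin
    memory st (toℕ i)                       ≡⟨ cong (memory st) position ⟩
    memory st (toℕ u * n + toℕ v)           ≡⟨ h u v ⟩
    ι (has P u v)                           ≡⟨ load-matrix u v ⟨
    load (matrix P) (toℕ u * n + toℕ v)     ≡⟨ cong (load (matrix P)) position ⟨
    load (matrix P) (toℕ i)                 ≡⟨ load-lookup (matrix P) i ⟩
    List.lookup (matrix P) i                ∎
    where
    open ≡-Reasoning
    position : toℕ i ≡ toℕ u * n + toℕ v
    position = trans (sym (trans (cong toℕ e) (Finₚ.toℕ-fromℕ< _)))
      (trans (Finₚ.toℕ-combine u v) (cong (_+ toℕ v) (*-comm n (toℕ u))))
    load-lookup : ∀ xs (i : Fin (length xs)) → load xs (toℕ i) ≡ List.lookup xs i
    load-lookup (x ∷ xs) zero    = refl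
    load-lookup (x ∷ xs) (suc i) = load-lookup xs i

extend : ∀ {n} → BRel n → ℕ → ℕ → Bool
extend {n} R u v with u <? n | v <? n
... | yes p | yes q = R (fromℕ< p) (fromℕ< q)
... | _     | _     = false

extend-toℕ : ∀ {n} (R : BRel n) u v → restrict n (extend R) u v ≡ R u v
extend-toℕ {n} R u v with toℕ u <? n | toℕ v <? n
... | yes p | yes q = cong₂ R (Finₚ.fromℕ<-toℕ u p) (Finₚ.fromℕ<-toℕ v q)
... | no p  | _     = contradiction (Finₚ.toℕ<n u) p
... | yes _ | no q  = contradiction (Finₚ.toℕ<n v) q

extend-sym : ∀ {n} (P : PairSet n) u v → restrict n (extend (has P)) u v ≡ restrict n (extend (has P)) v u
extend-sym P u v = trans (extend-toℕ (has P) u v) (trans (has-sym P u v) (sym (extend-toℕ (has P) v u)))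

arr-fin : ∀ {n} a (R : ℕ → ℕ → Bool) m → (∀ u v → m (addr n a (toℕ {n} u * n + toℕ {n} v)) ≡ ι (restrict n R u v)) →
          Arr n a (λ u v → ι (R u v)) m
arr-fin {n} a R m h u v p q = subst₂ (λ x y → m (addr n a (x * n + y)) ≡ ι (R x y))
  (Finₚ.toℕ-fromℕ< p) (Finₚ.toℕ-fromℕ< q) (h (fromℕ< p) (fromℕ< q))

≡ᵇ-toℕ : ∀ {n} (u v : Fin n) → (toℕ u ≡ᵇ toℕ v) ≡ u ≡ᵇᶠ v
≡ᵇ-toℕ u v with u Finₚ.≟ v
... | yes refl = ≡ᵇ-refl (toℕ u)
... | no p     = 𝔹ₚ.¬-not (λ q → p (Finₚ.toℕ-injective (≡ᵇ-true q)))

≡ᵇᶠ-sym : ∀ {n} (u v : Fin n) → u ≡ᵇᶠ v ≡ v ≡ᵇᶠ u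
≡ᵇᶠ-sym u v = trans (sym (≡ᵇ-toℕ u v)) (trans (≡ᵇ-sym (toℕ u) (toℕ v)) (≡ᵇ-toℕ v u))

editSet : ∀ {n} → Graph n → (X : BRel n) → IsEquiv X → PairSet n
editSet G X E .has = difference _≡ᵇᶠ_ (has G) X
editSet G X E .has-sym u v = cong₂ (λ a b → not a ∧ b) (≡ᵇᶠ-sym u v) (cong₂ _xor_ (has-sym G u v) (sy E u v))
editSet G X E .has-irrefl v rewrite ≡ᵇᶠ-refl v = refl

-- For want of multiplication, the square of `n` is accumulated by `n` additions.
initialise : Cmd
initialise =
  0 ≔ mem (const 0) ⨾ 1 ≔ const 0 ⨾ 2 ≔ const 0 ⨾
  whileNonzero (reg 0 ⊖ reg 2) (1 ≔ (reg 1 ⊕ reg 0) ⨾ 2 ≔ (reg 2 ⊕ const 1))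

initialiseTime : ℕ → ℕ
initialiseTime n = 1 + (1 + (1 + suc (n * suc (1 + 1))))

run-initialise : ∀ {n s} → memory s 0 ≡ n → Run initialise s (initialiseTime n) (λ s′ → Base n s′ × memory s′ ≡ memory s)
run-initialise {n} {s} p = run-⨾ (run-≔ (run-⨾ (run-≔ (run-⨾ (run-≔ (run-weaken ≤-refl
  (λ s′ (a , b , _ , d) → (a , b) , d)
  (run-for n I (λ j st (a , _ , c , _) → cong₂ _∸_ a c)
    (λ j st _ (a , b , c , d) → run-⨾ (run-≔ (run-≔
      (a , trans (cong₂ _+_ b a) (+-comm (j * n) n) , trans (cong (_+ 1) c) (+-comm j 1) , d))))
    (p , refl , refl , refl))))))))
  where
  I : ℕ → State → Set
  I j st = registers st 0 ≡ n × registers st 1 ≡ j * n × registers st 2 ≡ j × memory st ≡ memory s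

^-*-base : ∀ a b d → (a * b) ^ d ≡ a ^ d * b ^ d
^-*-base a b zero    = refl
^-*-base a b (suc d) rewrite ^-*-base a b d = rearranged a b (a ^ d) (b ^ d)
  where
  rearranged : ∀ a b x y → a * b * (x * y) ≡ a * x * (b * y)
  rearranged = solve-∀

poly-input : ∀ {T} → Poly T → ∃[ a ] ∃[ d ] ∀ n l → suc n ≤ l → T n ≤ a * l ^ d + a
poly-input {T} (poly d p) = 2 ^ d , d , λ n l n<l → begin
  T n                        ≤⟨ p n ⟩
  (2 + n) ^ d                ≤⟨ ^-monoˡ-≤ d (≤-trans (+-mono-≤ (≤-trans (s≤s z≤n) n<l) n<l) (≤-reflexive (cong (l +_) (sym (+-identityʳ l))))) ⟩
  (2 * l) ^ d                ≡⟨ ^-*-base 2 l d ⟩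
  2 ^ d * l ^ d              ≤⟨ m≤m+n _ (2 ^ d) ⟩
  2 ^ d * l ^ d + 2 ^ d      ∎
  where open ≤-Reasoning

-- 23/12 is 4600/2400 and 1.92 is 4608/2400. The factors 2 come from summing over ordered pairs.
ratio-192/100 : ∀ c c* → 12 * (2 * c) ≤ 23 * (2 * c*) → (ℤ.+ c ℚ./ 1) ℚ.≤ (ℤ.+ 192 ℚ./ 100) ℚ.* (ℤ.+ c* ℚ./ 1)
ratio-192/100 c c* h = ℚ.*≤* (subst₂ ℤ._≤_ (ℤₚ.pos-* c 100)
  (trans (ℤₚ.pos-* (192 * c*) 1) (cong (ℤ._* ℤ.+ 1) (ℤₚ.pos-* 192 c*))) (ℤ.+≤+ (*-cancelˡ-≤ 24 scaled)))
  where
  open ≤-Reasoning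
  scaled : 24 * (c * 100) ≤ 24 * (192 * c* * 1)
  scaled = begin
    24 * (c * 100)             ≡⟨ e₁ c ⟩
    100 * (12 * (2 * c))       ≤⟨ *-monoʳ-≤ 100 h ⟩
    100 * (23 * (2 * c*))      ≡⟨ e₂ c* ⟩
    4600 * c*                  ≤⟨ *-monoˡ-≤ c* (m≤m+n 4600 8) ⟩
    4608 * c*                  ≡⟨ e₃ c* ⟩
    24 * (192 * c* * 1)        ∎
    where
    e₁ : ∀ c → 24 * (c * 100) ≡ 100 * (12 * (2 * c))
    e₁ = solve-∀
    e₂ : ∀ c → 100 * (23 * (2 * c)) ≡ 4600 * c
    e₂ = solve-∀
    e₃ : ∀ c → 4608 * c ≡ 24 * (192 * c * 1)
    e₃ = solve-∀

-- The two problems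

record LocalOutcome (k n : ℕ) (G : Graph n) (f h : ℕ → ℕ → Bool) (final : State) : Set where
  field
    X       : BRel n
    equiv   : IsEquiv X
    rows    : RowsWithin (suc (pred k)) X
    holds   : Holds final (matrix (editSet G X equiv))
    ratio   : ∀ {O} (E : IsEquiv O) → RowSizes≤ E k → Respects (restrict n f) (restrict n h) O →
              ∀ D → (∀ u v → difference _≡ᵇᶠ_ (has G) O u v ≡ has D u v) →
              Respects (restrict n f) (restrict n h) X × 12 * (2 * size (editSet G X equiv)) ≤ 23 * (2 * size D)

localOutcome : ∀ {k n} (G : Graph n) {f h X final} → Outcome (pred k) n (extend (has G)) f h X →
  (∀ u v → u < n → v < n → memory final (u * n + v) ≡ ι (difference _≡ᵇ_ (extend (has G)) X u v)) →
  LocalOutcome k n G f h final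
localOutcome {k} {n} G {f} {h} {X} {final} out written = record
  { X = Y ; equiv = E ; rows = restrict-rows rows
  ; holds = holds-matrix (editSet G Y E) final (λ u v →
      trans (written (toℕ u) (toℕ v) (Finₚ.toℕ<n u) (Finₚ.toℕ<n v))
        (cong ι (cong₂ (λ d g → not d ∧ (g xor Y u v)) (≡ᵇ-toℕ u v) (extend-toℕ (has G) u v))))
  ; ratio = λ {O} EO sizes F D same → let F′ , le = ratio EO (sizes⇒rows EO sizes) F in F′ ,
      subst₂ (λ a b → 12 * a ≤ 23 * b)
        (trans (∑²-cong (λ u v → cong (λ g → ι (not (u ≡ᵇᶠ v) ∧ (g xor Y u v))) (extend-toℕ (has G) u v))) (size-doubled (editSet G Y E)))
        (trans (∑²-cong (λ u v → cong ι (trans (cong (λ g → not (u ≡ᵇᶠ v) ∧ (g xor O u v)) (extend-toℕ (has G) u v)) (same u v)))) (size-doubled D)) le }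
  where
  open Outcome out
  Y = restrict n X
  E = restrict-equiv {n} equiv

editSet-△ : ∀ {n} (G : Graph n) {X} (E : IsEquiv X) u v → has (G △ editSet G X E) u v ≡ not (u ≡ᵇᶠ v) ∧ X u v
editSet-△ G {X} E u v with u Finₚ.≟ v
... | yes refl rewrite has-irrefl G u = refl
... | no _ with has G u v | X u v
...   | true  | true  = refl
...   | true  | false = refl
...   | false | true  = refl
...   | false | false = refl

difference-△ : ∀ {n} (G D : PairSet n) u v → difference _≡ᵇᶠ_ (has G) (reflexive-closure (G △ D)) u v ≡ has D u v
difference-△ G D u v with u Finₚ.≟ v
... | yes refl = sym (has-irrefl D u)
... | no _ with has G u v | has D u v
...   | true  | true  = refl
...   | true  | false = refl
...   | false | true  = refl
...   | false | false = refl

constrainedProgram : ℕ → Cmd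
constrainedProgram k = initialise ⨾ main (pred k)

constrainedTime : ℕ → ℕ → ℕ
constrainedTime k n = initialiseTime n + mainTime (pred k) n

initialiseTime-poly : Poly initialiseTime
initialiseTime-poly = poly-+ (poly-const 4) (poly-* poly-id (poly-const 3))

1+n≤1+n*n+m : ∀ n m → suc n ≤ suc (n * n + m)
1+n≤1+n*n+m n m = s≤s (≤-trans (square n) (m≤m+n (n * n) m))
  where
  square : ∀ n → n ≤ n * n
  square zero    = z≤n
  square (suc n) = m≤m+n (suc n) (n * suc n)

run-constrained : ∀ k x → let open ConstrainedInstance x in
  Run (constrainedProgram k) (initial (order ∷ matrix graph ++ matrix friendly ++ matrix hostile)) (constrainedTime k order)
    (LocalOutcome k order graph (extend (has friendly)) (extend (has hostile)))
run-constrained k x = run-⨾ (run-weaken ≤-refl next (run-initialise refl))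
  where
  open ConstrainedInstance x
  n = order
  MG = matrix graph
  MF = matrix friendly
  MH = matrix hostile
  m₀ = load (n ∷ MG ++ MF ++ MH)
  short : ∀ (P : PairSet n) u v → toℕ u * n + toℕ v < length (matrix P)
  short P u v = subst (_ <_) (sym (length-matrix P)) (idx-< n n _ _ (Finₚ.toℕ<n u) (Finₚ.toℕ<n v))
  value : ∀ P u v → load (matrix P) (toℕ u * n + toℕ v) ≡ ι (restrict n (extend (has P)) u v)
  value P u v = trans (load-matrix P u v) (cong ι (sym (extend-toℕ (has P) u v)))
  G₀ : Arr n 0 (λ u v → ι (extend (has graph) u v)) m₀
  G₀ = arr-fin 0 _ m₀ λ u v → trans (load-++ˡ MG (MF ++ MH) (short graph u v)) (value graph u v)
  F₀ : Arr n 1 (λ u v → ι (extend (has friendly) u v)) m₀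
  F₀ = arr-fin 1 _ m₀ λ u v → begin
    load (MG ++ MF ++ MH) (1 * (n * n) + (toℕ u * n + toℕ v))
      ≡⟨ cong (λ l → load (MG ++ MF ++ MH) (l + (toℕ u * n + toℕ v))) (trans (+-identityʳ (n * n)) (sym (length-matrix graph))) ⟩
    load (MG ++ MF ++ MH) (length MG + (toℕ u * n + toℕ v))   ≡⟨ load-++ʳ MG (MF ++ MH) _ ⟩
    load (MF ++ MH) (toℕ u * n + toℕ v)                       ≡⟨ load-++ˡ MF MH (short friendly u v) ⟩
    load MF (toℕ u * n + toℕ v)                               ≡⟨ value friendly u v ⟩
    ι (restrict n (extend (has friendly)) u v)                ∎
    where open ≡-Reasoning
  H₀ : Arr n 2 (λ u v → ι (extend (has hostile) u v)) m₀
  H₀ = arr-fin 2 _ m₀ λ u v → begin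
    load (MG ++ MF ++ MH) (2 * (n * n) + (toℕ u * n + toℕ v))
      ≡⟨ cong (load (MG ++ MF ++ MH)) (trans (+-assoc (n * n) (n * n + 0) _)
           (cong₂ (λ l l′ → l + (l′ + (toℕ u * n + toℕ v))) (sym (length-matrix graph))
             (trans (+-identityʳ (n * n)) (sym (length-matrix friendly))))) ⟩
    load (MG ++ MF ++ MH) (length MG + (length MF + (toℕ u * n + toℕ v)))   ≡⟨ load-++ʳ MG (MF ++ MH) _ ⟩
    load (MF ++ MH) (length MF + (toℕ u * n + toℕ v))         ≡⟨ load-++ʳ MF MH _ ⟩
    load MH (toℕ u * n + toℕ v)                               ≡⟨ value hostile u v ⟩
    ι (restrict n (extend (has hostile)) u v)                 ∎
    where open ≡-Reasoning
  next : ∀ s → Base n s × memory s ≡ m₀ → Run (main (pred k)) s (mainTime (pred k) n) _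
  next ⟪ ρ , _ ⟫ (b , refl) = run-weaken ≤-refl (λ final (X , out , written) → localOutcome graph out written)
    (run-main (extend (has graph)) (extend (has friendly)) (extend (has hostile))
      (extend-sym graph) (extend-sym friendly) (extend-sym hostile) (pred k) b G₀ F₀ H₀)

module _ (P : MinimizationProblem) (ρ : ℚ.ℚᵘ) where
  open MinimizationProblem P

  Solves : (x : Instance) → State → Set
  Solves x final = ∃ (Feasible x) → ∃[ s ] Holds final (encodeSolution x s) × Approximates P ρ x s

  approximation : ∀ (order : Instance → ℕ) c {T} → Poly T → (∀ x → suc (order x) ≤ length (encodeInstance x)) →
    (∀ x → Run c (initial (encodeInstance x)) (T (order x)) (Solves x)) → HasPolyTimeApproximation P ρ
  approximation order c {T} p long run = c , a , d , λ x → conclude x (run x)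
    where
    a = proj₁ (poly-input p)
    d = proj₁ (proj₂ (poly-input p))
    conclude : ∀ x → Run c (initial (encodeInstance x)) (T (order x)) (Solves x) →
      ∃[ t ] ∃[ final ] (c , initial (encodeInstance x) ⇓[ t ] final) × t ≤ a * length (encodeInstance x) ^ d + a × Solves x final
    conclude x (t , final , r , t≤ , solved) =
      t , final , r , ≤-trans t≤ (proj₂ (proj₂ (poly-input p)) (order x) _ (long x)) , solved

constrained-approximation : ∀ k → HasPolyTimeApproximation (ConstrainedClustering k) (ℤ.+ 192 ℚ./ 100)
constrained-approximation k = approximation (ConstrainedClustering k) (ℤ.+ 192 ℚ./ 100) order (constrainedProgram k)
  (poly-+ initialiseTime-poly (mainTime-poly (pred k))) long
  (λ x → run-weaken ≤-refl (solve x) (run-constrained k x))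
  where
  open MinimizationProblem (ConstrainedClustering k)
  open ConstrainedInstance
  long : ∀ x → suc (order x) ≤ length (encodeInstance x)
  long x = subst (λ l → suc (order x) ≤ suc l)
    (sym (trans (length-++ (matrix (graph x))) (cong (_+ length (matrix (friendly x) ++ matrix (hostile x))) (length-matrix (graph x)))))
    (1+n≤1+n*n+m (order x) _)
  solve : ∀ x final → LocalOutcome k (order x) (graph x) (extend (has (friendly x))) (extend (has (hostile x))) final →
          Solves (ConstrainedClustering k) (ℤ.+ 192 ℚ./ 100) x final
  solve x final out (D₀ , F₀) =
    editSet G X equiv , holds , feasible (proj₁ (compare-with D₀ F₀)) {E = FromClusterGraph.X-equiv (graph x △ D₀) (proj₁ F₀)} (sizes D₀ F₀) ,
    λ D* (F* , _) → ratio-192/100 (size (editSet G X equiv)) (size D*) (proj₂ (compare-with D* F*))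
    where
    open LocalOutcome out
    G = graph x
    n = order x
    f = has (friendly x)
    h = has (hostile x)
    module _ (D : PairSet n) (F : Feasible x D) where
      open FromClusterGraph (G △ D) (proj₁ F)
      sizes : RowSizes≤ X-equiv k
      sizes r = proj₂ (proj₂ (proj₂ F)) _ (row-component r)
      compare-with : Respects (restrict n (extend f)) (restrict n (extend h)) X × 12 * (2 * size (editSet G X equiv)) ≤ 23 * (2 * size D)
      compare-with = ratio X-equiv sizes (record
        { together = λ u v p → connected⇒X (proj₁ (proj₂ F) u v (toT (trans (sym (extend-toℕ f u v)) p)))
        ; apart = λ u v p → 𝔹ₚ.¬-not (λ q → proj₁ (proj₂ (proj₂ F)) u v (toT (trans (sym (extend-toℕ h u v)) p)) (X⇒connected q)) })
        D (difference-△ G D)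
    module R = FromEquivalence (G △ editSet G X equiv) equiv (editSet-△ G equiv)
    feasible : Respects (restrict n (extend f)) (restrict n (extend h)) X → ∀ {O} {E : IsEquiv O} → RowSizes≤ E k → Feasible x (editSet G X equiv)
    feasible F {E = E} sizes = R.clusterGraph ,
      (λ u v p → R.adjacent (λ { refl → subst T (has-irrefl (friendly x) u) p })
                   (together F u v (trans (extend-toℕ f u v) (fromT p))) ◅ ε) ,
      (λ u v p c → contradiction (trans (sym (R.connected⇒X c)) (apart F u v (trans (extend-toℕ h u v) (fromT p)))) λ ()) ,
      -- A component contains a vertex, so in a feasible instance `k` is positive and the bound used
      -- by the search is `k` itself.
      λ S c → subst (∣ S ∣ ≤_) (sizes⇒suc-pred E sizes (proj₁ c)) (R.componentSizes rows S c)

markNonEdges : Cmd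
markNonEdges = pairs (ifNonzero diagonalE (⟦ addrE 2 ⟧≔ const 0) (⟦ addrE 2 ⟧≔ (const 1 ⊖ readE 0)))

-- Cluster Deletion is Constrained Clustering with all non-edges hostile and no friendly pairs: no
-- cluster may then contain a non-edge, so only edges are edited.
deletionProgram : ℕ → Cmd
deletionProgram k = initialise ⨾ markNonEdges ⨾ main (pred k)

deletionTime : ℕ → ℕ → ℕ
deletionTime k n = initialiseTime n + (pairsTime (λ _ → 2) n + mainTime (pred k) n)

nonEdge : (ℕ → ℕ → Bool) → ℕ → ℕ → Bool
nonEdge g u v = not (u ≡ᵇ v) ∧ not (g u v)

nonEdge-fin : ∀ {n} (G : Graph n) u v → restrict n (nonEdge (extend (has G))) u v ≡ not (u ≡ᵇᶠ v) ∧ not (has G u v)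
nonEdge-fin G u v = cong₂ (λ d g → not d ∧ not g) (≡ᵇ-toℕ u v) (extend-toℕ (has G) u v)

nonEdge-sym : ∀ {n} (G : Graph n) u v →
  restrict n (nonEdge (extend (has G))) u v ≡ restrict n (nonEdge (extend (has G))) v u
nonEdge-sym G u v = trans (nonEdge-fin G u v)
  (trans (cong₂ (λ d g → not d ∧ not g) (≡ᵇᶠ-sym u v) (has-sym G u v)) (sym (nonEdge-fin G v u)))

run-deletion : ∀ k n (G : Graph n) → Run (deletionProgram k) (initial (n ∷ matrix G)) (deletionTime k n)
  (LocalOutcome k n G (λ _ _ → false) (nonEdge (extend (has G))))
run-deletion k n G = run-⨾ (run-weaken ≤-refl next (run-initialise refl))
  where
  m₀ = load (n ∷ matrix G)
  g = extend (has G)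
  G₀ : Arr n 0 (λ u v → ι (g u v)) m₀
  G₀ = arr-fin 0 _ m₀ λ u v → trans (load-matrix G u v) (cong ι (sym (extend-toℕ (has G) u v)))
  -- The memory beyond the input is zero, so array 1 already encodes the empty set of friendly
  -- pairs.
  F₀ : Arr n 1 (λ u v → ι false) m₀
  F₀ u v _ _ = trans (cong (λ l → load (matrix G) (l + (u * n + v))) (trans (+-identityʳ (n * n)) (sym (length-matrix G))))
                 (load-beyond (matrix G) (u * n + v))
  value : ∀ d b → ι (not d ∧ not b) ≡ (if d then 0 else ι (not b))
  value true  b = refl
  value false b = refl
  Goal : State → Set
  Goal = LocalOutcome k n G (λ _ _ → false) (nonEdge g)
  next : ∀ s → Base n s × memory s ≡ m₀ → Run (markNonEdges ⨾ main (pred k)) s (pairsTime (λ _ → 2) n + mainTime (pred k) n) Goal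
  next s₀@(⟪ ρ , _ ⟫) (b , refl) = run-⨾ (run-weaken ≤-refl search (run-mapArray {T = λ _ → 2} 2 (λ u v → ι (nonEdge g u v))
    (λ u v s u<n v<n p q _ o _ → store-choice {s = s} 2 diagonalE (const 0) (const 1 ⊖ readE 0) (u ≡ᵇ v) p q (eval-diagonal s q)
      (λ t → sym (trans (value (u ≡ᵇ v) (g u v)) (cong (λ d → if d then 0 else ι (not (g u v))) t)))
      (λ t → trans (cong (1 ∸_) (read-arr {st = s} 0 (keep {n} {2} {0} (λ ()) o G₀) u<n v<n p q))
        (trans (not-arith (g u v)) (sym (trans (value (u ≡ᵇ v) (g u v)) (cong (λ d → if d then 0 else ι (not (g u v))) t)))))) b))
    where
    search : ∀ s → Filled n 2 (λ u v → ι (nonEdge g u v)) s₀ s → Run (main (pred k)) s (mainTime (pred k) n) Goal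
    search s (b′ , _ , H , o) = run-weaken ≤-refl (λ final (X , out , written) → localOutcome G out written)
      (run-main g (λ _ _ → false) (nonEdge g) (extend-sym G) (λ _ _ → refl) (nonEdge-sym G) (pred k) b′
        (keep {n} {2} {0} (λ ()) o G₀) (keep {n} {2} {1} (λ ()) o F₀) H)

deletion-approximation : ∀ k → HasPolyTimeApproximation (ClusterDeletion k) (ℤ.+ 192 ℚ./ 100)
deletion-approximation k = approximation (ClusterDeletion k) (ℤ.+ 192 ℚ./ 100) proj₁ (deletionProgram k)
  (poly-+ initialiseTime-poly (poly-+ (pairsTime-poly (poly-const 2)) (mainTime-poly (pred k)))) long
  (λ x → run-weaken ≤-refl (solve x) (run-deletion k (proj₁ x) (proj₁ (proj₂ x))))
  where
  open MinimizationProblem (ClusterDeletion k)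
  long : ∀ x → suc (proj₁ x) ≤ length (encodeInstance x)
  long (n , G , _) = subst (λ l → suc n ≤ suc l) (trans (+-identityʳ (n * n)) (sym (length-matrix G))) (1+n≤1+n*n+m n 0)
  solve : ∀ x final → LocalOutcome k (proj₁ x) (proj₁ (proj₂ x)) (λ _ _ → false) (nonEdge (extend (has (proj₁ (proj₂ x))))) final →
          Solves (ClusterDeletion k) (ℤ.+ 192 ℚ./ 100) x final
  solve x@(n , G , cliques) final out (D₀ , F₀) =
    editSet G X equiv , holds , feasible (proj₁ (compare-with D₀ F₀)) ,
    λ D* (F* , _) → ratio-192/100 (size (editSet G X equiv)) (size D*) (proj₂ (compare-with D* F*))
    where
    open LocalOutcome out
    h = nonEdge (extend (has G))
    module _ (D : PairSet n) (F : Feasible x D) where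
      open FromClusterGraph (G ∖ D) (proj₂ F)
      O = reflexive-closure (G ∖ D)
      edge : ∀ {u v} → u ≢ v → O u v ≡ true → Adj G u v
      edge {u} {v} p q rewrite ≡ᵇᶠ-≢ p = toT (proj₁ (∧-true q))
      same : ∀ u v → difference _≡ᵇᶠ_ (has G) O u v ≡ has D u v
      same u v with u Finₚ.≟ v
      ... | yes refl = sym (has-irrefl D u)
      ... | no _ with has D u v in d
      ...   | false with has G u v
      ...     | true  = refl
      ...     | false = refl
      same u v | no _ | true rewrite fromT (proj₁ F u v (toT d)) = refl
      compare-with : Respects (restrict n (λ _ _ → false)) (restrict n h) X × 12 * (2 * size (editSet G X equiv)) ≤ 23 * (2 * size D)
      compare-with = ratio X-equiv
        -- The clusters left by a deletion set are cliques of `G`, so the clique number supplies the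
        -- size bound.
        (λ r → cliques _ (λ u v p q u≢v → edge u≢v (tr X-equiv u r v
          (trans (sy X-equiv u r) (∈-tabulate⁻ (O r) p)) (∈-tabulate⁻ (O r) q))))
        (record { together = λ u v () ; apart = λ u v p → apart-nonEdge u v (trans (sym (nonEdge-fin G u v)) p) })
        D same
        where
        apart-nonEdge : ∀ u v → not (u ≡ᵇᶠ v) ∧ not (has G u v) ≡ true → O u v ≡ false
        apart-nonEdge u v p with u Finₚ.≟ v
        ... | no _ rewrite not-true p = refl
    feasible : Respects (restrict n (λ _ _ → false)) (restrict n h) X → Feasible x (editSet G X equiv)
    feasible F = (λ u v p → toT (deleted u v (fromT p))) , clusterGraph
      where
      nonEdge-apart : ∀ u v → not (u ≡ᵇᶠ v) ≡ true → has G u v ≡ false → X u v ≡ false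
      nonEdge-apart u v p q = apart F u v (trans (nonEdge-fin G u v) (cong₂ (λ d g → d ∧ not g) p q))
      deleted : ∀ u v → difference _≡ᵇᶠ_ (has G) X u v ≡ true → has G u v ≡ true
      deleted u v p with not (u ≡ᵇᶠ v) in d | has G u v in g
      ... | true | true  = refl
      ... | true | false = trans (sym (nonEdge-apart u v d g)) p
      remaining : ∀ u v → has (G ∖ editSet G X equiv) u v ≡ not (u ≡ᵇᶠ v) ∧ X u v
      remaining u v with u Finₚ.≟ v | nonEdge-apart u v
      ... | yes refl | _ rewrite has-irrefl G u = refl
      ... | no p | apart-uv with has G u v in g
      ...   | false = sym (apart-uv refl refl)
      ...   | true with X u v
      ...     | true  = refl
      ...     | false = refl
      open FromEquivalence (G ∖ editSet G X equiv) equiv remaining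

open import Data.Integer using (+_)
open import Data.Rational.Unnormalised using (_/_)

theorem1p4 : (k : ℕ) →
    HasPolyTimeApproximation (ClusterDeletion k) (+ 192 / 100) ×
    HasPolyTimeApproximation (ConstrainedClustering k) (+ 192 / 100)
theorem1p4 k = deletion-approximation k , constrained-approximation k
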